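{- For all $k\geq 2$, $$\sum_{n\geq0}J^e_{2134\cdots k;1}(n)\,x^n=(1-x^2)\sum_{j=2}^{k-1}\frac{x^{k+2-j}R^e_j(x^2)\prod_{i=j+1}^{k}R_i(-x^2)}{U_{j+1}\left(\frac{1}{2x}\right)}.$$
   Context: $2134\cdots k$ denotes the permutation $(2,1,3,4,\dots,k)$ (for $k=2$ it is $21$). An occurrence of a pattern $\tau\in\mathfrak{S}_m$ in $\pi\in\mathfrak{S}_n$ is an index set $i_1<\dots<i_m$ with $\pi_{i_1}\cdots\pi_{i_m}$ order-isomorphic to $\tau$. $J^e_{\tau;r}(n)$ is the number of even involutions $\pi\in\mathfrak{S}_n$ ($\pi=\pi^{ -1}$ with an even number of inversions, pairs $i<j$ with $\pi_i>\pi_j$) containing $132$ exactly once and $\tau$ exactly $r$ times. $U_r$ is the Chebyshev polynomial of the second kind ($U_0=1$, $U_1(t)=2t$, $U_r(t)=2tU_{r-1}(t)-U_{r-2}(t)$). For $k\geq1$, $R_k(x)=\dfrac{U_{k-1}\left(\frac{1}{2\sqrt{x}}\right)}{\sqrt{x}\,U_k\left(\frac{1}{2\sqrt{x}}\right)}$ (rational in $x$; $R_1=1$, $R_k=1/(1-xR_{k-1})$), and $R^e_k(x)=\tfrac12(R_k(x)+R_k(-x))$. An empty sum is $0$. -}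

module Defs where

open import Data.Bool using (Bool; true; false; _∧_; if_then_else_)
open import Data.Nat using (ℕ; zero; suc; _∸_; _<ᵇ_; _≡ᵇ_)
open import Data.Integer using (ℤ; +_; -_; _+_; _-_; _*_)
open import Data.List using (List; []; _∷_; _++_; map; concatMap; upTo; length; filterᵇ; zipWith)
open import Data.Bool.ListAction using (and)
import Data.List as L

-- Permutations of {0,…,n-1} represented as words π₀π₁…π_{n-1} (0-based
-- values; patterns are compared only up to order-isomorphism).

words : ℕ → ℕ → List (List ℕ)
words n zero    = [] ∷ []
words n (suc m) = concatMap (λ w → map (_∷ w) (upTo n)) (words n m)

-- i-th entry (0-based) of a word, 0 if out of range
at : List ℕ → ℕ → ℕ
at []       _       = 0
at (x ∷ xs) zero    = x
at (x ∷ xs) (suc i) = at xs i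

notElem : ℕ → List ℕ → Bool
notElem x []       = true
notElem x (y ∷ ys) = if x ≡ᵇ y then false else notElem x ys

distinct : List ℕ → Bool
distinct []       = true
distinct (x ∷ xs) = notElem x xs ∧ distinct xs

perms : ℕ → List (List ℕ)
perms n = filterᵇ distinct (words n n)

isInvolution : List ℕ → Bool
isInvolution w = and (map (λ i → at w (at w i) ≡ᵇ i) (upTo (length w)))

inversions : List ℕ → ℕ
inversions []       = 0
inversions (x ∷ xs) = length (filterᵇ (λ y → y <ᵇ x) xs) Data.Nat.+ inversions xs

isEvenℕ : ℕ → Bool
isEvenℕ zero          = true
isEvenℕ (suc zero)    = false
isEvenℕ (suc (suc n)) = isEvenℕ n

half : ℕ → ℕ
half zero          = zero
half (suc zero)    = zero
half (suc (suc n)) = suc (half n)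

subseqs : ℕ → List ℕ → List (List ℕ)
subseqs zero    _        = [] ∷ []
subseqs (suc m) []       = []
subseqs (suc m) (x ∷ xs) = map (x ∷_) (subseqs m xs) ++ subseqs (suc m) xs

_==_ : Bool → Bool → Bool
true  == b = b
false == true  = false
false == false = true

-- s is order-isomorphic to τ (both of length |τ|, with distinct entries)
orderIso : List ℕ → List ℕ → Bool
orderIso τ s =
  (length s ≡ᵇ length τ) ∧
  and (concatMap (λ a → map (λ b → (at s a <ᵇ at s b) == (at τ a <ᵇ at τ b))
                            (upTo (length τ)))
                 (upTo (length τ)))

occurrences : List ℕ → List ℕ → ℕ
occurrences τ π = length (filterᵇ (orderIso τ) (subseqs (length τ) π))

p132 : List ℕ
p132 = 1 ∷ 3 ∷ 2 ∷ []

-- the pattern 2134⋯k = (2,1,3,4,…,k)  (k ≥ 2; for k = 2 it is 21)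
p2134 : ℕ → List ℕ
p2134 k = 2 ∷ 1 ∷ map (λ i → i Data.Nat.+ 3) (upTo (k ∸ 2))

Je : List ℕ → ℕ → ℕ → ℕ
Je τ r n = length (filterᵇ
  (λ π → isInvolution π ∧ isEvenℕ (inversions π)
         ∧ (occurrences p132 π ≡ᵇ 1) ∧ (occurrences τ π ≡ᵇ r))
  (perms n))

Series : Set
Series = ℕ → ℤ

sumℤ : List ℤ → ℤ
sumℤ = L.foldr _+_ (+ 0)

one : Series
one zero    = + 1
one (suc _) = + 0

X^ : ℕ → Series
X^ m n = if m ≡ᵇ n then + 1 else + 0

_⊕_ : Series → Series → Series
(a ⊕ b) n = a n + b n

_⊖_ : Series → Series → Series
(a ⊖ b) n = a n - b n

_⊛_ : Series → Series → Series
(a ⊛ b) n = sumℤ (map (λ i → a i * b (n ∸ i)) (upTo (suc n)))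

infixl 7 _⊛_
infixl 6 _⊕_ _⊖_

-- multiplicative inverse of a series with constant term 1:
-- b₀ = 1, b_{n} = - Σ_{i=1}^{n} a_i b_{n-i}.
-- invRev a n = [b_n, b_{n-1}, …, b_0]
invRev : Series → ℕ → List ℤ
invRev a zero    = + 1 ∷ []
invRev a (suc n) =
  let bs = invRev a n
  in - sumℤ (zipWith _*_ (map (λ i → a (suc i)) (upTo (length bs))) bs) ∷ bs

inv : Series → Series
inv a n with invRev a n
... | []    = + 0
... | b ∷ _ = b

negArg : Series → Series
negArg a n = if isEvenℕ n then a n else - a n

sq : Series → Series
sq a n = if isEvenℕ n then a (half n) else + 0

evenPart : Series → Series
evenPart a n = if isEvenℕ n then a n else + 0

-- R_k(x) for k ≥ 1:  R_1 = 1, R_k = 1/(1 - x R_{k-1})   (R 0 is unused junk)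
R : ℕ → Series
R zero             = one
R (suc zero)       = one
R (suc (suc k))    = inv (one ⊖ X^ 1 ⊛ R (suc k))

Re : ℕ → Series
Re k = evenPart (R k)

-- Ũ_m(x) = x^m U_m(1/(2x)):  Ũ_0 = 1, Ũ_1 = 1, Ũ_m = Ũ_{m-1} - x² Ũ_{m-2}
Ũ : ℕ → Series
Ũ zero          = one
Ũ (suc zero)    = one
Ũ (suc (suc m)) = Ũ (suc m) ⊖ X^ 2 ⊛ Ũ m

-- 1 / U_m(1/(2x)) = x^m / Ũ_m(x)
invU : ℕ → Series
invU m = X^ m ⊛ inv (Ũ m)

-- Σ_{j=a}^{b} f j   (empty if b < a)
sumFromTo : ℕ → ℕ → (ℕ → Series) → Series
sumFromTo a b f n = sumℤ (map (λ i → f (a Data.Nat.+ i) n) (upTo (suc b ∸ a)))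

-- Π_{i=a}^{b} f i   (1 if b < a)
prodFromTo : ℕ → ℕ → (ℕ → Series) → Series
prodFromTo a b f = L.foldr (λ i acc → f (a Data.Nat.+ i) ⊛ acc) one (upTo (suc b ∸ a))

{-# OPTIONS --safe #-}
-- An involution containing 132 exactly once is built from a core ⟨A, m, N, A⁻¹, m+1⟩, with A avoiding 132,
-- by appending new maxima and wrapping as ⟨A, N, ·, A⁻¹, m⟩; this is read off the position of the maximum N.
-- Write τ_k for 2134⋯k, k ≥ 3.  A core contains τ_k an even number of times, wrapping adds an even number of
-- occurrences (none iff A avoids τ_{k-1}), and a new maximum adds as many as there were of τ_{k-1}.  So the
-- generating function g_k, y marking 2-cycles, of the involutions containing τ_k once satisfies
-- g_k = g_{k-1} + y R_{k-1} g_k, i.e. g_k = g_{k-1} R_k, where g_2 = y accounts for 132 itself.  There k - 1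
-- points are fixed and the sign is the parity of the number of 2-cycles, so the series sought is x^{k-1}
-- times the even part of g_k at y = x².  The sum over j results from iterating
-- R_k(y) - R_k(-y) = y R_k(y) R_k(-y) (R_{k-1}(y) + R_{k-1}(-y)).
module Submission where

open import Defs

-- Since 132 is its own inverse, an involution mirrors each occurrence of 132 to an occurrence of
-- 132, and a single occurrence is its own mirror image. If its 3 is the maximum, its 1 must
-- therefore be a fixed point and its 2 the last letter, which forces the core; otherwise every
-- letter before the maximum exceeds every letter after it.
--
-- Permutations avoiding 132 are binary trees, split at the maximum. The left subtree is followed by
-- a larger letter, so avoiding τ_k means that the left subtree avoids τ_{k-1} and the right one
-- τ_k: this is the recursion of R_k.
--
-- A new maximum produces exactly one τ_k only if τ_{k-1} occurs once and τ_k does not occur. For k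
-- > 3 the first condition implies the second; for k = 3 the two together leave only 132 among the
-- involutions with one inversion. Hence g_2 is not the count for k = 2, and that case is settled by
-- parity.
--
-- The factor 1 - x² is `Ũ 2`: as R_k(x²) is the quotient of `Ũ (k - 1)` by `Ũ k`, the product
-- g_k(x²) telescopes to x² `Ũ 2` / `Ũ k`.

module PowerSeries where

  open import Algebra.Bundles using (CommutativeRing)
  open import Algebra.Solver.Ring.AlmostCommutativeRing using (fromCommutativeRing; _-Raw-AlmostCommutative⟶_)
  import Algebra.Solver.Ring
  open import Data.Bool using (true; false)
  open import Data.Integer using (ℤ; +-*-rawRing; +_; -_; _+_; _*_)
  import Data.Integer.Properties as ℤ
  open import Data.Integer.Tactic.RingSolver using (solve-∀)
  open import Data.List using (List; []; _∷_; _∷ʳ_; map; upTo; applyUpTo; length; zipWith; foldr)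
  open import Data.List.Properties using (map-applyUpTo; map-cong; length-applyUpTo; map-++; foldr-∷ʳ; upTo-∷ʳ)
  open import Data.Maybe using (Maybe; just; nothing)
  open import Data.Nat using (ℕ; zero; suc; _∸_; _≤_; s≤s)
  import Data.Nat as ℕ
  import Data.Nat.Properties as ℕ
  open import Data.Product using (_,_)
  open import Function using (_∘_; id)
  open import Level using (0ℓ)
  open import Relation.Binary.PropositionalEquality using (_≡_; refl; sym; trans; cong; cong₂; module ≡-Reasoning)
  import Relation.Binary.Reasoning.Setoid
  open import Relation.Nullary using (yes; no)

  -- Formal power series over the integers as a commutative ring

  infix 4 _≈_
  -- A record rather than a bare family of equations, so that unification can recover the two series
  -- from the type of a proof.
  record _≈_ (a b : Series) : Set where
    constructor pointwise
    field coeff : ∀ n → a n ≡ b n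
  open _≈_ public

  tl : Series → Series
  tl a n = a (suc n)

  const : ℤ → Series
  const c zero    = c
  const c (suc _) = + 0

  neg : Series → Series
  neg a n = - a n

  map-upTo : ∀ {A : Set} (f : ℕ → A) n → map f (upTo n) ≡ applyUpTo f n
  map-upTo f n = map-applyUpTo id f n

  ⊛-zero : ∀ a b → (a ⊛ b) 0 ≡ a 0 * b 0
  ⊛-zero a b = ℤ.+-identityʳ _

  -- Peeling off `a 0` turns convolution into a recursion on the tail of `a`; the ring laws then
  -- follow by induction on the exponent.
  ⊛-suc : ∀ a b n → (a ⊛ b) (suc n) ≡ a 0 * b (suc n) + (tl a ⊛ b) n
  ⊛-suc a b n = cong (λ l → a 0 * b (suc n) + sumℤ l)
    (trans (map-applyUpTo suc (λ i → a i * b (suc n ∸ i)) (suc n))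
           (sym (map-upTo (λ i → a (suc i) * b (n ∸ i)) (suc n))))

  -- Peels from the other end. The two recursions are exchanged by swapping the factors, whence
  -- commutativity.
  ⊛-sucʳ : ∀ a b n → (a ⊛ b) (suc n) ≡ (a ⊛ tl b) n + a (suc n) * b 0
  ⊛-sucʳ a b zero =
    trans (⊛-suc a b 0) (cong₂ _+_ (sym (⊛-zero a (tl b))) (⊛-zero (tl a) b))
  ⊛-sucʳ a b (suc n) = begin
    (a ⊛ b) (suc (suc n))
      ≡⟨ ⊛-suc a b (suc n) ⟩
    a 0 * b (suc (suc n)) + (tl a ⊛ b) (suc n)
      ≡⟨ cong (_+_ (a 0 * b (suc (suc n)))) (⊛-sucʳ (tl a) b n) ⟩
    a 0 * b (suc (suc n)) + ((tl a ⊛ tl b) n + a (suc (suc n)) * b 0)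
      ≡⟨ ℤ.+-assoc (a 0 * b (suc (suc n))) _ _ ⟨
    a 0 * b (suc (suc n)) + (tl a ⊛ tl b) n + a (suc (suc n)) * b 0
      ≡⟨ cong (_+ a (suc (suc n)) * b 0) (⊛-suc a (tl b) n) ⟨
    (a ⊛ tl b) (suc n) + a (suc (suc n)) * b 0 ∎
    where open ≡-Reasoning

  ⊛-cong : ∀ {a a′ b b′} → a ≈ a′ → b ≈ b′ → (a ⊛ b) ≈ (a′ ⊛ b′)
  ⊛-cong p q = pointwise λ n →
    cong sumℤ (map-cong (λ i → cong₂ _*_ (coeff p i) (coeff q (n ∸ i))) (upTo (suc n)))

  ⊛-comm : ∀ a b → (a ⊛ b) ≈ (b ⊛ a)
  ⊛-comm a b = pointwise (go a b)
    where
    go : ∀ a b n → (a ⊛ b) n ≡ (b ⊛ a) n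
    go a b zero = trans (⊛-zero a b) (trans (ℤ.*-comm (a 0) (b 0)) (sym (⊛-zero b a)))
    go a b (suc n) = begin
      (a ⊛ b) (suc n)                     ≡⟨ ⊛-suc a b n ⟩
      a 0 * b (suc n) + (tl a ⊛ b) n      ≡⟨ ℤ.+-comm (a 0 * b (suc n)) _ ⟩
      (tl a ⊛ b) n + a 0 * b (suc n)      ≡⟨ cong₂ _+_ (go (tl a) b n) (ℤ.*-comm (a 0) _) ⟩
      (b ⊛ tl a) n + b (suc n) * a 0      ≡⟨ ⊛-sucʳ b a n ⟨
      (b ⊛ a) (suc n)                     ∎
      where open ≡-Reasoning

  ⊛-distribʳ : ∀ c a b → ((a ⊕ b) ⊛ c) ≈ (a ⊛ c ⊕ b ⊛ c)
  ⊛-distribʳ c a b = pointwise (go a b)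
    where
    lem : ∀ x y z u v → (x + y) * z + (u + v) ≡ (x * z + u) + (y * z + v)
    lem = solve-∀
    go : ∀ a b n → ((a ⊕ b) ⊛ c) n ≡ (a ⊛ c ⊕ b ⊛ c) n
    go a b zero = trans (⊛-zero (a ⊕ b) c)
      (trans (ℤ.*-distribʳ-+ (c 0) (a 0) (b 0)) (sym (cong₂ _+_ (⊛-zero a c) (⊛-zero b c))))
    go a b (suc n) = begin
      ((a ⊕ b) ⊛ c) (suc n)                              ≡⟨ ⊛-suc (a ⊕ b) c n ⟩
      (a 0 + b 0) * c (suc n) + ((tl a ⊕ tl b) ⊛ c) n    ≡⟨ cong (_+_ ((a 0 + b 0) * c (suc n))) (go (tl a) (tl b) n) ⟩
      (a 0 + b 0) * c (suc n) + ((tl a ⊛ c) n + (tl b ⊛ c) n) ≡⟨ lem (a 0) (b 0) (c (suc n)) _ _ ⟩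
      (a 0 * c (suc n) + (tl a ⊛ c) n) + (b 0 * c (suc n) + (tl b ⊛ c) n)
        ≡⟨ cong₂ _+_ (⊛-suc a c n) (⊛-suc b c n) ⟨
      (a ⊛ c ⊕ b ⊛ c) (suc n) ∎
      where open ≡-Reasoning

  scale : ℤ → Series → Series
  scale k a n = k * a n

  scale-⊛ : ∀ k a b n → (scale k a ⊛ b) n ≡ k * (a ⊛ b) n
  scale-⊛ k a b zero = trans (⊛-zero (scale k a) b)
    (trans (ℤ.*-assoc k (a 0) (b 0)) (cong (k *_) (sym (⊛-zero a b))))
  scale-⊛ k a b (suc n) = begin
    (scale k a ⊛ b) (suc n)                          ≡⟨ ⊛-suc (scale k a) b n ⟩
    k * a 0 * b (suc n) + (scale k (tl a) ⊛ b) n     ≡⟨ cong₂ _+_ (ℤ.*-assoc k (a 0) _) (scale-⊛ k (tl a) b n) ⟩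
    k * (a 0 * b (suc n)) + k * (tl a ⊛ b) n         ≡⟨ ℤ.*-distribˡ-+ k _ _ ⟨
    k * (a 0 * b (suc n) + (tl a ⊛ b) n)             ≡⟨ cong (k *_) (⊛-suc a b n) ⟨
    k * (a ⊛ b) (suc n)                              ∎
    where open ≡-Reasoning

  ⊛-assoc : ∀ a b c → (a ⊛ b ⊛ c) ≈ (a ⊛ (b ⊛ c))
  ⊛-assoc a b c = pointwise (go a)
    where
    lem : ∀ x y z u v → x * y * z + (x * u + v) ≡ x * (y * z + u) + v
    lem = solve-∀
    go : ∀ a n → (a ⊛ b ⊛ c) n ≡ (a ⊛ (b ⊛ c)) n
    go a zero = begin
      (a ⊛ b ⊛ c) 0       ≡⟨ ⊛-zero (a ⊛ b) c ⟩
      (a ⊛ b) 0 * c 0     ≡⟨ cong (_* c 0) (⊛-zero a b) ⟩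
      a 0 * b 0 * c 0     ≡⟨ ℤ.*-assoc (a 0) (b 0) (c 0) ⟩
      a 0 * (b 0 * c 0)   ≡⟨ cong (a 0 *_) (⊛-zero b c) ⟨
      a 0 * (b ⊛ c) 0     ≡⟨ ⊛-zero a (b ⊛ c) ⟨
      (a ⊛ (b ⊛ c)) 0     ∎
      where open ≡-Reasoning
    go a (suc n) = begin
      (a ⊛ b ⊛ c) (suc n)
        ≡⟨ ⊛-suc (a ⊛ b) c n ⟩
      (a ⊛ b) 0 * c (suc n) + (tl (a ⊛ b) ⊛ c) n
        ≡⟨ cong₂ _+_ (cong (_* c (suc n)) (⊛-zero a b)) (coeff (⊛-cong (pointwise (⊛-suc a b)) (pointwise {c} λ _ → refl)) n) ⟩
      a 0 * b 0 * c (suc n) + ((scale (a 0) (tl b) ⊕ (tl a ⊛ b)) ⊛ c) n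
        ≡⟨ cong (_+_ (a 0 * b 0 * c (suc n))) (coeff (⊛-distribʳ c (scale (a 0) (tl b)) (tl a ⊛ b)) n) ⟩
      a 0 * b 0 * c (suc n) + ((scale (a 0) (tl b) ⊛ c) n + (tl a ⊛ b ⊛ c) n)
        ≡⟨ cong (_+_ (a 0 * b 0 * c (suc n))) (cong₂ _+_ (scale-⊛ (a 0) (tl b) c n) (go (tl a) n)) ⟩
      a 0 * b 0 * c (suc n) + (a 0 * (tl b ⊛ c) n + (tl a ⊛ (b ⊛ c)) n)
        ≡⟨ lem (a 0) (b 0) (c (suc n)) _ _ ⟩
      a 0 * (b 0 * c (suc n) + (tl b ⊛ c) n) + (tl a ⊛ (b ⊛ c)) n
        ≡⟨ cong (λ t → a 0 * t + (tl a ⊛ (b ⊛ c)) n) (⊛-suc b c n) ⟨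
      a 0 * (b ⊛ c) (suc n) + (tl a ⊛ (b ⊛ c)) n
        ≡⟨ ⊛-suc a (b ⊛ c) n ⟨
      (a ⊛ (b ⊛ c)) (suc n) ∎
      where open ≡-Reasoning

  const-0-⊛ : ∀ b n → (const (+ 0) ⊛ b) n ≡ + 0
  const-0-⊛ b zero = ⊛-zero (const (+ 0)) b
  const-0-⊛ b (suc n) = trans (⊛-suc (const (+ 0)) b n)
    (trans (ℤ.+-identityˡ _)
      (trans (coeff (⊛-cong (pointwise {tl (const (+ 0))} {const (+ 0)} λ { zero → refl ; (suc _) → refl })
                            (pointwise {b} λ _ → refl)) n)
             (const-0-⊛ b n)))

  const-⊛ : ∀ c b n → (const c ⊛ b) n ≡ c * b n
  const-⊛ c b zero = ⊛-zero (const c) b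
  const-⊛ c b (suc n) = trans (⊛-suc (const c) b n)
    (trans (cong (_+_ (c * b (suc n)))
      (trans (coeff (⊛-cong (pointwise {tl (const c)} {const (+ 0)} λ { zero → refl ; (suc _) → refl })
                            (pointwise {b} λ _ → refl)) n)
             (const-0-⊛ b n))) (ℤ.+-identityʳ _))

  one≈const : one ≈ const (+ 1)
  one≈const = pointwise λ { zero → refl ; (suc _) → refl }

  ⊛-identityˡ : ∀ a → (one ⊛ a) ≈ a
  ⊛-identityˡ a = pointwise λ n →
    trans (coeff (⊛-cong one≈const (pointwise {a} λ _ → refl)) n)
      (trans (const-⊛ (+ 1) a n) (ℤ.*-identityˡ (a n)))

  seriesRing : CommutativeRing 0ℓ 0ℓ
  seriesRing = record
    { Carrier = Series ; _≈_ = _≈_ ; _+_ = _⊕_ ; _*_ = _⊛_ ; -_ = neg ; 0# = const (+ 0) ; 1# = one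
    ; isCommutativeRing = record
      { isRing = record
        { +-isAbelianGroup = record
          { isGroup = record
            { isMonoid = record
              { isSemigroup = record
                { isMagma = record
                  { isEquivalence = record
                    { refl = pointwise λ _ → refl
                    ; sym = λ p → pointwise λ n → sym (coeff p n)
                    ; trans = λ p q → pointwise λ n → trans (coeff p n) (coeff q n) }
                  ; ∙-cong = λ p q → pointwise λ n → cong₂ _+_ (coeff p n) (coeff q n) }
                ; assoc = λ a b c → pointwise λ n → ℤ.+-assoc (a n) (b n) (c n) }
              ; identity = (λ a → pointwise λ { zero → ℤ.+-identityˡ _ ; (suc n) → ℤ.+-identityˡ _ })
                         , (λ a → pointwise λ { zero → ℤ.+-identityʳ _ ; (suc n) → ℤ.+-identityʳ _ }) }
            ; inverse = (λ a → pointwise λ { zero → ℤ.+-inverseˡ (a 0) ; (suc n) → ℤ.+-inverseˡ (a (suc n)) })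
                      , (λ a → pointwise λ { zero → ℤ.+-inverseʳ (a 0) ; (suc n) → ℤ.+-inverseʳ (a (suc n)) })
            ; ⁻¹-cong = λ p → pointwise λ n → cong -_ (coeff p n) }
          ; comm = λ a b → pointwise λ n → ℤ.+-comm (a n) (b n) }
        ; *-cong = ⊛-cong
        ; *-assoc = ⊛-assoc
        ; *-identity = ⊛-identityˡ
                     , λ a → pointwise λ n → trans (coeff (⊛-comm a one) n) (coeff (⊛-identityˡ a) n)
        ; distrib = (λ c a b → pointwise λ n →
                       trans (coeff (⊛-comm c (a ⊕ b)) n)
                         (trans (coeff (⊛-distribʳ c a b) n)
                           (cong₂ _+_ (coeff (⊛-comm a c) n) (coeff (⊛-comm b c) n))))
                  , ⊛-distribʳ }
      ; *-comm = ⊛-comm } }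

  module S = CommutativeRing seriesRing

  -- Makes integer literals available to the ring solver. They appear as `const`, which is why `one`
  -- is converted by `one≈const` around calls of the solver.
  const-homomorphism : +-*-rawRing -Raw-AlmostCommutative⟶ fromCommutativeRing seriesRing
  const-homomorphism = record
    { ⟦_⟧ = const
    ; +-homo = λ x y → pointwise λ { zero → refl ; (suc _) → refl }
    ; *-homo = λ x y → pointwise λ n → sym (trans (const-⊛ x (const y) n) (lem x y n))
    ; -‿homo = λ x → pointwise λ { zero → refl ; (suc _) → refl }
    ; 0-homo = pointwise λ { zero → refl ; (suc _) → refl }
    ; 1-homo = S.sym one≈const }
    where
    lem : ∀ x y n → x * const y n ≡ const (x * y) n
    lem x y zero = refl
    lem x y (suc n) = ℤ.*-zeroʳ x

  const-≟ : ∀ x y → Maybe (const x ≈ const y)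
  const-≟ x y with x ℤ.≟ y
  ... | yes p = just (pointwise λ n → cong (λ c → const c n) p)
  ... | no _  = nothing

  module Solver = Algebra.Solver.Ring +-*-rawRing (fromCommutativeRing seriesRing)
    const-homomorphism const-≟

  -- Inverses of power series

  invRev-inv : ∀ a n → invRev a n ≡ applyUpTo (λ i → inv a (n ∸ i)) (suc n)
  invRev-inv a zero = refl
  invRev-inv a (suc n) = cong (inv a (suc n) ∷_) (invRev-inv a n)

  zipWith-applyUpTo : ∀ (f g : ℕ → ℤ) m →
    zipWith _*_ (map f (upTo (length (applyUpTo g m)))) (applyUpTo g m) ≡ applyUpTo (λ i → f i * g i) m
  zipWith-applyUpTo f g m = trans
    (cong (λ l → zipWith _*_ l (applyUpTo g m))
      (trans (cong (λ l → map f (upTo l)) (length-applyUpTo g m)) (map-upTo f m)))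
    (go f g m)
    where
    go : ∀ (f g : ℕ → ℤ) m → zipWith _*_ (applyUpTo f m) (applyUpTo g m) ≡ applyUpTo (λ i → f i * g i) m
    go f g zero = refl
    go f g (suc m) = cong (f 0 * g 0 ∷_) (go (f ∘ suc) (g ∘ suc) m)

  -- The sum that defines the next coefficient pairs `tl a` with the earlier coefficients in reverse
  -- order, so it is a convolution.
  inv-suc : ∀ a n → inv a (suc n) ≡ - (tl a ⊛ inv a) n
  inv-suc a n = cong (λ l → - sumℤ l) (begin
    zipWith _*_ (map (tl a) (upTo (length (invRev a n)))) (invRev a n)
      ≡⟨ cong (λ l → zipWith _*_ (map (tl a) (upTo (length l))) l) (invRev-inv a n) ⟩
    zipWith _*_ (map (tl a) (upTo (length (applyUpTo g (suc n))))) (applyUpTo g (suc n))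
      ≡⟨ zipWith-applyUpTo (tl a) g (suc n) ⟩
    applyUpTo (λ i → tl a i * g i) (suc n)
      ≡⟨ map-upTo _ (suc n) ⟨
    map (λ i → tl a i * g i) (upTo (suc n)) ∎)
    where
    open ≡-Reasoning
    g : Series
    g i = inv a (n ∸ i)

  ⊛-inverse : ∀ a → a 0 ≡ + 1 → (a ⊛ inv a) ≈ one
  ⊛-inverse a a₀ = pointwise go
    where
    open ≡-Reasoning
    go : ∀ n → (a ⊛ inv a) n ≡ one n
    go zero = trans (⊛-zero a (inv a)) (trans (ℤ.*-identityʳ (a 0)) a₀)
    go (suc n) = begin
      (a ⊛ inv a) (suc n)                          ≡⟨ ⊛-suc a (inv a) n ⟩
      a 0 * inv a (suc n) + (tl a ⊛ inv a) n       ≡⟨ cong (λ t → t * inv a (suc n) + (tl a ⊛ inv a) n) a₀ ⟩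
      + 1 * inv a (suc n) + (tl a ⊛ inv a) n       ≡⟨ cong (_+ (tl a ⊛ inv a) n) (trans (ℤ.*-identityˡ (inv a (suc n))) (inv-suc a n)) ⟩
      - (tl a ⊛ inv a) n + (tl a ⊛ inv a) n        ≡⟨ ℤ.+-inverseˡ ((tl a ⊛ inv a) n) ⟩
      + 0 ∎

  module ≈-Reasoning = Relation.Binary.Reasoning.Setoid S.setoid

  ⊛-congˡ : ∀ a {b c} → b ≈ c → (a ⊛ b) ≈ (a ⊛ c)
  ⊛-congˡ a p = ⊛-cong (S.refl {a}) p

  ⊛-congʳ : ∀ c {a b} → a ≈ b → (a ⊛ c) ≈ (b ⊛ c)
  ⊛-congʳ c p = ⊛-cong p (S.refl {c})

  ⊕-congˡ : ∀ a {b c} → b ≈ c → (a ⊕ b) ≈ (a ⊕ c)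
  ⊕-congˡ a p = S.+-cong (S.refl {a}) p

  ⊕-congʳ : ∀ c {a b} → a ≈ b → (a ⊕ c) ≈ (b ⊕ c)
  ⊕-congʳ c p = S.+-cong p (S.refl {c})

  X^-zero : X^ 0 ≈ one
  X^-zero = pointwise λ { zero → refl ; (suc _) → refl }

  tl-X^1 : tl (X^ 1) ≈ one
  tl-X^1 = pointwise λ { zero → refl ; (suc _) → refl }

  X^1-⊛-suc : ∀ b n → (X^ 1 ⊛ b) (suc n) ≡ b n
  X^1-⊛-suc b n = trans (⊛-suc (X^ 1) b n)
    (trans (ℤ.+-identityˡ _) (trans (coeff (⊛-cong tl-X^1 (S.refl {b})) n) (coeff (⊛-identityˡ b) n)))

  X^-suc : ∀ m → X^ (suc m) ≈ (X^ 1 ⊛ X^ m)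
  X^-suc m = pointwise λ { zero → refl ; (suc n) → sym (X^1-⊛-suc (X^ m) n) }

  -- Even parts and the substitutions of x² and -x

  sq-cong : ∀ {a b} → a ≈ b → sq a ≈ sq b
  sq-cong {a} {b} p = pointwise go
    where
    go : ∀ n → sq a n ≡ sq b n
    go n with isEvenℕ n
    ... | true  = coeff p (half n)
    ... | false = refl

  sq-⊕ : ∀ a b → sq (a ⊕ b) ≈ (sq a ⊕ sq b)
  sq-⊕ a b = pointwise go
    where
    go : ∀ n → sq (a ⊕ b) n ≡ (sq a ⊕ sq b) n
    go n with isEvenℕ n
    ... | true  = refl
    ... | false = refl

  sq-neg : ∀ a → sq (neg a) ≈ neg (sq a)
  sq-neg a = pointwise go
    where
    go : ∀ n → sq (neg a) n ≡ neg (sq a) n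
    go n with isEvenℕ n
    ... | true  = refl
    ... | false = refl

  scale-sq : ∀ k a n → sq (scale k a) n ≡ k * sq a n
  scale-sq k a n with isEvenℕ n
  ... | true  = refl
  ... | false = sym (ℤ.*-zeroʳ k)

  -- Induction in steps of two: odd coefficients vanish on both sides, and the double tail of `sq a`
  -- is `sq (tl a)`.
  sq-⊛ : ∀ a b → sq (a ⊛ b) ≈ (sq a ⊛ sq b)
  sq-⊛ a b = pointwise (go a)
    where
    open ≡-Reasoning
    go : ∀ a n → sq (a ⊛ b) n ≡ (sq a ⊛ sq b) n
    go a zero = trans (⊛-zero a b) (sym (⊛-zero (sq a) (sq b)))
    go a (suc zero) = sym (trans (⊛-suc (sq a) (sq b) 0)
      (cong₂ _+_ (ℤ.*-zeroʳ (a 0)) (trans (⊛-zero (tl (sq a)) (sq b)) (ℤ.*-zeroˡ (b 0)))))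
    go a (suc (suc n)) = begin
      sq (tl (a ⊛ b)) n
        ≡⟨ coeff (sq-cong (pointwise {tl (a ⊛ b)} {scale (a 0) (tl b) ⊕ tl a ⊛ b} (⊛-suc a b))) n ⟩
      sq (scale (a 0) (tl b) ⊕ tl a ⊛ b) n
        ≡⟨ coeff (sq-⊕ (scale (a 0) (tl b)) (tl a ⊛ b)) n ⟩
      sq (scale (a 0) (tl b)) n + sq (tl a ⊛ b) n
        ≡⟨ cong₂ _+_ (scale-sq (a 0) (tl b) n) (go (tl a) n) ⟩
      a 0 * sq b (suc (suc n)) + (sq (tl a) ⊛ sq b) n
        ≡⟨ cong (_+_ (a 0 * sq b (suc (suc n)))) (ℤ.+-identityˡ _) ⟨
      a 0 * sq b (suc (suc n)) + (+ 0 + (sq (tl a) ⊛ sq b) n)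
        ≡⟨ cong (λ t → a 0 * sq b (suc (suc n)) + (t + (sq (tl a) ⊛ sq b) n)) (ℤ.*-zeroˡ (sq b (suc n))) ⟨
      a 0 * sq b (suc (suc n)) + (+ 0 * sq b (suc n) + (sq (tl a) ⊛ sq b) n)
        ≡⟨ cong (_+_ (a 0 * sq b (suc (suc n)))) (⊛-suc (tl (sq a)) (sq b) n) ⟨
      a 0 * sq b (suc (suc n)) + (tl (sq a) ⊛ sq b) (suc n)
        ≡⟨ ⊛-suc (sq a) (sq b) (suc n) ⟨
      (sq a ⊛ sq b) (suc (suc n)) ∎

  negArg-cong : ∀ {a b} → a ≈ b → negArg a ≈ negArg b
  negArg-cong {a} {b} p = pointwise go
    where
    go : ∀ n → negArg a n ≡ negArg b n
    go n with isEvenℕ n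
    ... | true  = coeff p n
    ... | false = cong -_ (coeff p n)

  negArg-⊕ : ∀ a b → negArg (a ⊕ b) ≈ (negArg a ⊕ negArg b)
  negArg-⊕ a b = pointwise go
    where
    go : ∀ n → negArg (a ⊕ b) n ≡ (negArg a ⊕ negArg b) n
    go n with isEvenℕ n
    ... | true  = refl
    ... | false = ℤ.neg-distrib-+ (a n) (b n)

  negArg-neg : ∀ a → negArg (neg a) ≈ neg (negArg a)
  negArg-neg a = pointwise go
    where
    go : ∀ n → negArg (neg a) n ≡ neg (negArg a) n
    go n with isEvenℕ n
    ... | true  = refl
    ... | false = refl

  scale-negArg : ∀ k a n → negArg (scale k a) n ≡ k * negArg a n
  scale-negArg k a n with isEvenℕ n
  ... | true  = refl
  ... | false = ℤ.neg-distribʳ-* k (a n)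

  -- A shift by one exchanges even and odd exponents; this is the sign in the inductive step of
  -- `negArg-⊛`.
  negArg-suc : ∀ a n → negArg a (suc n) ≡ - negArg (tl a) n
  negArg-suc a zero          = refl
  negArg-suc a (suc zero)    = sym (ℤ.neg-involutive (a 2))
  negArg-suc a (suc (suc n)) = negArg-suc (tl (tl a)) n

  negArg-⊛ : ∀ a b → negArg (a ⊛ b) ≈ (negArg a ⊛ negArg b)
  negArg-⊛ a b = pointwise (go a)
    where
    open ≡-Reasoning
    lem : ∀ x y z → - (x * y + z) ≡ x * - y + - z
    lem = solve-∀
    neg-⊛ : ∀ a n → (neg a ⊛ negArg b) n ≡ - (a ⊛ negArg b) n
    neg-⊛ a n = trans (coeff (⊛-cong (pointwise {neg a} {scale (- (+ 1)) a} λ n → sym (ℤ.-1*i≡-i (a n))) (S.refl {negArg b})) n)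
      (trans (scale-⊛ (- (+ 1)) a (negArg b) n) (ℤ.-1*i≡-i _))
    go : ∀ a n → negArg (a ⊛ b) n ≡ (negArg a ⊛ negArg b) n
    go a zero = trans (⊛-zero a b) (sym (⊛-zero (negArg a) (negArg b)))
    go a (suc n) = begin
      negArg (a ⊛ b) (suc n)
        ≡⟨ negArg-suc (a ⊛ b) n ⟩
      - negArg (tl (a ⊛ b)) n
        ≡⟨ cong -_ (coeff (negArg-cong (pointwise {tl (a ⊛ b)} {scale (a 0) (tl b) ⊕ tl a ⊛ b} (⊛-suc a b))) n) ⟩
      - negArg (scale (a 0) (tl b) ⊕ tl a ⊛ b) n
        ≡⟨ cong -_ (coeff (negArg-⊕ (scale (a 0) (tl b)) (tl a ⊛ b)) n) ⟩
      - (negArg (scale (a 0) (tl b)) n + negArg (tl a ⊛ b) n)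
        ≡⟨ cong -_ (cong₂ _+_ (scale-negArg (a 0) (tl b) n) (go (tl a) n)) ⟩
      - (a 0 * negArg (tl b) n + (negArg (tl a) ⊛ negArg b) n)
        ≡⟨ lem (a 0) _ _ ⟩
      a 0 * - negArg (tl b) n + - (negArg (tl a) ⊛ negArg b) n
        ≡⟨ cong₂ _+_ (cong (_*_ (a 0)) (negArg-suc b n))
            (trans (coeff (⊛-cong (pointwise {tl (negArg a)} {neg (negArg (tl a))} (negArg-suc a)) (S.refl {negArg b})) n)
                   (neg-⊛ (negArg (tl a)) n)) ⟨
      a 0 * negArg b (suc n) + (tl (negArg a) ⊛ negArg b) n
        ≡⟨ ⊛-suc (negArg a) (negArg b) n ⟨
      (negArg a ⊛ negArg b) (suc n) ∎

  evenPart-cong : ∀ {a b} → a ≈ b → evenPart a ≈ evenPart b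
  evenPart-cong {a} {b} p = pointwise go
    where
    go : ∀ n → evenPart a n ≡ evenPart b n
    go n with isEvenℕ n
    ... | true  = coeff p n
    ... | false = refl

  evenPart-double : ∀ a → (evenPart a ⊕ evenPart a) ≈ (a ⊕ negArg a)
  evenPart-double a = pointwise go
    where
    go : ∀ n → (evenPart a ⊕ evenPart a) n ≡ (a ⊕ negArg a) n
    go n with isEvenℕ n
    ... | true  = refl
    ... | false = sym (ℤ.+-inverseʳ (a n))

  -- Replaces the factor 1/2 of the even part: over the integers, identities with even parts are
  -- proved in doubled form.
  double-injective : ∀ {a b} → (a ⊕ a) ≈ (b ⊕ b) → a ≈ b
  double-injective {a} {b} p = pointwise λ n →
    ℤ.*-cancelˡ-≡ (+ 2) (a n) (b n) (trans (lem (a n)) (trans (coeff p n) (sym (lem (b n)))))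
    where
    lem : ∀ x → + 2 * x ≡ x + x
    lem = solve-∀

  sq-one : sq one ≈ one
  sq-one = pointwise λ { zero → refl ; (suc zero) → refl ; (suc (suc n)) → lem n }
    where
    lem : ∀ n → sq (tl one) n ≡ + 0
    lem n with isEvenℕ n
    ... | true  = refl
    ... | false = refl

  negArg-one : negArg one ≈ one
  negArg-one = pointwise λ { zero → refl ; (suc n) → lem n }
    where
    lem : ∀ n → negArg one (suc n) ≡ + 0
    lem n with isEvenℕ (suc n)
    ... | true  = refl
    ... | false = refl

  sq-X : sq (X^ 1) ≈ X^ 2
  sq-X = pointwise λ { zero → refl ; (suc zero) → refl ; (suc (suc n)) →
    trans (coeff (sq-cong tl-X^1) n) (trans (coeff sq-one n) (lem n)) }
    where
    lem : ∀ n → one n ≡ X^ 2 (suc (suc n))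
    lem zero = refl
    lem (suc n) = refl

  negArg-X : negArg (X^ 1) ≈ neg (X^ 1)
  negArg-X = pointwise λ { zero → refl ; (suc n) → trans (negArg-suc (X^ 1) n)
    (cong -_ (trans (coeff (negArg-cong tl-X^1) n) (trans (coeff negArg-one n) (sym (coeff tl-X^1 n))))) }

  -- Finite sums and products of series

  ΣS : ℕ → (ℕ → Series) → Series
  ΣS zero    h = const (+ 0)
  ΣS (suc m) h = ΣS m h ⊕ h m

  sumℤ-∷ʳ : ∀ xs x → sumℤ (xs ∷ʳ x) ≡ sumℤ xs + x
  sumℤ-∷ʳ []       x = ℤ.+-comm x (+ 0)
  sumℤ-∷ʳ (y ∷ xs) x = trans (cong (_+_ y) (sumℤ-∷ʳ xs x)) (sym (ℤ.+-assoc y _ x))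

  sumℤ-upTo : ∀ m h → (λ n → sumℤ (map (λ i → h i n) (upTo m))) ≈ ΣS m h
  sumℤ-upTo zero h = pointwise λ { zero → refl ; (suc _) → refl }
  sumℤ-upTo (suc m) h = pointwise λ n → begin
    sumℤ (map (λ i → h i n) (upTo (suc m)))       ≡⟨ cong (sumℤ ∘ map (λ i → h i n)) (upTo-∷ʳ m) ⟨
    sumℤ (map (λ i → h i n) (upTo m ∷ʳ m))        ≡⟨ cong sumℤ (map-++ (λ i → h i n) (upTo m) (m ∷ [])) ⟩
    sumℤ (map (λ i → h i n) (upTo m) ∷ʳ h m n)    ≡⟨ sumℤ-∷ʳ (map (λ i → h i n) (upTo m)) (h m n) ⟩
    sumℤ (map (λ i → h i n) (upTo m)) + h m n     ≡⟨ cong (_+ h m n) (coeff (sumℤ-upTo m h) n) ⟩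
    ΣS m h n + h m n                              ∎
    where open ≡-Reasoning

  -- The restriction to `i < m` matches `term-suc`, which is available only up to the diagonal.
  ΣS-cong-⊛ : ∀ c m {h h′} → (∀ i → i ℕ.< m → h′ i ≈ (c ⊛ h i)) → ΣS m h′ ≈ (c ⊛ ΣS m h)
  ΣS-cong-⊛ c zero eq = S.sym (S.zeroʳ c)
  ΣS-cong-⊛ c (suc m) eq = S.trans
    (S.+-cong (ΣS-cong-⊛ c m λ i i<m → eq i (ℕ.m<n⇒m<1+n i<m)) (eq m ℕ.≤-refl))
    (S.sym (S.distribˡ c (ΣS m _) _))

  prodFromTo-suc : ∀ a b f → a ≤ suc b → prodFromTo a (suc b) f ≈ (prodFromTo a b f ⊛ f (suc b))
  prodFromTo-suc a b f a≤ rewrite ℕ.+-∸-assoc 1 a≤ = begin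
    foldr op one (upTo (suc d))          ≡⟨ cong (foldr op one) (upTo-∷ʳ d) ⟨
    foldr op one (upTo d ∷ʳ d)           ≡⟨ foldr-∷ʳ op one d (upTo d) ⟩
    foldr op (f (a ℕ.+ d) ⊛ one) (upTo d) ≈⟨ seed (upTo d) ⟩
    foldr op one (upTo d) ⊛ f (a ℕ.+ d)  ≡⟨ cong (λ t → foldr op one (upTo d) ⊛ f t) (ℕ.m+[n∸m]≡n a≤) ⟩
    foldr op one (upTo d) ⊛ f (suc b)    ∎
    where
    open ≈-Reasoning
    d = suc b ∸ a
    op : ℕ → Series → Series
    op i acc = f (a ℕ.+ i) ⊛ acc
    seed : ∀ xs → foldr op (f (a ℕ.+ d) ⊛ one) xs ≈ (foldr op one xs ⊛ f (a ℕ.+ d))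
    seed [] = ⊛-comm (f (a ℕ.+ d)) one
    seed (x ∷ xs) = S.trans (⊛-congˡ (f (a ℕ.+ x)) (seed xs))
      (S.sym (⊛-assoc (f (a ℕ.+ x)) (foldr op one xs) (f (a ℕ.+ d))))

  prodFromTo-empty : ∀ a f → prodFromTo (suc a) a f ≈ one
  prodFromTo-empty a f rewrite ℕ.n∸n≡0 a = S.refl

  -- g_k for k = m + 2.
  cycleSeries : ℕ → Series
  cycleSeries zero    = X^ 1
  cycleSeries (suc m) = cycleSeries m ⊛ R (3 ℕ.+ m)

  -- The series R_k(x²) and R_k(-x²) and the Chebyshev polynomials

  R⁺ R⁻ : ℕ → Series
  R⁺ k = sq (R k)
  R⁻ k = sq (negArg (R k))

  R-suc : ∀ k → (R (2 ℕ.+ k) ⊛ (one ⊖ X^ 1 ⊛ R (suc k))) ≈ one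
  R-suc k = S.trans (⊛-comm (R (2 ℕ.+ k)) c) (⊛-inverse c refl)
    where c = one ⊖ X^ 1 ⊛ R (suc k)

  R⁺-suc : ∀ k → (R⁺ (2 ℕ.+ k) ⊛ (one ⊕ neg (X^ 2 ⊛ R⁺ (suc k)))) ≈ one
  R⁺-suc k = begin
    R⁺ (2 ℕ.+ k) ⊛ (one ⊕ neg (X^ 2 ⊛ R⁺ (suc k)))
      ≈⟨ ⊛-congˡ (R⁺ (2 ℕ.+ k)) (S.+-cong sq-one
          (S.trans (sq-neg (X^ 1 ⊛ R (suc k))) (S.-‿cong (S.trans (sq-⊛ (X^ 1) (R (suc k))) (⊛-congʳ (R⁺ (suc k)) sq-X))))) ⟨
    R⁺ (2 ℕ.+ k) ⊛ (sq one ⊕ sq (neg (X^ 1 ⊛ R (suc k))))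
      ≈⟨ ⊛-congˡ (R⁺ (2 ℕ.+ k)) (sq-⊕ one (neg (X^ 1 ⊛ R (suc k)))) ⟨
    R⁺ (2 ℕ.+ k) ⊛ sq (one ⊖ X^ 1 ⊛ R (suc k))
      ≈⟨ sq-⊛ (R (2 ℕ.+ k)) (one ⊖ X^ 1 ⊛ R (suc k)) ⟨
    sq (R (2 ℕ.+ k) ⊛ (one ⊖ X^ 1 ⊛ R (suc k)))
      ≈⟨ sq-cong (R-suc k) ⟩
    sq one
      ≈⟨ sq-one ⟩
    one ∎
    where open ≈-Reasoning

  R⁻-suc : ∀ k → (R⁻ (2 ℕ.+ k) ⊛ (one ⊕ X^ 2 ⊛ R⁻ (suc k))) ≈ one
  R⁻-suc k = begin
    R⁻ (2 ℕ.+ k) ⊛ (one ⊕ X^ 2 ⊛ R⁻ (suc k))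
      ≈⟨ ⊛-congˡ (R⁻ (2 ℕ.+ k)) (S.+-cong sq-one
          (S.trans (sq-⊛ (X^ 1) (negArg (R (suc k)))) (⊛-congʳ (R⁻ (suc k)) sq-X))) ⟨
    R⁻ (2 ℕ.+ k) ⊛ (sq one ⊕ sq (X^ 1 ⊛ negArg (R (suc k))))
      ≈⟨ ⊛-congˡ (R⁻ (2 ℕ.+ k)) (sq-⊕ one (X^ 1 ⊛ negArg (R (suc k)))) ⟨
    R⁻ (2 ℕ.+ k) ⊛ sq (one ⊕ X^ 1 ⊛ negArg (R (suc k)))
      ≈⟨ sq-⊛ (negArg (R (2 ℕ.+ k))) (one ⊕ X^ 1 ⊛ negArg (R (suc k))) ⟨
    sq (negArg (R (2 ℕ.+ k)) ⊛ (one ⊕ X^ 1 ⊛ negArg (R (suc k))))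
      ≈⟨ sq-cong (⊛-congˡ (negArg (R (2 ℕ.+ k))) (S.+-cong negArg-one neg-arg)) ⟨
    sq (negArg (R (2 ℕ.+ k)) ⊛ (negArg one ⊕ negArg (neg (X^ 1 ⊛ R (suc k)))))
      ≈⟨ sq-cong (⊛-congˡ (negArg (R (2 ℕ.+ k))) (negArg-⊕ one (neg (X^ 1 ⊛ R (suc k))))) ⟨
    sq (negArg (R (2 ℕ.+ k)) ⊛ negArg (one ⊖ X^ 1 ⊛ R (suc k)))
      ≈⟨ sq-cong (negArg-⊛ (R (2 ℕ.+ k)) (one ⊖ X^ 1 ⊛ R (suc k))) ⟨
    sq (negArg (R (2 ℕ.+ k) ⊛ (one ⊖ X^ 1 ⊛ R (suc k))))
      ≈⟨ sq-cong (negArg-cong (R-suc k)) ⟩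
    sq (negArg one)
      ≈⟨ S.trans (sq-cong negArg-one) sq-one ⟩
    one ∎
    where
    open ≈-Reasoning
    neg-arg : negArg (neg (X^ 1 ⊛ R (suc k))) ≈ (X^ 1 ⊛ negArg (R (suc k)))
    neg-arg = begin
      negArg (neg (X^ 1 ⊛ R (suc k)))     ≈⟨ negArg-neg (X^ 1 ⊛ R (suc k)) ⟩
      neg (negArg (X^ 1 ⊛ R (suc k)))     ≈⟨ S.-‿cong (S.trans (negArg-⊛ (X^ 1) (R (suc k))) (⊛-congʳ (negArg (R (suc k))) negArg-X)) ⟩
      neg (neg (X^ 1) ⊛ negArg (R (suc k)))
        ≈⟨ solve 2 (λ x y → :- (:- x :* y) := x :* y) S.refl (X^ 1) (negArg (R (suc k))) ⟩
      X^ 1 ⊛ negArg (R (suc k)) ∎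
      where open Solver

  -- The recursion of `Ũ`, divided by its middle term, is the recursion of the reciprocals of
  -- R_k(x²).
  R⁺-⊛-Ũ : ∀ k → (R⁺ (suc k) ⊛ Ũ (suc k)) ≈ Ũ k
  R⁺-⊛-Ũ zero = S.trans (⊛-congʳ one sq-one) (⊛-identityˡ one)
  R⁺-⊛-Ũ (suc k) = begin
    r′ ⊛ (Ũ (suc k) ⊕ neg (X^ 2 ⊛ Ũ k))
      ≈⟨ ⊛-congˡ (r′) (⊕-congˡ (Ũ (suc k)) (S.-‿cong (⊛-congˡ (X^ 2) (R⁺-⊛-Ũ k)))) ⟨
    r′ ⊛ (Ũ (suc k) ⊕ neg (X^ 2 ⊛ (R⁺ (suc k) ⊛ Ũ (suc k))))
      ≈⟨ solve 4 (λ r′ u y r → r′ :* (u :+ :- (y :* (r :* u))) := r′ :* (con (+ 1) :+ :- (y :* r)) :* u)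
           S.refl r′ (Ũ (suc k)) (X^ 2) (R⁺ (suc k)) ⟩
    r′ ⊛ (const (+ 1) ⊕ neg (X^ 2 ⊛ R⁺ (suc k))) ⊛ Ũ (suc k)
      ≈⟨ ⊛-congʳ (Ũ (suc k)) (S.trans (⊛-congˡ (r′) (⊕-congʳ (neg (X^ 2 ⊛ R⁺ (suc k))) (S.sym one≈const))) (R⁺-suc k)) ⟩
    one ⊛ Ũ (suc k)
      ≈⟨ ⊛-identityˡ (Ũ (suc k)) ⟩
    Ũ (suc k) ∎
    where
    open ≈-Reasoning
    open Solver
    r′ = R⁺ (2 ℕ.+ k)

  -- Each factor R_k(x²) lowers the index of `Ũ` by one, until `Ũ 2` is reached.
  cycleSeries-⊛-Ũ : ∀ m → (sq (cycleSeries m) ⊛ Ũ (2 ℕ.+ m)) ≈ (X^ 2 ⊛ (one ⊖ X^ 2))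
  cycleSeries-⊛-Ũ zero = S.*-cong sq-X (⊕-congˡ one (S.-‿cong (S.*-identityʳ (X^ 2))))
  cycleSeries-⊛-Ũ (suc m) = begin
    sq (cycleSeries (suc m)) ⊛ Ũ (3 ℕ.+ m)              ≈⟨ ⊛-congʳ (Ũ (3 ℕ.+ m)) (sq-⊛ (cycleSeries m) (R (3 ℕ.+ m))) ⟩
    sq (cycleSeries m) ⊛ R⁺ (3 ℕ.+ m) ⊛ Ũ (3 ℕ.+ m)      ≈⟨ ⊛-assoc (sq (cycleSeries m)) (R⁺ (3 ℕ.+ m)) (Ũ (3 ℕ.+ m)) ⟩
    sq (cycleSeries m) ⊛ (R⁺ (3 ℕ.+ m) ⊛ Ũ (3 ℕ.+ m))    ≈⟨ ⊛-congˡ (sq (cycleSeries m)) (R⁺-⊛-Ũ (2 ℕ.+ m)) ⟩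
    sq (cycleSeries m) ⊛ Ũ (2 ℕ.+ m)                    ≈⟨ cycleSeries-⊛-Ũ m ⟩
    X^ 2 ⊛ (one ⊖ X^ 2)                  ∎
    where open ≈-Reasoning

  -- The even part of g_k as a sum over j

  term : ℕ → ℕ → Series
  term k j = X^ (k ℕ.+ 2 ∸ j) ⊛ sq (Re j) ⊛ prodFromTo (j ℕ.+ 1) k (λ i → sq (negArg (R i))) ⊛ invU (j ℕ.+ 1)

  -- Only the power of `x` and the upper end of the product depend on `k`.
  term-suc : ∀ k j → j ≤ k → term (suc k) j ≈ (X^ 1 ⊛ R⁻ (suc k) ⊛ term k j)
  term-suc k j j≤k rewrite ℕ.+-∸-assoc 1 {k ℕ.+ 2} {j} (ℕ.≤-trans j≤k (ℕ.m≤m+n k 2)) | ℕ.+-comm j 1 = begin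
    X^ (suc d) ⊛ e ⊛ prodFromTo (suc j) (suc k) R⁻ ⊛ u
      ≈⟨ ⊛-congʳ u (⊛-cong (⊛-congʳ e (X^-suc d)) (prodFromTo-suc (suc j) k R⁻ (s≤s j≤k))) ⟩
    X^ 1 ⊛ X^ d ⊛ e ⊛ (p ⊛ R⁻ (suc k)) ⊛ u
      ≈⟨ solve 6 (λ x d e p r u → x :* d :* e :* (p :* r) :* u := x :* r :* (d :* e :* p :* u)) S.refl
           (X^ 1) (X^ d) e p (R⁻ (suc k)) u ⟩
    X^ 1 ⊛ R⁻ (suc k) ⊛ (X^ d ⊛ e ⊛ p ⊛ u) ∎
    where
    open ≈-Reasoning
    open Solver
    d = k ℕ.+ 2 ∸ j
    e = sq (Re j)
    p = prodFromTo (suc j) k R⁻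
    u = invU (suc j)

  -- The summand that is new when the upper end of the sum grows by one; its product has a single
  -- factor.
  term-diagonal : ∀ k → term (suc k) k ≈ (X^ 3 ⊛ sq (Re k) ⊛ R⁻ (suc k) ⊛ invU (suc k))
  term-diagonal k rewrite ℕ.+-comm k 2 | ℕ.+-comm k 1 | ℕ.m+n∸n≡m 3 k =
    ⊛-congʳ (invU (suc k)) (⊛-congˡ (X^ 3 ⊛ sq (Re k)) (begin
      prodFromTo (suc k) (suc k) R⁻         ≈⟨ prodFromTo-suc (suc k) k R⁻ ℕ.≤-refl ⟩
      prodFromTo (suc k) k R⁻ ⊛ R⁻ (suc k)   ≈⟨ ⊛-congʳ (R⁻ (suc k)) (prodFromTo-empty k R⁻) ⟩
      one ⊛ R⁻ (suc k)                      ≈⟨ ⊛-identityˡ (R⁻ (suc k)) ⟩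
      R⁻ (suc k) ∎))
    where open ≈-Reasoning

  Ũ-zero : ∀ m → Ũ m 0 ≡ + 1
  Ũ-zero zero          = refl
  Ũ-zero (suc zero)    = refl
  Ũ-zero (suc (suc m)) rewrite Ũ-zero (suc m) = refl

  cycleSeries-R⁺ : ∀ m → (sq (cycleSeries m) ⊛ R⁺ (3 ℕ.+ m)) ≈ (X^ 2 ⊛ (one ⊖ X^ 2) ⊛ inv (Ũ (3 ℕ.+ m)))
  cycleSeries-R⁺ m = begin
    sq (cycleSeries m) ⊛ r′                          ≈⟨ S.*-identityʳ (sq (cycleSeries m) ⊛ r′) ⟨
    sq (cycleSeries m) ⊛ r′ ⊛ one                    ≈⟨ ⊛-congˡ (sq (cycleSeries m) ⊛ r′) (⊛-inverse u (Ũ-zero (3 ℕ.+ m))) ⟨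
    sq (cycleSeries m) ⊛ r′ ⊛ (u ⊛ inv u)            ≈⟨ ⊛-assoc (sq (cycleSeries m) ⊛ r′) u (inv u) ⟨
    sq (cycleSeries m) ⊛ r′ ⊛ u ⊛ inv u              ≈⟨ ⊛-congʳ (inv u) (⊛-congʳ u (sq-⊛ (cycleSeries m) (R (3 ℕ.+ m)))) ⟨
    sq (cycleSeries (suc m)) ⊛ u ⊛ inv u             ≈⟨ ⊛-congʳ (inv u) (cycleSeries-⊛-Ũ (suc m)) ⟩
    X^ 2 ⊛ (one ⊖ X^ 2) ⊛ inv u       ∎
    where
    open ≈-Reasoning
    r′ = R⁺ (3 ℕ.+ m)
    u = Ũ (3 ℕ.+ m)

  -- With `r` and `r̄` the series of the previous index and `y` for `X^ 2`, the reciprocals of the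
  -- two series are `1 - y r` and `1 + y r̄`. They differ by `y (r + r̄)`, and multiplying by both
  -- series clears the denominators.
  R⁺-difference : ∀ k → R⁺ (2 ℕ.+ k) ≈
    (R⁻ (2 ℕ.+ k) ⊕ X^ 2 ⊛ R⁺ (2 ℕ.+ k) ⊛ R⁻ (2 ℕ.+ k) ⊛ (R⁺ (suc k) ⊕ R⁻ (suc k)))
  R⁺-difference k = begin
    r′
      ≈⟨ S.*-identityʳ r′ ⟨
    r′ ⊛ one
      ≈⟨ ⊛-congˡ r′ (S.trans (⊛-congˡ r̄′ (⊕-congʳ (y ⊛ R⁻ (suc k)) (S.sym one≈const))) (R⁻-suc k)) ⟨
    r′ ⊛ (r̄′ ⊛ (const (+ 1) ⊕ y ⊛ R⁻ (suc k)))
      ≈⟨ solve 5 (λ r′ r̄′ y r r̄ → r′ :* (r̄′ :* (con (+ 1) :+ y :* r̄)) :=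
                   r̄′ :* (r′ :* (con (+ 1) :+ :- (y :* r))) :+ y :* r′ :* r̄′ :* (r :+ r̄))
           S.refl r′ r̄′ y (R⁺ (suc k)) (R⁻ (suc k)) ⟩
    r̄′ ⊛ (r′ ⊛ (const (+ 1) ⊕ neg (y ⊛ R⁺ (suc k)))) ⊕ z
      ≈⟨ ⊕-congʳ z (⊛-congˡ r̄′ (S.trans (⊛-congˡ r′ (⊕-congʳ (neg (y ⊛ R⁺ (suc k))) (S.sym one≈const))) (R⁺-suc k))) ⟩
    r̄′ ⊛ one ⊕ z
      ≈⟨ ⊕-congʳ z (S.*-identityʳ r̄′) ⟩
    r̄′ ⊕ z ∎
    where
    open ≈-Reasoning
    open Solver
    r′ = R⁺ (2 ℕ.+ k)
    r̄′ = R⁻ (2 ℕ.+ k)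
    y = X^ 2
    z = y ⊛ r′ ⊛ r̄′ ⊛ (R⁺ (suc k) ⊕ R⁻ (suc k))

  sq-evenPart-double : ∀ a → (sq (evenPart a) ⊕ sq (evenPart a)) ≈ (sq a ⊕ sq (negArg a))
  sq-evenPart-double a = begin
    sq (evenPart a) ⊕ sq (evenPart a)   ≈⟨ sq-⊕ (evenPart a) (evenPart a) ⟨
    sq (evenPart a ⊕ evenPart a)        ≈⟨ sq-cong (evenPart-double a) ⟩
    sq (a ⊕ negArg a)                   ≈⟨ sq-⊕ a (negArg a) ⟩
    sq a ⊕ sq (negArg a)                ∎
    where open ≈-Reasoning

  -- Twice the even part of g_{k+1} is g_k(x²) R_{k+1}(x²) + g_k(-x²) R_{k+1}(-x²). Replacing the
  -- first R_{k+1}(x²) by means of `R⁺-difference` lets R_{k+1}(-x²) multiply the whole even part of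
  -- g_k, which accounts for the old summands. The correction contains g_k(x²) R_{k+1}(x²), whose
  -- closed form makes it the diagonal summand.
  chebyshev-sum : ∀ m → (X^ (suc m) ⊛ sq (evenPart (cycleSeries m))) ≈
    ((one ⊖ X^ 2) ⊛ ΣS m (λ i → term (2 ℕ.+ m) (2 ℕ.+ i)))
  -- The series g_2 = y is odd, so its even part vanishes like the empty sum.
  chebyshev-sum zero = begin
    X^ 1 ⊛ sq (evenPart (X^ 1))      ≈⟨ ⊛-congˡ (X^ 1) sq-evenPart-X ⟩
    X^ 1 ⊛ const (+ 0)               ≈⟨ S.zeroʳ (X^ 1) ⟩
    const (+ 0)                      ≈⟨ S.zeroʳ (one ⊖ X^ 2) ⟨
    (one ⊖ X^ 2) ⊛ const (+ 0)       ∎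
    where
    open ≈-Reasoning
    sq-evenPart-X : sq (evenPart (X^ 1)) ≈ const (+ 0)
    sq-evenPart-X = double-injective (begin
      sq (evenPart (X^ 1)) ⊕ sq (evenPart (X^ 1))  ≈⟨ sq-evenPart-double (X^ 1) ⟩
      sq (X^ 1) ⊕ sq (negArg (X^ 1))               ≈⟨ ⊕-congˡ (sq (X^ 1)) (S.trans (sq-cong negArg-X) (sq-neg (X^ 1))) ⟩
      sq (X^ 1) ⊕ neg (sq (X^ 1))                  ≈⟨ S.-‿inverseʳ (sq (X^ 1)) ⟩
      const (+ 0)                                  ≈⟨ S.+-identityˡ (const (+ 0)) ⟨
      const (+ 0) ⊕ const (+ 0)                    ∎)
  chebyshev-sum (suc m) = double-injective (begin
    X^ (2 ℕ.+ m) ⊛ E′ ⊕ X^ (2 ℕ.+ m) ⊛ E′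
      ≈⟨ S.distribˡ (X^ (2 ℕ.+ m)) E′ E′ ⟨
    X^ (2 ℕ.+ m) ⊛ (E′ ⊕ E′)
      ≈⟨ ⊛-cong (X^-suc (suc m)) (S.trans (sq-evenPart-double (cycleSeries (suc m)))
           (S.+-cong (sq-⊛ (cycleSeries m) (R (3 ℕ.+ m)))
             (S.trans (sq-cong (negArg-⊛ (cycleSeries m) (R (3 ℕ.+ m)))) (sq-⊛ (negArg (cycleSeries m)) (negArg (R (3 ℕ.+ m))))))) ⟩
    x ⊛ P ⊛ (sq (cycleSeries m) ⊛ r′ ⊕ sq (negArg (cycleSeries m)) ⊛ r̄′)
      ≈⟨ ⊛-congˡ (x ⊛ P) (⊕-congʳ (sq (negArg (cycleSeries m)) ⊛ r̄′) (⊛-congˡ (sq (cycleSeries m)) (R⁺-difference (suc m)))) ⟩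
    x ⊛ P ⊛ (sq (cycleSeries m) ⊛ (r̄′ ⊕ y ⊛ r′ ⊛ r̄′ ⊛ (r₀ ⊕ r̄₀)) ⊕ sq (negArg (cycleSeries m)) ⊛ r̄′)
      ≈⟨ solve 9 (λ x P G Ḡ r′ r̄′ y r r̄ → x :* P :* (G :* (r̄′ :+ y :* r′ :* r̄′ :* (r :+ r̄)) :+ Ḡ :* r̄′) :=
                   x :* r̄′ :* (P :* (G :+ Ḡ)) :+ x :* P :* y :* r̄′ :* (r :+ r̄) :* (G :* r′))
           S.refl x P (sq (cycleSeries m)) (sq (negArg (cycleSeries m))) r′ r̄′ y r₀ r̄₀ ⟩
    x ⊛ r̄′ ⊛ (P ⊛ (sq (cycleSeries m) ⊕ sq (negArg (cycleSeries m)))) ⊕ x ⊛ P ⊛ y ⊛ r̄′ ⊛ (r₀ ⊕ r̄₀) ⊛ (sq (cycleSeries m) ⊛ r′)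
      ≈⟨ S.+-cong (⊛-congˡ (x ⊛ r̄′) (⊛-congˡ P (S.sym (sq-evenPart-double (cycleSeries m)))))
           (⊛-cong (⊛-congˡ (x ⊛ P ⊛ y ⊛ r̄′) (S.sym (sq-evenPart-double (R (2 ℕ.+ m))))) (cycleSeries-R⁺ m)) ⟩
    x ⊛ r̄′ ⊛ (P ⊛ (E ⊕ E)) ⊕ x ⊛ P ⊛ y ⊛ r̄′ ⊛ (e ⊕ e) ⊛ (y ⊛ c ⊛ v)
      ≈⟨ ⊕-congʳ (x ⊛ P ⊛ y ⊛ r̄′ ⊛ (e ⊕ e) ⊛ (y ⊛ c ⊛ v)) (⊛-congˡ (x ⊛ r̄′)
           (S.trans (S.distribˡ P E E) (S.+-cong (chebyshev-sum m) (chebyshev-sum m)))) ⟩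
    x ⊛ r̄′ ⊛ (c ⊛ Σm ⊕ c ⊛ Σm) ⊕ x ⊛ P ⊛ y ⊛ r̄′ ⊛ (e ⊕ e) ⊛ (y ⊛ c ⊛ v)
      ≈⟨ solve 8 (λ x r̄′ c Σm P y e v →
             x :* r̄′ :* (c :* Σm :+ c :* Σm) :+ x :* P :* y :* r̄′ :* (e :+ e) :* (y :* c :* v) :=
             let t = c :* (x :* r̄′ :* Σm :+ x :* y :* e :* r̄′ :* (y :* P :* v)) in t :+ t)
           S.refl x r̄′ c Σm P y e v ⟩
    (let t = c ⊛ (x ⊛ r̄′ ⊛ Σm ⊕ x ⊛ y ⊛ e ⊛ r̄′ ⊛ (y ⊛ P ⊛ v)) in t ⊕ t)
      ≈⟨ S.+-cong sum≈ sum≈ ⟩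
    c ⊛ Σm′ ⊕ c ⊛ Σm′ ∎)
    where
    open ≈-Reasoning
    open Solver
    x = X^ 1
    y = X^ 2
    c = one ⊖ X^ 2
    P = X^ (suc m)
    E = sq (evenPart (cycleSeries m))
    E′ = sq (evenPart (cycleSeries (suc m)))
    r₀ = R⁺ (2 ℕ.+ m)
    r̄₀ = R⁻ (2 ℕ.+ m)
    r′ = R⁺ (3 ℕ.+ m)
    r̄′ = R⁻ (3 ℕ.+ m)
    e = sq (Re (2 ℕ.+ m))
    v = inv (Ũ (3 ℕ.+ m))
    Σm = ΣS m (λ i → term (2 ℕ.+ m) (2 ℕ.+ i))
    Σm′ = ΣS (suc m) (λ i → term (3 ℕ.+ m) (2 ℕ.+ i))
    -- Of the collected factors, `y ⊛ P` is the numerator of `invU (3 + m)`, and `x ⊛ y` is the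
    -- `X^ 3` of the diagonal summand.
    yP : (y ⊛ P) ≈ X^ (3 ℕ.+ m)
    yP = begin
      y ⊛ P                     ≈⟨ ⊛-congʳ P (X^-suc 1) ⟩
      x ⊛ x ⊛ P                 ≈⟨ ⊛-assoc x x P ⟩
      x ⊛ (x ⊛ P)               ≈⟨ ⊛-congˡ x (X^-suc (suc m)) ⟨
      x ⊛ X^ (2 ℕ.+ m)          ≈⟨ X^-suc (2 ℕ.+ m) ⟨
      X^ (3 ℕ.+ m)              ∎
    sum≈ : (c ⊛ (x ⊛ r̄′ ⊛ Σm ⊕ x ⊛ y ⊛ e ⊛ r̄′ ⊛ (y ⊛ P ⊛ v))) ≈ (c ⊛ Σm′)
    sum≈ = ⊛-congˡ c (S.+-cong
      (S.sym (ΣS-cong-⊛ (x ⊛ r̄′) m λ i i<m → term-suc (2 ℕ.+ m) (2 ℕ.+ i) (ℕ.+-monoʳ-≤ 2 (ℕ.<⇒≤ i<m))))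
      (S.trans (⊛-cong (⊛-congʳ r̄′ (⊛-congʳ e (S.sym (X^-suc 2)))) (⊛-congʳ v yP))
               (S.sym (term-diagonal (2 ℕ.+ m)))))

  sumFromTo-term : ∀ m → ((one ⊖ X^ 2) ⊛ sumFromTo 2 (suc m) (term (2 ℕ.+ m))) ≈ (X^ (suc m) ⊛ sq (evenPart (cycleSeries m)))
  sumFromTo-term m = S.trans
    (⊛-congˡ (one ⊖ X^ 2) (sumℤ-upTo m (λ i → term (2 ℕ.+ m) (2 ℕ.+ i))))
    (S.sym (chebyshev-sum m))

open PowerSeries

open import Data.Bool using (Bool; true; false; _∧_; if_then_else_; T)
open import Data.Bool.ListAction using (and)
open import Data.Bool.Properties using (T-∧)
open import Data.Empty using (⊥; ⊥-elim)
open import Data.Fin using (Fin; toℕ; fromℕ<)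
open import Data.Fin.Properties using (injective⇒≤; toℕ<n; toℕ-injective; toℕ-fromℕ<)
open import Data.Integer using () renaming (+_ to pos)
import Data.Integer as ℤ
import Data.Integer.Properties as ℤ
open import Data.List using (List; []; _∷_; _++_; map; concatMap; upTo; applyUpTo; length; zipWith; filterᵇ; take; drop; cartesianProductWith; initLast; _∷ʳ′_)
open import Data.List.Properties using (length-++; length-map; length-upTo; length-drop; map-cong; map-injective; map-applyUpTo; concatMap-cong; ++-identityʳ; ++-assoc; ++-cancelʳ; take++drop≡id; ∷-injective; ∷ʳ-injective; filter-none)
open import Data.List.Membership.Propositional using (_∈_; find; lose)
open import Data.List.Membership.Propositional.Properties using (∈-++⁻; ∈-++⁺ˡ; ∈-++⁺ʳ; ∈-map⁺; ∈-map⁻; ∈-concatMap⁺; ∈-concatMap⁻; ∈-upTo⁺; ∈-upTo⁻; ∈-cartesianProductWith⁺; ∈-cartesianProductWith⁻; ∈-filter⁺; ∈-filter⁻)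
open import Data.List.Membership.Propositional.Properties.WithK using (unique∧set⇒bag)
open import Data.List.Relation.Binary.BagAndSetEquality using (∼bag⇒↭)
open import Data.List.Relation.Binary.Permutation.Propositional.Properties using (↭-length)
open import Data.List.Relation.Unary.All as All using (All; []; _∷_)
import Data.List.Relation.Unary.All.Properties as All
open import Data.List.Relation.Unary.AllPairs as AllPairs using ([]; _∷_)
import Data.List.Relation.Unary.AllPairs.Properties as AllPairs
open import Data.List.Relation.Unary.Any as Any using (here; there)
open import Data.List.Relation.Unary.Unique.Propositional using (Unique)
import Data.List.Relation.Unary.Unique.Propositional.Properties as Unique
open import Data.Nat using (ℕ; zero; suc; _+_; _*_; _∸_; _≤_; _<_; z≤n; s≤s; _<?_; _≟_; _<ᵇ_; _≡ᵇ_)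
open import Data.Nat.Properties
open import Data.Nat.Tactic.RingSolver using (solve-∀)
open import Data.Product using (∃; _×_; _,_; proj₁; proj₂)
open import Data.Sum using (_⊎_; inj₁; inj₂)
open import Function using (_∘_; id; Equivalence; mk⇔)
open import Relation.Binary.Definitions using (tri<; tri≈; tri>)
open import Relation.Binary.PropositionalEquality using (_≡_; _≢_; refl; sym; trans; cong; cong₂; subst; subst₂; module ≡-Reasoning)
open import Relation.Nullary using (yes; no; ¬_)
open import Relation.Nullary.Decidable using (T?)

-- Enumerations

concatMap-unique : ∀ {A B : Set} (f : A → List B) {xs} → Unique xs → (∀ x → Unique (f x)) →
  (∀ {x y v} → v ∈ f x → v ∈ f y → x ≡ y) → Unique (concatMap f xs)
concatMap-unique f {xs} xs! f! disjoint = Unique.concat⁺ (All.map⁺ (All.universal f! xs))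
  (AllPairs.map⁺ (AllPairs.map (λ x≢y {_} v∈ → x≢y (disjoint (proj₁ v∈) (proj₂ v∈))) xs!))

length-concatMap : ∀ {A B : Set} (f : A → List B) xs →
  pos (length (concatMap f xs)) ≡ sumℤ (map (λ x → pos (length (f x))) xs)
length-concatMap f [] = refl
length-concatMap f (x ∷ xs) = trans (cong pos (length-++ (f x)))
  (cong (ℤ._+_ (pos (length (f x)))) (length-concatMap f xs))

length-cartesianProductWith : ∀ {A B C : Set} (f : A → B → C) xs ys →
  length (cartesianProductWith f xs ys) ≡ length xs * length ys
length-cartesianProductWith f [] ys = refl
length-cartesianProductWith f (x ∷ xs) ys = trans (length-++ (map (f x) ys))
  (cong₂ _+_ (length-map (f x) ys) (length-cartesianProductWith f xs ys))

counting : ∀ {A : Set} → (ℕ → List A) → Series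
counting L n = pos (length (L n))

record Enumerates {A : Set} (size : A → ℕ) (P : A → Set) (L : ℕ → List A) : Set where
  field
    unique   : ∀ n → Unique (L n)
    sound    : ∀ {n x} → x ∈ L n → size x ≡ n × P x
    complete : ∀ {x} → P x → x ∈ L (size x)
open Enumerates

-- Solutions of L = B + node(C, L), where node t x has size 1 + |t| + |x|; the first argument of grow is fuel.
module LinearGrowth {T A : Set} (node : T → A → A) (B : ℕ → List A) (C : ℕ → List T) where

  grow : ℕ → ℕ → List A
  layer : (ℕ → ℕ → List A) → ℕ → List A
  layer rec n = concatMap (λ i → cartesianProductWith node (C i) (rec i (n ∸ suc i))) (upTo n)
  -- The empty tail makes this agree definitionally with `grow (suc f)` at size 0, where the layer
  -- over `upTo 0` is empty.
  grow zero    n = B n ++ []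
  grow (suc f) n = B n ++ layer (λ _ → grow f) n

  -- Every recursive call lowers the size by at least one, so fuel beyond `n` is never reached.
  grow-fuel : ∀ {f f′} n → n ≤ f → n ≤ f′ → grow f n ≡ grow f′ n
  grow-fuel {zero} {zero} n _ _ = refl
  grow-fuel {zero} {suc f′} .zero z≤n _ = refl
  grow-fuel {suc f} {zero} .zero _ z≤n = refl
  grow-fuel {suc f} {suc f′} n n≤ n≤′ = cong (B n ++_) (concatMap-cong
    (λ i → cong (cartesianProductWith node (C i))
      (grow-fuel (n ∸ suc i) (smaller i n≤) (smaller i n≤′))) (upTo n))
    where
    smaller : ∀ i {f} → n ≤ suc f → n ∸ suc i ≤ f
    smaller i p = ≤-trans (∸-monoʳ-≤ n (s≤s z≤n)) (∸-monoˡ-≤ 1 p)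

  solution : ℕ → List A
  solution n = grow n n

  solution-unfold : ∀ n → solution (suc n) ≡ B (suc n) ++ layer (λ _ → solution) (suc n)
  solution-unfold n = cong (B (suc n) ++_) (concatMap-cong
    (λ i → cong (cartesianProductWith node (C i)) (grow-fuel (n ∸ i) (m∸n≤m n i) ≤-refl)) (upTo (suc n)))

  layer-length : ∀ n → pos (length (layer (λ _ → solution) (suc n))) ≡ (counting C ⊛ counting solution) n
  layer-length n = trans (length-concatMap (λ i → cartesianProductWith node (C i) (solution (n ∸ i))) (upTo (suc n)))
    (cong sumℤ (map-cong (λ i → trans (cong pos (length-cartesianProductWith node (C i) (solution (n ∸ i))))
      (ℤ.pos-* (length (C i)) _)) (upTo (suc n))))

  counting-solution : counting solution ≈ (counting B ⊕ X^ 1 ⊛ (counting C ⊛ counting solution))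
  counting-solution = pointwise go
    where
    open ≡-Reasoning
    go : ∀ n → counting solution n ≡ (counting B ⊕ X^ 1 ⊛ (counting C ⊛ counting solution)) n
    go zero = trans (cong (pos ∘ length) (++-identityʳ (B 0))) (sym (ℤ.+-identityʳ (pos (length (B 0)))))
    go (suc n) = begin
      pos (length (solution (suc n)))
        ≡⟨ cong (pos ∘ length) (solution-unfold n) ⟩
      pos (length (B (suc n) ++ layer (λ _ → solution) (suc n)))
        ≡⟨ cong pos (length-++ (B (suc n))) ⟩
      pos (length (B (suc n))) ℤ.+ pos (length (layer (λ _ → solution) (suc n)))
        ≡⟨ cong (ℤ._+_ (pos (length (B (suc n))))) (layer-length n) ⟩
      pos (length (B (suc n))) ℤ.+ (counting C ⊛ counting solution) n
        ≡⟨ cong (ℤ._+_ (pos (length (B (suc n))))) (X^1-⊛-suc (counting C ⊛ counting solution) n) ⟨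
      (counting B ⊕ X^ 1 ⊛ (counting C ⊛ counting solution)) (suc n) ∎

  module _ {sizeT : T → ℕ} {sizeA : A → ℕ} {PB P : A → Set} {PT : T → Set}
    (enumB : Enumerates sizeA PB B) (enumC : Enumerates sizeT PT C)
    (size-node : ∀ t x → sizeA (node t x) ≡ suc (sizeT t + sizeA x))
    (node-injective : ∀ {t t′ x x′} → node t x ≡ node t′ x′ → t ≡ t′ × x ≡ x′)
    (B-not-node : ∀ {t x} → PB (node t x) → ⊥)
    (P-base : ∀ {x} → PB x → P x)
    (P-node : ∀ {t x} → PT t → P x → P (node t x))
    (P-cases : ∀ {x} → P x → PB x ⊎ ∃ λ t → ∃ λ x′ → x ≡ node t x′ × PT t × P x′)
    where

    ∈-layer⁻ : ∀ rec n {x} → x ∈ layer (λ _ → rec) n →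
      ∃ λ i → ∃ λ t → ∃ λ x′ → i < n × t ∈ C i × x′ ∈ rec (n ∸ suc i) × x ≡ node t x′
    ∈-layer⁻ rec n p with i , i∈ , q ← find (∈-concatMap⁻ (λ i → cartesianProductWith node (C i) (rec (n ∸ suc i))) {xs = upTo n} p)
      with t , x′ , t∈ , x′∈ , eq ← ∈-cartesianProductWith⁻ node (C i) (rec (n ∸ suc i)) q
      = i , t , x′ , ∈-upTo⁻ i∈ , t∈ , x′∈ , eq

    grow-sound : ∀ f {n x} → x ∈ grow f n → sizeA x ≡ n × P x
    grow-sound zero {n} p with ∈-++⁻ (B n) p
    ... | inj₁ q = proj₁ (sound enumB q) , P-base (proj₂ (sound enumB q))
    grow-sound (suc f) {n} p with ∈-++⁻ (B n) p
    ... | inj₁ q = proj₁ (sound enumB q) , P-base (proj₂ (sound enumB q))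
    ... | inj₂ q with i , t , x′ , i<n , t∈ , x′∈ , refl ← ∈-layer⁻ (grow f) n q
        with eqT , pT ← sound enumC t∈ | eqA , pA ← grow-sound f x′∈
        = trans (size-node t x′) (trans (cong₂ (λ a b → suc (a + b)) eqT eqA) (m+[n∸m]≡n i<n)) , P-node pT pA

    grow-complete : ∀ f {x} → P x → sizeA x ≤ f → x ∈ grow f (sizeA x)
    grow-complete f {x} p ≤f with P-cases p
    grow-complete zero    p ≤f | inj₁ q = ∈-++⁺ˡ (complete enumB q)
    grow-complete (suc f) p ≤f | inj₁ q = ∈-++⁺ˡ (complete enumB q)
    grow-complete f p ≤f | inj₂ (t , x′ , refl , pT , pA) with sizeA (node t x′) | size-node t x′
    grow-complete (suc f) p (s≤s ≤f) | inj₂ (t , x′ , refl , pT , pA) | ._ | refl =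
      ∈-++⁺ʳ (B _) (∈-concatMap⁺ (λ i → cartesianProductWith node (C i) (grow f (sizeT t + sizeA x′ ∸ i)))
        (lose (∈-upTo⁺ (s≤s (m≤m+n (sizeT t) (sizeA x′))))
          (∈-cartesianProductWith⁺ node (complete enumC pT)
            (subst (λ k → x′ ∈ grow f k) (sym (m+n∸m≡n (sizeT t) (sizeA x′)))
              (grow-complete f pA (≤-trans (m≤n+m (sizeA x′) (sizeT t)) ≤f))))))

    grow-unique : ∀ f n → Unique (grow f n)
    grow-unique zero n = subst Unique (sym (++-identityʳ (B n))) (unique enumB n)
    grow-unique (suc f) n = Unique.++⁺ (unique enumB n)
      (concatMap-unique _ (Unique.upTo⁺ n)
        (λ i → Unique.cartesianProductWith⁺ node node-injective (unique enumC i) (grow-unique f (n ∸ suc i)))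
        (λ {i} {j} p q → same-size {i} {j} p q))
      (λ (p , q) → disjoint p q)
      where
      -- The index of a layer is the size of the first component, which the node determines.
      same-size : ∀ {i j v} → v ∈ cartesianProductWith node (C i) (grow f (n ∸ suc i)) →
        v ∈ cartesianProductWith node (C j) (grow f (n ∸ suc j)) → i ≡ j
      same-size {i} {j} p q
        with t , x , t∈ , _ , refl ← ∈-cartesianProductWith⁻ node (C i) (grow f (n ∸ suc i)) p
           | t′ , x′ , t′∈ , _ , eq ← ∈-cartesianProductWith⁻ node (C j) (grow f (n ∸ suc j)) q
        = trans (sym (proj₁ (sound enumC t∈)))
            (trans (cong sizeT (proj₁ (node-injective eq))) (proj₁ (sound enumC t′∈)))
      disjoint : ∀ {v} → v ∈ B n → v ∈ layer (λ _ → grow f) n → ⊥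
      disjoint p q with _ , _ , _ , _ , _ , _ , refl ← ∈-layer⁻ (grow f) n q = B-not-node (proj₂ (sound enumB p))

    solution-enumerates : Enumerates sizeA P solution
    solution-enumerates .unique n = grow-unique n n
    solution-enumerates .sound {n} = grow-sound n
    solution-enumerates .complete p = grow-complete _ p ≤-refl

inv-cong : ∀ {a b} → a ≈ b → inv a ≈ inv b
inv-cong {a} {b} p = pointwise inv-≡
  where
  invRev-≡ : ∀ n → invRev a n ≡ invRev b n
  invRev-≡ zero = refl
  invRev-≡ (suc n) rewrite invRev-≡ n = cong (λ l → ℤ.- sumℤ (zipWith ℤ._*_ l (invRev b n)) ∷ invRev b n)
    (map-cong (λ i → coeff p (suc i)) (upTo (length (invRev b n))))
  inv-≡ : ∀ n → inv a n ≡ inv b n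
  inv-≡ n rewrite invRev-≡ n = refl

linear-equation : ∀ a b c → b ≈ (a ⊕ X^ 1 ⊛ (c ⊛ b)) → b ≈ (a ⊛ inv (one ⊖ X^ 1 ⊛ c))
linear-equation a b c eq = begin
  b                                                ≈⟨ S.*-identityʳ b ⟨
  b ⊛ one                                          ≈⟨ ⊛-congˡ b (⊛-inverse d refl) ⟨
  b ⊛ (d ⊛ inv d)                                  ≈⟨ ⊛-assoc b d (inv d) ⟨
  b ⊛ d ⊛ inv d                                    ≈⟨ ⊛-congʳ (inv d) b⊛d ⟩
  a ⊛ inv d ∎
  where
  open ≈-Reasoning
  open Solver
  d = one ⊖ X^ 1 ⊛ c
  b⊛d : (b ⊛ d) ≈ a
  b⊛d = begin
    b ⊛ (one ⊕ neg (X^ 1 ⊛ c))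
      ≈⟨ ⊛-congˡ b (⊕-congʳ (neg (X^ 1 ⊛ c)) one≈const) ⟩
    b ⊛ (const (pos 1) ⊕ neg (X^ 1 ⊛ c))
      ≈⟨ solve 3 (λ b x c → b :* (con (pos 1) :+ :- (x :* c)) := b :+ :- (x :* (c :* b))) S.refl b (X^ 1) c ⟩
    b ⊕ neg (X^ 1 ⊛ (c ⊛ b))
      ≈⟨ ⊕-congʳ (neg (X^ 1 ⊛ (c ⊛ b))) eq ⟩
    a ⊕ X^ 1 ⊛ (c ⊛ b) ⊕ neg (X^ 1 ⊛ (c ⊛ b))
      ≈⟨ solve 2 (λ a z → a :+ z :+ :- z := a) S.refl a (X^ 1 ⊛ (c ⊛ b)) ⟩
    a ∎

-- Trees and involutions

-- Shapes of the permutations avoiding 132: the root is the maximum, and the left subtree stands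
-- before it and takes the larger of the remaining values.
data Tree : Set where
  leaf : Tree
  node : Tree → Tree → Tree

data Involution : Set where
  core : Tree → Involution
  fix  : Involution → Involution
  wrap : Tree → Involution → Involution

sizeT : Tree → ℕ
sizeT leaf       = 0
sizeT (node l r) = suc (sizeT l + sizeT r)

sizeI : Involution → ℕ
sizeI (core t)   = 3 + (sizeT t + sizeT t)
sizeI (fix o)    = suc (sizeI o)
sizeI (wrap t o) = 2 + (sizeT t + sizeT t) + sizeI o

cycles : Involution → ℕ
cycles (core t)   = suc (sizeT t)
cycles (fix o)    = cycles o
cycles (wrap t o) = suc (sizeT t + cycles o)

-- Applied to the index of the pattern shorter by one, this singles out 213. In a core, 213 is the
-- only pattern of the family with at least three letters that can use the fixed point; a longer one
-- would need two increasing letters above its 2, and after the 1 there is only one.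
ifZero : ℕ → ℕ → ℕ
ifZero zero    n = n
ifZero (suc _) n = 0

-- The numbers of occurrences of 2134⋯(m+2) in word t and in wordI o.
occT : ℕ → Tree → ℕ
occT m       leaf       = 0
occT zero    (node l r) = occT 0 l + occT 0 r + (sizeT l * sizeT r + sizeT r)
occT (suc m) (node l r) = occT (suc m) l + occT m l + occT (suc m) r

occI : ℕ → Involution → ℕ
occI zero    (core t)   = occT 0 t + (sizeT t + (suc (sizeT t) + occT 0 t)) + sizeT t * (2 + sizeT t)
occI zero    (fix o)    = occI 0 o
occI zero    (wrap t o) = occT 0 t + (occI 0 o + occT 0 t + sizeI o * suc (sizeT t)) + suc (sizeT t) * (sizeI o + suc (sizeT t))
occI (suc m) (core t)   = let c = occT (suc m) t + occT m t + ifZero m (sizeT t) in c + c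
occI (suc m) (fix o)    = occI (suc m) o + occI m o
occI (suc m) (wrap t o) = let d = occT (suc m) t + occT m t in d + (occI (suc m) o + d)

-- The involutions counted by g_{m+2}: 132 itself for m = 0, those containing 2134⋯(m+2) once for m > 0.
data Good : ℕ → Involution → Set where
  goodCore : Good 0 (core leaf)
  goodFix  : ∀ {m o} → Good m o → Good (suc m) (fix o)
  goodWrap : ∀ {m t o} → occT m t ≡ 0 → Good (suc m) o → Good (suc m) (wrap t o)

-- Shapes with exactly one occurrence of 2134⋯k

occT-suc : ∀ m t → occT m t ≡ 0 → occT (suc m) t ≡ 0
occT-suc m leaf p = refl
occT-suc zero (node l r) p
  rewrite occT-suc 0 l (m+n≡0⇒m≡0 (occT 0 l) (m+n≡0⇒m≡0 _ p))
        | m+n≡0⇒m≡0 (occT 0 l) (m+n≡0⇒m≡0 (occT 0 l + occT 0 r) p)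
        | occT-suc 0 r (m+n≡0⇒n≡0 (occT 0 l) (m+n≡0⇒m≡0 _ p)) = refl
occT-suc (suc m) (node l r) p
  rewrite occT-suc (suc m) l (m+n≡0⇒m≡0 (occT (suc m) l) (m+n≡0⇒m≡0 _ p))
        | m+n≡0⇒m≡0 (occT (suc m) l) (m+n≡0⇒m≡0 (occT (suc m) l + occT m l) p)
        | occT-suc (suc m) r (m+n≡0⇒n≡0 (occT (suc m) l + occT m l) p) = refl

-- The patterns are nested, so avoiding one entails avoiding the next. At `m = 0` cores and
-- wrappings are excluded outright, because their words have inversions.
occI-suc : ∀ m o → occI m o ≡ 0 → occI (suc m) o ≡ 0
occI-suc zero (core t) p with () ← trans (sym (+-suc (sizeT t) (sizeT t + occT 0 t)))
  (m+n≡0⇒n≡0 (occT 0 t) (m+n≡0⇒m≡0 (occT 0 t + (sizeT t + (suc (sizeT t) + occT 0 t))) p))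
occI-suc (suc m) (core t) p
  rewrite occT-suc (suc m) t (m+n≡0⇒m≡0 (occT (suc m) t) (m+n≡0⇒m≡0 _ (m+n≡0⇒m≡0 _ p)))
        | m+n≡0⇒m≡0 (occT (suc m) t) (m+n≡0⇒m≡0 (occT (suc m) t + occT m t) (m+n≡0⇒m≡0 _ p)) = refl
occI-suc zero (fix o) p rewrite occI-suc 0 o p = p
occI-suc (suc m) (fix o) p rewrite occI-suc (suc m) o (m+n≡0⇒m≡0 _ p) = m+n≡0⇒m≡0 _ p
occI-suc zero (wrap t o) p with () ← trans (sym (+-suc (sizeI o) (sizeT t)))
  (m+n≡0⇒m≡0 _ (m+n≡0⇒n≡0 (occT 0 t + (occI 0 o + occT 0 t + sizeI o * suc (sizeT t))) p))
occI-suc (suc m) (wrap t o) p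
  rewrite occT-suc (suc m) t (m+n≡0⇒m≡0 (occT (suc m) t) (m+n≡0⇒m≡0 _ p))
        | m+n≡0⇒m≡0 (occT (suc m) t) (m+n≡0⇒m≡0 (occT (suc m) t + occT m t) p)
        | occI-suc (suc m) o (m+n≡0⇒m≡0 _ (m+n≡0⇒n≡0 (occT (suc m) t + occT m t) p)) = refl

-- When a maximum is appended, the occurrences of the longer pattern already present are added to
-- the new ones; their absence keeps the total at one in `Good⇒once`.
Good⇒no-longer : ∀ {m o} → Good m o → occI (suc m) o ≡ 0
Good⇒no-longer goodCore = refl
Good⇒no-longer (goodFix {m} {o} p) rewrite Good⇒no-longer p = trans (+-identityʳ _) (occI-suc (suc m) o (Good⇒no-longer p))
Good⇒no-longer (goodWrap {m} {t} avoids p)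
  rewrite occT-suc m t avoids | occT-suc (suc m) t (occT-suc m t avoids) | Good⇒no-longer p = refl

Good⇒once : ∀ {m o} → Good m o → occI m o ≡ 1
Good⇒once goodCore = refl
Good⇒once (goodFix p) rewrite Good⇒no-longer p = Good⇒once p
Good⇒once (goodWrap {m} {t} avoids p)
  rewrite occT-suc m t avoids | avoids | Good⇒once p = refl

double≢1 : ∀ n → n + n ≢ 1
double≢1 (suc n) p with () ← trans (sym (+-suc n n)) (suc-injective p)

-- The core of a nonempty tree and every wrapping have at least two inversions, and a maximum
-- appended after an inversion completes a 213.
once-avoiding⇒core : ∀ o → occI 0 o ≡ 1 → occI 1 o ≡ 0 → Good 0 o
once-avoiding⇒core (core leaf) p q = goodCore
once-avoiding⇒core (core (node l r)) p q = ⊥-elim (<⇒≢ (≤-trans (s≤s (s≤s z≤n)) (m≤n+m _ (occT 0 t + _))) (sym p))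
  where t = node l r
once-avoiding⇒core (fix o) p q with () ← trans (sym p) (m+n≡0⇒n≡0 (occI 1 o) q)
once-avoiding⇒core (wrap t o) p q = ⊥-elim (<⇒≢ (≤-trans (bound t o) (m≤n+m _ (occT 0 t + _))) (sym p))
  where
  size-positive : ∀ o → 1 ≤ sizeI o
  size-positive (core t)   = s≤s z≤n
  size-positive (fix o)    = s≤s z≤n
  size-positive (wrap t o) = s≤s z≤n
  bound : ∀ t o → 2 ≤ suc (sizeT t) * (sizeI o + suc (sizeT t))
  bound t o = ≤-trans (+-mono-≤ (size-positive o) (s≤s z≤n)) (m≤m+n _ (sizeT t * (sizeI o + suc (sizeT t))))

-- What a core contributes is a double, and so is what a wrapping adds; a total of one excludes the
-- former and makes the latter zero. Under `fix` the shorter pattern must occur, for without it the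
-- longer one would be absent too; so its one occurrence, completed by the new maximum, uses up the
-- total.
once⇒Good : ∀ m o → occI (suc m) o ≡ 1 → Good (suc m) o
once⇒Good m (core t) p = ⊥-elim (double≢1 (occT (suc m) t + occT m t + ifZero m (sizeT t)) p)
once⇒Good m (wrap t o) p = go d refl p
  where
  d = occT (suc m) t + occT m t
  go : ∀ d′ → d ≡ d′ → d′ + (occI (suc m) o + d′) ≡ 1 → Good (suc m) (wrap t o)
  go zero eq p = goodWrap (m+n≡0⇒n≡0 (occT (suc m) t) eq) (once⇒Good m o (trans (sym (+-identityʳ _)) p))
  go (suc d′) eq p with () ← trans (sym (trans (cong (d′ +_) (+-suc (occI (suc m) o) d′)) (+-suc d′ _))) (suc-injective p)
once⇒Good m (fix o) p = go m (occI m o) refl p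
  where
  go : ∀ m x → occI m o ≡ x → occI (suc m) o + x ≡ 1 → Good (suc m) (fix o)
  go m zero eq p with () ← trans (sym (trans (+-identityʳ _) (occI-suc m o eq))) p
  go m (suc (suc x)) eq p with () ← trans (sym (trans (+-suc (occI (suc m) o) (suc x)) (cong suc (+-suc (occI (suc m) o) x)))) p
  -- A single inversion does not determine `o`; the remaining information, that `o` avoids 213,
  -- comes from `p`.
  go zero (suc zero) eq p = goodFix (once-avoiding⇒core o eq (suc-injective (trans (+-comm 1 (occI 1 o)) p)))
  go (suc m) (suc zero) eq p = goodFix (once⇒Good m o eq)

-- `suc m` is the number of fixed points: 132 has one, each `fix` adds one, and a wrapping adds
-- none.
Good⇒size : ∀ {m o} → Good m o → sizeI o ≡ suc m + (cycles o + cycles o)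
Good⇒size goodCore = refl
Good⇒size (goodFix p) = cong suc (Good⇒size p)
Good⇒size (goodWrap {m} {t} {o} _ p) = trans (cong (2 + (sizeT t + sizeT t) +_) (Good⇒size p)) (lem m (sizeT t) (cycles o))
  where
  lem : ∀ m t c → 2 + (t + t) + (2 + m + (c + c)) ≡ 2 + m + (suc (t + c) + suc (t + c))
  lem = solve-∀

-- Parity of the number of inversions

isEvenℕ-+double : ∀ n q → isEvenℕ (n + (q + q)) ≡ isEvenℕ n
isEvenℕ-+double n zero = cong isEvenℕ (+-identityʳ n)
isEvenℕ-+double n (suc q) = trans (cong isEvenℕ (lem n q)) (isEvenℕ-+double n q)
  where
  lem : ∀ n q → n + (suc q + suc q) ≡ suc (suc (n + (q + q)))
  lem = solve-∀

pronic-even : ∀ n → ∃ λ q → n * suc n ≡ q + q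
pronic-even zero = 0 , refl
pronic-even (suc n) with q , eq ← pronic-even n = q + suc n , trans (lem n) (trans (cong (_+ 2 * suc n) eq) (lem₂ q n))
  where
  lem : ∀ n → suc n * suc (suc n) ≡ n * suc n + 2 * suc n
  lem = solve-∀
  lem₂ : ∀ q n → q + q + 2 * suc n ≡ q + suc n + (q + suc n)
  lem₂ = solve-∀

-- Apart from one inversion per 2-cycle, the contributions come in equal pairs, except for a product
-- `m * suc m` of neighbours, which is even as well.
inversions-cycles : ∀ o → ∃ λ q → occI 0 o ≡ cycles o + (q + q)
inversions-cycles (core t) with q , eq ← pronic-even (sizeT t) =
  occT 0 t + sizeT t + q , trans (lem (occT 0 t) (sizeT t)) (trans (cong (suc (sizeT t) + 2 * occT 0 t + 2 * sizeT t +_) eq) (lem₂ (occT 0 t) (sizeT t) q))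
  where
  lem : ∀ a m → a + (m + (suc m + a)) + m * (2 + m) ≡ suc m + 2 * a + 2 * m + m * suc m
  lem = solve-∀
  lem₂ : ∀ a m q → suc m + 2 * a + 2 * m + (q + q) ≡ suc m + (a + m + q + (a + m + q))
  lem₂ = solve-∀
inversions-cycles (fix o) = inversions-cycles o
inversions-cycles (wrap t o) with q , eq ← pronic-even (sizeT t) | p , eq′ ← inversions-cycles o =
  a + sizeI o * suc m + q + p ,
  trans (cong (λ i → a + (i + a + sizeI o * suc m) + suc m * (sizeI o + suc m)) eq′)
    (trans (lem a (cycles o) p m (sizeI o))
      (trans (cong (suc (m + cycles o) + 2 * p + 2 * a + 2 * (sizeI o * suc m) +_) eq) (lem₂ a (cycles o) p m (sizeI o * suc m) q)))
  where
  a = occT 0 t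
  m = sizeT t
  lem : ∀ a c p m s → a + (c + (p + p) + a + s * suc m) + suc m * (s + suc m) ≡
        suc (m + c) + 2 * p + 2 * a + 2 * (s * suc m) + m * suc m
  lem = solve-∀
  lem₂ : ∀ a c p m s q → suc (m + c) + 2 * p + 2 * a + 2 * s + (q + q) ≡ suc (m + c) + (a + s + q + p + (a + s + q + p))
  lem₂ = solve-∀

inversions-parity : ∀ o → isEvenℕ (occI 0 o) ≡ isEvenℕ (cycles o)
inversions-parity o with q , eq ← inversions-cycles o = trans (cong isEvenℕ eq) (isEvenℕ-+double (cycles o) q)

-- Listing trees by size and involutions by 2-cycles

comb : ℕ → Tree
comb zero    = leaf
comb (suc n) = node (comb n) leaf

onlyLeaf : ℕ → List Tree
onlyLeaf zero    = leaf ∷ []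
onlyLeaf (suc _) = []

-- At level 0 the pattern is 21, so the word is increasing and the tree is a left comb.
trees : ℕ → ℕ → List Tree
trees zero    n = comb n ∷ []
trees (suc m) = LinearGrowth.solution node onlyLeaf (trees m)

-- Graded by `cycles`, so that `fix` preserves the degree and a wrapping has the degree of a node in
-- `LinearGrowth`.
involutions : ℕ → ℕ → List Involution
involutions zero    (suc zero) = core leaf ∷ []
involutions zero    _          = []
involutions (suc m) = LinearGrowth.solution wrap (map fix ∘ involutions m) (trees m)

node-injective : ∀ {l l′ r r′} → node l r ≡ node l′ r′ → l ≡ l′ × r ≡ r′
node-injective refl = refl , refl

wrap-injective : ∀ {t t′ o o′} → wrap t o ≡ wrap t′ o′ → t ≡ t′ × o ≡ o′
wrap-injective refl = refl , refl

fix-injective : ∀ {o o′} → fix o ≡ fix o′ → o ≡ o′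
fix-injective refl = refl

trees-enumerate : ∀ m → Enumerates sizeT (λ t → occT m t ≡ 0) (trees m)
trees-enumerate zero .unique n = [] ∷ []
trees-enumerate zero .sound {n} (here refl) = size-comb n , occT-comb n
  where
  size-comb : ∀ n → sizeT (comb n) ≡ n
  size-comb zero = refl
  size-comb (suc n) = cong suc (trans (+-identityʳ _) (size-comb n))
  occT-comb : ∀ n → occT 0 (comb n) ≡ 0
  occT-comb zero = refl
  occT-comb (suc n) rewrite occT-comb n | *-zeroʳ (sizeT (comb n)) = refl
trees-enumerate zero .complete p = here (comb-complete _ p)
  where
  comb-complete : ∀ t → occT 0 t ≡ 0 → t ≡ comb (sizeT t)
  comb-complete leaf p = refl
  comb-complete (node l leaf) p rewrite +-identityʳ (sizeT l) =
    cong (λ l → node l leaf) (comb-complete l (m+n≡0⇒m≡0 _ (m+n≡0⇒m≡0 _ p)))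
  comb-complete (node l (node r s)) p
    with () ← m+n≡0⇒n≡0 (sizeT l * sizeT (node r s)) (m+n≡0⇒n≡0 (occT 0 l + occT 0 (node r s)) p)
trees-enumerate (suc m) = LinearGrowth.solution-enumerates node onlyLeaf (trees m)
  {PB = _≡ leaf} onlyLeaf-enumerates (trees-enumerate m) (λ _ _ → refl) node-injective (λ ())
  (λ { refl → refl }) (λ {l} {r} p q → P-node l r p q) (λ {t} → cases t)
  where
  onlyLeaf-enumerates : Enumerates sizeT (_≡ leaf) onlyLeaf
  onlyLeaf-enumerates .unique zero = [] ∷ []
  onlyLeaf-enumerates .unique (suc _) = []
  onlyLeaf-enumerates .sound {zero} (here refl) = refl , refl
  onlyLeaf-enumerates .complete refl = here refl
  P-node : ∀ l r → occT m l ≡ 0 → occT (suc m) r ≡ 0 → occT (suc m) (node l r) ≡ 0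
  P-node l r p q rewrite occT-suc m l p | p | q = refl
  cases : ∀ t → occT (suc m) t ≡ 0 → t ≡ leaf ⊎ ∃ λ l → ∃ λ r → t ≡ node l r × occT m l ≡ 0 × occT (suc m) r ≡ 0
  cases leaf p = inj₁ refl
  cases (node l r) p = inj₂ (l , r , refl , m+n≡0⇒n≡0 (occT (suc m) l) (m+n≡0⇒m≡0 _ p) , m+n≡0⇒n≡0 (occT (suc m) l + occT m l) p)

involutions-enumerate : ∀ m → Enumerates cycles (Good m) (involutions m)
involutions-enumerate zero .unique zero = []
involutions-enumerate zero .unique (suc zero) = [] ∷ []
involutions-enumerate zero .unique (suc (suc _)) = []
involutions-enumerate zero .sound {suc zero} (here refl) = refl , goodCore
involutions-enumerate zero .complete goodCore = here refl
involutions-enumerate (suc m) = LinearGrowth.solution-enumerates wrap (map fix ∘ involutions m) (trees m)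
  {PB = λ o → ∃ λ o′ → o ≡ fix o′ × Good m o′} fix-enumerates (trees-enumerate m) (λ _ _ → refl) wrap-injective
  (λ ()) (λ { (_ , refl , p) → goodFix p }) goodWrap cases
  where
  previous = involutions-enumerate m
  fix-enumerates : Enumerates cycles (λ o → ∃ λ o′ → o ≡ fix o′ × Good m o′) (map fix ∘ involutions m)
  fix-enumerates .unique n = Unique.map⁺ fix-injective (unique previous n)
  fix-enumerates .sound p with o , o∈ , refl ← ∈-map⁻ fix p with eq , good ← sound previous o∈ = eq , o , refl , good
  fix-enumerates .complete (o , refl , p) = ∈-map⁺ fix (complete previous p)
  cases : ∀ {o} → Good (suc m) o → (∃ λ o′ → o ≡ fix o′ × Good m o′) ⊎
    ∃ λ t → ∃ λ o′ → o ≡ wrap t o′ × occT m t ≡ 0 × Good (suc m) o′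
  cases (goodFix p) = inj₁ (_ , refl , p)
  cases (goodWrap p q) = inj₂ (_ , _ , refl , p , q)

-- The offset of the index is set at level 0, where one comb for each size gives 1/(1 - x) = R_2.
counting-trees : ∀ m → counting (trees m) ≈ R (2 + m)
counting-trees zero = S.trans (linear-equation one (counting (trees 0)) one (pointwise geometric)) (⊛-identityˡ (R 2))
  where
  geometric : ∀ n → counting (trees 0) n ≡ (one ⊕ X^ 1 ⊛ (one ⊛ counting (trees 0))) n
  geometric zero = refl
  geometric (suc n) = sym (trans (ℤ.+-identityˡ _) (trans (X^1-⊛-suc (one ⊛ counting (trees 0)) n) (coeff (⊛-identityˡ (counting (trees 0))) n)))
counting-trees (suc m) = begin
  counting (trees (suc m))
    ≈⟨ linear-equation (counting onlyLeaf) (counting (trees (suc m))) (counting (trees m)) (LinearGrowth.counting-solution node onlyLeaf (trees m)) ⟩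
  counting onlyLeaf ⊛ inv (one ⊖ X^ 1 ⊛ counting (trees m))
    ≈⟨ ⊛-cong counting-onlyLeaf (inv-cong (⊕-congˡ one (S.-‿cong (⊛-congˡ (X^ 1) (counting-trees m)))) ) ⟩
  one ⊛ R (3 + m)
    ≈⟨ ⊛-identityˡ (R (3 + m)) ⟩
  R (3 + m) ∎
  where
  open ≈-Reasoning
  counting-onlyLeaf : counting onlyLeaf ≈ one
  counting-onlyLeaf = pointwise λ { zero → refl ; (suc _) → refl }

counting-involutions : ∀ m → counting (involutions m) ≈ cycleSeries m
counting-involutions zero = pointwise λ { zero → refl ; (suc zero) → refl ; (suc (suc _)) → refl }
counting-involutions (suc m) = begin
  counting (involutions (suc m))
    ≈⟨ linear-equation (counting (map fix ∘ involutions m)) (counting (involutions (suc m))) (counting (trees m)) (LinearGrowth.counting-solution wrap (map fix ∘ involutions m) (trees m)) ⟩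
  counting (map fix ∘ involutions m) ⊛ inv (one ⊖ X^ 1 ⊛ counting (trees m))
    ≈⟨ ⊛-cong (S.trans (pointwise λ n → cong pos (length-map fix (involutions m n))) (counting-involutions m))
         (inv-cong (⊕-congˡ one (S.-‿cong (⊛-congˡ (X^ 1) (counting-trees m))))) ⟩
  cycleSeries (suc m) ∎
  where open ≈-Reasoning

-- Counting pattern occurrences

<⇒true : ∀ {x y} → x < y → (x <ᵇ y) ≡ true
<⇒true {x} {y} p with x <ᵇ y | <⇒<ᵇ p
... | true | _ = refl

≤⇒false : ∀ {x y} → y ≤ x → (x <ᵇ y) ≡ false
≤⇒false {x} {y} p with x <ᵇ y | <ᵇ⇒< x y
... | true  | f = ⊥-elim (<⇒≱ (f _) p)
... | false | _ = refl

T-ext : ∀ {a b} → (T a → T b) → (T b → T a) → a ≡ b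
T-ext {true}  {true}  f g = refl
T-ext {true}  {false} f g = ⊥-elim (f _)
T-ext {false} {true}  f g = ⊥-elim (g _)
T-ext {false} {false} f g = refl

T-==⁻ : ∀ a b → T (a == b) → a ≡ b
T-==⁻ true  true  _ = refl
T-==⁻ false false _ = refl

T-==⁺ : ∀ {a b} → a ≡ b → T (a == b)
T-==⁺ {true}  refl = _
T-==⁺ {false} refl = _

T-∧⁺ : ∀ {a b} → T a → T b → T (a ∧ b)
T-∧⁺ p q = Equivalence.from T-∧ (p , q)

T-∧⁻ : ∀ {a b} → T (a ∧ b) → T a × T b
T-∧⁻ = Equivalence.to T-∧

and⁻ : ∀ {xs x} → T (and xs) → x ∈ xs → T x
and⁻ p (here refl) = proj₁ (T-∧⁻ p)
and⁻ p (there x∈)  = and⁻ (proj₂ (T-∧⁻ p)) x∈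

and⁺ : ∀ xs → (∀ {x} → x ∈ xs → T x) → T (and xs)
and⁺ []       f = _
and⁺ (x ∷ xs) f = T-∧⁺ (f (here refl)) (and⁺ xs (f ∘ there))

SameOrder : List ℕ → List ℕ → Set
SameOrder τ s = length s ≡ length τ ×
  (∀ a b → a < length τ → b < length τ → (at s a <ᵇ at s b) ≡ (at τ a <ᵇ at τ b))

orderIso⁻ : ∀ τ s → T (orderIso τ s) → SameOrder τ s
orderIso⁻ τ s p with eq , q ← T-∧⁻ p = ≡ᵇ⇒≡ _ _ eq , λ a b a< b< → T-==⁻ _ _
  (and⁻ q (∈-concatMap⁺ _ (lose (∈-upTo⁺ a<) (∈-map⁺ _ (∈-upTo⁺ b<)))))

orderIso⁺ : ∀ τ s → SameOrder τ s → T (orderIso τ s)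
orderIso⁺ τ s (eq , f) = T-∧⁺ (≡⇒≡ᵇ _ _ eq) (and⁺ _ λ x∈ → comparison (find (∈-concatMap⁻ _ {xs = upTo (length τ)} x∈)))
  where
  comparison : ∀ {x} → (∃ λ a → a ∈ upTo (length τ) ×
    x ∈ map (λ b → (at s a <ᵇ at s b) == (at τ a <ᵇ at τ b)) (upTo (length τ))) → T x
  comparison (a , a∈ , x∈) with b , b∈ , refl ← ∈-map⁻ _ x∈ = T-==⁺ (f a b (∈-upTo⁻ a∈) (∈-upTo⁻ b∈))

-- The pattern tests are recast letter by letter, in step with the recursion of `subseqs`, so that
-- occurrences can be counted by recursion on the word.
chain : ℕ → ℕ → List ℕ → Bool
chain zero    x []       = true
chain zero    x (_ ∷ _)  = false
chain (suc m) x []       = false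
chain (suc m) x (y ∷ ys) = (x <ᵇ y) ∧ chain m y ys

descentThenChain : ℕ → ℕ → List ℕ → Bool
descentThenChain m x []       = false
descentThenChain m x (y ∷ ys) = (y <ᵇ x) ∧ chain m x ys

is2134 : ℕ → List ℕ → Bool
is2134 m []       = false
is2134 m (x ∷ xs) = descentThenChain m x xs

isBetween : ℕ → ℕ → List ℕ → Bool
isBetween x y (z ∷ []) = (x <ᵇ z) ∧ (z <ᵇ y)
isBetween x y _        = false

ascentAndBetween : ℕ → List ℕ → Bool
ascentAndBetween x []       = false
ascentAndBetween x (y ∷ zs) = (x <ᵇ y) ∧ isBetween x y zs

is132 : List ℕ → Bool
is132 []       = false
is132 (x ∷ ys) = ascentAndBetween x ys

chain-length : ∀ m x s → T (chain m x s) → length s ≡ m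
chain-length zero    x []      p = refl
chain-length (suc m) x (y ∷ s) p = cong suc (chain-length m y s (proj₂ (T-∧⁻ p)))

chain-above : ∀ m x s → T (chain m x s) → ∀ i → i < m → x < at s i
chain-above (suc m) x (y ∷ s) p zero    i< = <ᵇ⇒< x y (proj₁ (T-∧⁻ p))
chain-above (suc m) x (y ∷ s) p (suc i) (s≤s i<) =
  <-trans (<ᵇ⇒< x y (proj₁ (T-∧⁻ p))) (chain-above m y s (proj₂ (T-∧⁻ p)) i i<)

chain-increasing : ∀ m x s → T (chain m x s) → ∀ i j → i < j → j < m → at s i < at s j
chain-increasing (suc m) x (y ∷ s) p zero    (suc j) i<j (s≤s j<) = chain-above m y s (proj₂ (T-∧⁻ p)) j j<
chain-increasing (suc m) x (y ∷ s) p (suc i) (suc j) (s≤s i<j) (s≤s j<) =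
  chain-increasing m y s (proj₂ (T-∧⁻ p)) i j i<j j<

chain-intro : ∀ m x s → length s ≡ m → (∀ i → i < m → x < at s i) →
  (∀ i j → i < j → j < m → at s i < at s j) → T (chain m x s)
chain-intro zero    x []      eq above increasing = _
chain-intro (suc m) x (y ∷ s) eq above increasing = T-∧⁺ (<⇒<ᵇ (above 0 (s≤s z≤n)))
  (chain-intro m y s (suc-injective eq) (λ i i< → increasing 0 (suc i) (s≤s z≤n) (s≤s i<))
    (λ i j i<j j< → increasing (suc i) (suc j) (s≤s i<j) (s≤s j<)))

at-applyUpTo : ∀ (f : ℕ → ℕ) m i → i < m → at (applyUpTo f m) i ≡ f i
at-applyUpTo f (suc m) zero    i< = refl
at-applyUpTo f (suc m) (suc i) (s≤s i<) = at-applyUpTo (f ∘ suc) m i i<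

at-p2134 : ∀ m i → i < m → at (p2134 (2 + m)) (2 + i) ≡ i + 3
at-p2134 m i i< = trans (cong (λ l → at l i) (map-applyUpTo id (_+ 3) m)) (at-applyUpTo (_+ 3) m i i<)

length-p2134 : ∀ m → length (p2134 (2 + m)) ≡ 2 + m
length-p2134 m = cong (2 +_) (trans (length-map (_+ 3) (upTo m)) (length-upTo m))

both-true : ∀ {a b c d} → a < b → c < d → (a <ᵇ b) ≡ (c <ᵇ d)
both-true p q = trans (<⇒true p) (sym (<⇒true q))

both-false : ∀ {a b c d} → b ≤ a → d ≤ c → (a <ᵇ b) ≡ (c <ᵇ d)
both-false p q = trans (≤⇒false p) (sym (≤⇒false q))

true⇒< : ∀ {x y} → (x <ᵇ y) ≡ true → x < y
true⇒< {x} {y} eq = <ᵇ⇒< x y (subst T (sym eq) _)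

SameOrder⇒2134 : ∀ m s → SameOrder (p2134 (2 + m)) s → T (is2134 m s)
SameOrder⇒2134 m s (eq , f) = go s (trans eq (length-p2134 m)) λ a b a< b< →
  f a b (subst (a <_) (sym (length-p2134 m)) a<) (subst (b <_) (sym (length-p2134 m)) b<)
  where
  go : ∀ s → length s ≡ 2 + m → (∀ a b → a < 2 + m → b < 2 + m →
    (at s a <ᵇ at s b) ≡ (at (p2134 (2 + m)) a <ᵇ at (p2134 (2 + m)) b)) → T (is2134 m s)
  go (x ∷ y ∷ s) eq f = T-∧⁺ (<⇒<ᵇ (true⇒< {y} {x} (f 1 0 (s≤s (s≤s z≤n)) (s≤s z≤n))))
    (chain-intro m x s (suc-injective (suc-injective eq))
      (λ i i< → true⇒< (trans (f 0 (2 + i) (s≤s z≤n) (s≤s (s≤s i<)))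
         (trans (cong (2 <ᵇ_) (at-p2134 m i i<)) (<⇒true (m≤n+m 3 i)))))
      (λ i j i<j j< → true⇒< (trans (f (2 + i) (2 + j) (s≤s (s≤s (<-trans i<j j<))) (s≤s (s≤s j<)))
         (trans (cong₂ _<ᵇ_ (at-p2134 m i (<-trans i<j j<)) (at-p2134 m j j<)) (<⇒true (+-monoˡ-< 3 i<j))))))

2134⇒SameOrder : ∀ m s → T (is2134 m s) → SameOrder (p2134 (2 + m)) s
2134⇒SameOrder m (x ∷ y ∷ s) p =
  trans (cong (2 +_) (chain-length m x s q)) (sym (length-p2134 m)) ,
  λ a b a< b< → go a b (subst (a <_) (length-p2134 m) a<) (subst (b <_) (length-p2134 m) b<)
  where
  q = proj₂ (T-∧⁻ p)
  y<x = <ᵇ⇒< y x (proj₁ (T-∧⁻ p))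
  above = chain-above m x s q
  go : ∀ a b → a < 2 + m → b < 2 + m →
    (at (x ∷ y ∷ s) a <ᵇ at (x ∷ y ∷ s) b) ≡ (at (p2134 (2 + m)) a <ᵇ at (p2134 (2 + m)) b)
  go zero zero _ _ = both-false {x} ≤-refl (≤-refl {2})
  go zero (suc zero) _ _ = both-false (<⇒≤ y<x) (s≤s (z≤n {1}))
  go zero (suc (suc j)) _ (s≤s (s≤s j<)) =
    both-true (above j j<) (subst (2 <_) (sym (at-p2134 m j j<)) (m≤n+m 3 j))
  go (suc zero) zero _ _ = both-true y<x (≤-refl {2})
  go (suc zero) (suc zero) _ _ = both-false {y} ≤-refl (≤-refl {1})
  go (suc zero) (suc (suc j)) _ (s≤s (s≤s j<)) =
    both-true (<-trans y<x (above j j<)) (subst (1 <_) (sym (at-p2134 m j j<)) (m≤n⇒m≤o+n j (s≤s (s≤s z≤n))))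
  go (suc (suc i)) zero (s≤s (s≤s i<)) _ =
    both-false (<⇒≤ (above i i<)) (subst (2 ≤_) (sym (at-p2134 m i i<)) (m≤n⇒m≤o+n i (s≤s (s≤s z≤n))))
  go (suc (suc i)) (suc zero) (s≤s (s≤s i<)) _ =
    both-false (<⇒≤ (<-trans y<x (above i i<))) (subst (1 ≤_) (sym (at-p2134 m i i<)) (m≤n⇒m≤o+n i (s≤s z≤n)))
  go (suc (suc i)) (suc (suc j)) (s≤s (s≤s i<)) (s≤s (s≤s j<)) rewrite at-p2134 m i i< | at-p2134 m j j< with <-cmp i j
  ... | tri< i<j _ _    = both-true (chain-increasing m x s q i j i<j j<) (+-monoˡ-< 3 i<j)
  ... | tri≈ _ refl _   = both-false {at s i} ≤-refl (≤-refl {i + 3})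
  ... | tri> _ _ j<i    = both-false (<⇒≤ (chain-increasing m x s q j i j<i i<)) (+-monoˡ-≤ 3 (<⇒≤ j<i))

orderIso-2134 : ∀ m s → orderIso (p2134 (2 + m)) s ≡ is2134 m s
orderIso-2134 m s = T-ext (SameOrder⇒2134 m s ∘ orderIso⁻ _ s) (orderIso⁺ _ s ∘ 2134⇒SameOrder m s)

orderIso-132 : ∀ s → orderIso p132 s ≡ is132 s
orderIso-132 s = T-ext (to s ∘ orderIso⁻ p132 s) (orderIso⁺ p132 s ∘ from s)
  where
  to : ∀ s → SameOrder p132 s → T (is132 s)
  to (x ∷ y ∷ z ∷ []) (refl , f) = T-∧⁺ {x <ᵇ y} (<⇒<ᵇ (<-trans x<z z<y)) (T-∧⁺ {x <ᵇ z} (<⇒<ᵇ x<z) (<⇒<ᵇ z<y))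
    where
    x<z = true⇒< {x} {z} (f 0 2 (s≤s z≤n) (s≤s (s≤s (s≤s z≤n))))
    z<y = true⇒< {z} {y} (f 2 1 (s≤s (s≤s (s≤s z≤n))) (s≤s (s≤s z≤n)))
  from : ∀ s → T (is132 s) → SameOrder p132 s
  from (x ∷ y ∷ []) p with () ← proj₂ (T-∧⁻ {x <ᵇ y} p)
  from (x ∷ y ∷ _ ∷ _ ∷ _) p with () ← proj₂ (T-∧⁻ {x <ᵇ y} p)
  from (x ∷ y ∷ z ∷ []) p = refl , go
    where
    q = proj₂ (T-∧⁻ {x <ᵇ y} p)
    x<z = <ᵇ⇒< x z (proj₁ (T-∧⁻ {x <ᵇ z} q))
    z<y = <ᵇ⇒< z y (proj₂ (T-∧⁻ {x <ᵇ z} q))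
    x<y = <-trans x<z z<y
    go : ∀ a b → a < 3 → b < 3 → (at (x ∷ y ∷ z ∷ []) a <ᵇ at (x ∷ y ∷ z ∷ []) b) ≡ (at p132 a <ᵇ at p132 b)
    go 0 0 _ _ = ≤⇒false {x} ≤-refl
    go 0 1 _ _ = <⇒true x<y
    go 0 2 _ _ = <⇒true x<z
    go 1 0 _ _ = ≤⇒false (<⇒≤ x<y)
    go 1 1 _ _ = ≤⇒false {y} ≤-refl
    go 1 2 _ _ = ≤⇒false (<⇒≤ z<y)
    go 2 0 _ _ = ≤⇒false (<⇒≤ x<z)
    go 2 1 _ _ = <⇒true z<y
    go 2 2 _ _ = ≤⇒false {z} ≤-refl
    go (suc (suc (suc _))) _ (s≤s (s≤s (s≤s ()))) _
    go 0 (suc (suc (suc _))) _ (s≤s (s≤s (s≤s ())))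
    go 1 (suc (suc (suc _))) _ (s≤s (s≤s (s≤s ())))
    go 2 (suc (suc (suc _))) _ (s≤s (s≤s (s≤s ())))

count : ∀ {A : Set} → (A → Bool) → List A → ℕ
count p []       = 0
count p (x ∷ xs) = (if p x then 1 else 0) + count p xs

length-filterᵇ : ∀ {A : Set} (p : A → Bool) xs → length (filterᵇ p xs) ≡ count p xs
length-filterᵇ p [] = refl
length-filterᵇ p (x ∷ xs) with p x
... | true  = cong suc (length-filterᵇ p xs)
... | false = length-filterᵇ p xs

count-++ : ∀ {A : Set} (p : A → Bool) xs ys → count p (xs ++ ys) ≡ count p xs + count p ys
count-++ p []       ys = refl
count-++ p (x ∷ xs) ys = trans (cong ((if p x then 1 else 0) +_) (count-++ p xs ys)) (sym (+-assoc (if p x then 1 else 0) _ _))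

count-map : ∀ {A B : Set} (p : B → Bool) (f : A → B) xs → count p (map f xs) ≡ count (p ∘ f) xs
count-map p f []       = refl
count-map p f (x ∷ xs) = cong ((if p (f x) then 1 else 0) +_) (count-map p f xs)

count-cong : ∀ {A : Set} {p q : A → Bool} → (∀ x → p x ≡ q x) → ∀ xs → count p xs ≡ count q xs
count-cong eq []       = refl
count-cong eq (x ∷ xs) = cong₂ _+_ (cong (if_then 1 else 0) (eq x)) (count-cong eq xs)

count-∧ : ∀ {A : Set} b (p : A → Bool) xs → count (λ x → b ∧ p x) xs ≡ (if b then count p xs else 0)
count-∧ true  p xs       = refl
count-∧ false p []       = refl
count-∧ false p (x ∷ xs) = count-∧ false p xs

count-subseqs : ∀ (p : List ℕ → Bool) m x xs → count p (subseqs (suc m) (x ∷ xs)) ≡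
  count (p ∘ (x ∷_)) (subseqs m xs) + count p (subseqs (suc m) xs)
count-subseqs p m x xs = trans (count-++ p (map (x ∷_) (subseqs m xs)) _)
  (cong (_+ count p (subseqs (suc m) xs)) (count-map p (x ∷_) (subseqs m xs)))

-- The number of increasing subsequences of length `m` in `ys` that begin above `x`: candidates for
-- the letters 3, 4, ... after a 2 with value `x`.
increasing : ℕ → ℕ → List ℕ → ℕ
increasing zero    x ys       = 1
increasing (suc m) x []       = 0
increasing (suc m) x (y ∷ ys) = (if x <ᵇ y then increasing m y ys else 0) + increasing (suc m) x ys

-- Here `x` plays the 2 and `y` the 1; the later letters need only be compared with `x`.
startingAt : ℕ → ℕ → List ℕ → ℕ
startingAt m x []       = 0
startingAt m x (y ∷ ys) = (if y <ᵇ x then increasing m x ys else 0) + startingAt m x ys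

-- count2134 m counts the occurrences of 2134⋯(m+2).
count2134 : ℕ → List ℕ → ℕ
count2134 m []       = 0
count2134 m (x ∷ xs) = startingAt m x xs + count2134 m xs

between : ℕ → ℕ → List ℕ → ℕ
between x y []       = 0
between x y (z ∷ zs) = (if (x <ᵇ z) ∧ (z <ᵇ y) then 1 else 0) + between x y zs

starting132 : ℕ → List ℕ → ℕ
starting132 x []       = 0
starting132 x (y ∷ ys) = (if x <ᵇ y then between x y ys else 0) + starting132 x ys

count132 : List ℕ → ℕ
count132 []       = 0
count132 (x ∷ xs) = starting132 x xs + count132 xs

count-increasing : ∀ m x ys → count (chain m x) (subseqs m ys) ≡ increasing m x ys
count-increasing zero    x ys = refl
count-increasing (suc m) x [] = refl
count-increasing (suc m) x (y ∷ ys) = trans (count-subseqs (chain (suc m) x) m y ys)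
  (cong₂ _+_ (trans (count-∧ (x <ᵇ y) (chain m y) (subseqs m ys))
                (cong (if x <ᵇ y then_else 0) (count-increasing m y ys)))
             (count-increasing (suc m) x ys))

count-startingAt : ∀ m x ys → count (descentThenChain m x) (subseqs (suc m) ys) ≡ startingAt m x ys
count-startingAt m x [] = refl
count-startingAt m x (y ∷ ys) = trans (count-subseqs (descentThenChain m x) m y ys)
  (cong₂ _+_ (trans (count-∧ (y <ᵇ x) (chain m x) (subseqs m ys))
                (cong (if y <ᵇ x then_else 0) (count-increasing m x ys)))
             (count-startingAt m x ys))

count-2134 : ∀ m xs → count (is2134 m) (subseqs (2 + m) xs) ≡ count2134 m xs
count-2134 m [] = refl
count-2134 m (x ∷ xs) = trans (count-subseqs (is2134 m) (suc m) x xs)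
  (cong₂ _+_ (count-startingAt m x xs) (count-2134 m xs))

occurrences-2134 : ∀ m xs → occurrences (p2134 (2 + m)) xs ≡ count2134 m xs
occurrences-2134 m xs = trans (length-filterᵇ (orderIso τ) (subseqs (length τ) xs))
  (trans (count-cong (orderIso-2134 m) (subseqs (length τ) xs))
    (trans (cong (λ k → count (is2134 m) (subseqs k xs)) (length-p2134 m)) (count-2134 m xs)))
  where τ = p2134 (2 + m)

count-between : ∀ x y zs → count (isBetween x y) (subseqs 1 zs) ≡ between x y zs
count-between x y [] = refl
count-between x y (z ∷ zs) = cong ((if (x <ᵇ z) ∧ (z <ᵇ y) then 1 else 0) +_) (count-between x y zs)

count-starting132 : ∀ x ys → count (ascentAndBetween x) (subseqs 2 ys) ≡ starting132 x ys
count-starting132 x [] = refl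
count-starting132 x (y ∷ ys) = trans (count-subseqs (ascentAndBetween x) 1 y ys)
  (cong₂ _+_ (trans (count-∧ (x <ᵇ y) (isBetween x y) (subseqs 1 ys))
                (cong (if x <ᵇ y then_else 0) (count-between x y ys)))
             (count-starting132 x ys))

occurrences-132 : ∀ xs → occurrences p132 xs ≡ count132 xs
occurrences-132 xs = trans (length-filterᵇ _ (subseqs 3 xs)) (trans (count-cong orderIso-132 (subseqs 3 xs)) (go xs))
  where
  go : ∀ xs → count is132 (subseqs 3 xs) ≡ count132 xs
  go [] = refl
  go (x ∷ xs) = trans (count-subseqs is132 2 x xs) (cong₂ _+_ (count-starting132 x xs) (go xs))

inversions-count : ∀ xs → inversions xs ≡ count2134 0 xs
inversions-count [] = refl
inversions-count (x ∷ xs) = cong₂ _+_ (trans (length-filterᵇ (_<ᵇ x) xs) (go xs)) (inversions-count xs)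
  where
  go : ∀ ys → count (_<ᵇ x) ys ≡ startingAt 0 x ys
  go [] = refl
  go (y ∷ ys) = cong ((if y <ᵇ x then 1 else 0) +_) (go ys)

-- Pattern counts of skew sums

increasing-below : ∀ m {x V} → All (_≤ x) V → increasing (suc m) x V ≡ 0
increasing-below m [] = refl
increasing-below m (y≤x ∷ V≤) rewrite ≤⇒false y≤x = increasing-below m V≤

increasing-skew : ∀ m {b x U V} → b ≤ x → All (b ≤_) U → All (_< b) V → increasing m x (U ++ V) ≡ increasing m x U
increasing-skew zero b≤x U≥ V< = refl
increasing-skew (suc m) b≤x [] V< = increasing-below m (All.map (λ y<b → <⇒≤ (<-≤-trans y<b b≤x)) V<)
increasing-skew (suc m) {x = x} b≤x (_∷_ {y} y≥ U≥) V< = cong₂ _+_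
  (cong (if x <ᵇ y then_else 0) (increasing-skew m y≥ U≥ V<)) (increasing-skew (suc m) b≤x U≥ V<)

startingAt-below : ∀ m {x V} → All (_≤ x) V → startingAt (suc m) x V ≡ 0
startingAt-below m [] = refl
startingAt-below m {x} (_∷_ {y} y≤x V≤) rewrite increasing-below m V≤ with y <ᵇ x
... | true  = startingAt-below m V≤
... | false = startingAt-below m V≤

-- If the 1 lay in the lower block, the 3 would come later and so lie there too, below the 2.
startingAt-skew : ∀ m {b x U V} → b ≤ x → All (b ≤_) U → All (_< b) V →
  startingAt (suc m) x (U ++ V) ≡ startingAt (suc m) x U
startingAt-skew m b≤x [] V< = startingAt-below m (All.map (λ y<b → <⇒≤ (<-≤-trans y<b b≤x)) V<)
startingAt-skew m {x = x} b≤x (_∷_ {y} y≥ U≥) V< = cong₂ _+_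
  (cong (if y <ᵇ x then_else 0) (increasing-skew (suc m) b≤x U≥ V<)) (startingAt-skew m b≤x U≥ V<)

startingAt-zero-above : ∀ {x V} → All (_< x) V → startingAt 0 x V ≡ length V
startingAt-zero-above [] = refl
startingAt-zero-above (y< ∷ V<) rewrite <⇒true y< = cong suc (startingAt-zero-above V<)

startingAt-zero-skew : ∀ {b x V} U → b ≤ x → All (_< b) V → startingAt 0 x (U ++ V) ≡ startingAt 0 x U + length V
startingAt-zero-skew [] b≤x V< = startingAt-zero-above (All.map (λ y<b → <-≤-trans y<b b≤x) V<)
startingAt-zero-skew {x = x} (y ∷ U) b≤x V< = trans (cong ((if y <ᵇ x then 1 else 0) +_) (startingAt-zero-skew U b≤x V<))
  (sym (+-assoc (if y <ᵇ x then 1 else 0) _ _))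

-- The patterns with at least three letters are not skew sums, so an occurrence stays in one block.
-- The pattern 21 is a skew sum; its crossing pairs are the product in `inversions-skew`.
count2134-skew : ∀ m {b U V} → All (b ≤_) U → All (_< b) V →
  count2134 (suc m) (U ++ V) ≡ count2134 (suc m) U + count2134 (suc m) V
count2134-skew m [] V< = refl
count2134-skew m (_∷_ {x} {U} x≥ U≥) V< = trans
  (cong₂ _+_ (startingAt-skew m x≥ U≥ V<) (count2134-skew m U≥ V<)) (sym (+-assoc (startingAt (suc m) x U) _ _))

inversions-skew : ∀ {b U V} → All (b ≤_) U → All (_< b) V →
  count2134 0 (U ++ V) ≡ count2134 0 U + count2134 0 V + length U * length V
inversions-skew {V = V} [] V< = sym (+-identityʳ _)
inversions-skew {V = V} (_∷_ {x} {U} x≥ U≥) V< = trans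
  (cong₂ _+_ (startingAt-zero-skew U x≥ V<) (inversions-skew U≥ V<))
  (lem (startingAt 0 x U) (length V) (count2134 0 U) (count2134 0 V) (length U))
  where
  lem : ∀ s v u w l → s + v + (u + w + l * v) ≡ s + u + w + suc l * v
  lem = solve-∀

increasing-[] : ∀ m x y → increasing m x [] ≡ increasing m y []
increasing-[] zero    x y = refl
increasing-[] (suc m) x y = refl

increasing-snoc : ∀ m {x c U} → x < c → All (_< c) U →
  increasing (suc m) x (U ++ c ∷ []) ≡ increasing (suc m) x U + increasing m x U
increasing-snoc m {x} {c} x<c [] rewrite <⇒true x<c = trans (+-identityʳ _) (increasing-[] m c x)
increasing-snoc zero {x} {c} x<c (_∷_ {y} {U} y<c U<) =
  trans (cong (_+_ (if x <ᵇ y then 1 else 0)) (increasing-snoc zero x<c U<)) (sym (+-assoc (if x <ᵇ y then 1 else 0) _ _))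
increasing-snoc (suc m) {x} {c} x<c (_∷_ {y} {U} y<c U<)
  rewrite increasing-snoc m y<c U< | increasing-snoc (suc m) x<c U< with x <ᵇ y
... | true  = lem (increasing (suc m) y U) (increasing m y U) (increasing (suc (suc m)) x U) (increasing (suc m) x U)
  where
  lem : ∀ a b c d → a + b + (c + d) ≡ a + c + (b + d)
  lem = solve-∀
... | false = refl

startingAt-snoc : ∀ m {x c U} → x < c → All (_< c) U →
  startingAt (suc m) x (U ++ c ∷ []) ≡ startingAt (suc m) x U + startingAt m x U
startingAt-snoc m {x} {c} x<c [] rewrite ≤⇒false (<⇒≤ x<c) = refl
startingAt-snoc m {x} {c} x<c (_∷_ {y} {U} y<c U<)
  rewrite startingAt-snoc m x<c U< | increasing-snoc m x<c U< with y <ᵇ x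
... | true  = lem (increasing (suc m) x U) (increasing m x U) (startingAt (suc m) x U) (startingAt m x U)
  where
  lem : ∀ a b c d → a + b + (c + d) ≡ a + c + (b + d)
  lem = solve-∀
... | false = refl

-- The appended maximum can only be the last letter of an occurrence, and it completes every
-- occurrence of the pattern shorter by one.
count2134-snoc : ∀ m {c U} → All (_< c) U → count2134 (suc m) (U ++ c ∷ []) ≡ count2134 (suc m) U + count2134 m U
count2134-snoc m [] = refl
count2134-snoc m (_∷_ {x} {U} x<c U<) rewrite startingAt-snoc m x<c U< | count2134-snoc m U< =
  lem (startingAt (suc m) x U) (startingAt m x U) (count2134 (suc m) U) (count2134 m U)
  where
  lem : ∀ a b c d → a + b + (c + d) ≡ a + c + (b + d)
  lem = solve-∀

inversions-snoc : ∀ {c U} → All (_< c) U → count2134 0 (U ++ c ∷ []) ≡ count2134 0 U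
inversions-snoc [] = refl
inversions-snoc {c} (_∷_ {x} {U} x<c U<) = cong₂ _+_ (go U) (inversions-snoc U<)
  where
  go : ∀ U → startingAt 0 x (U ++ c ∷ []) ≡ startingAt 0 x U
  go [] rewrite ≤⇒false (<⇒≤ x<c) = refl
  go (y ∷ U) = cong ((if y <ᵇ x then 1 else 0) +_) (go U)

<ᵇ-shift : ∀ c x y → (c + x <ᵇ c + y) ≡ (x <ᵇ y)
<ᵇ-shift zero    x y = refl
<ᵇ-shift (suc c) x y = <ᵇ-shift c x y

increasing-shift : ∀ m c x U → increasing m (c + x) (map (c +_) U) ≡ increasing m x U
increasing-shift zero    c x U = refl
increasing-shift (suc m) c x [] = refl
increasing-shift (suc m) c x (y ∷ U)
  rewrite <ᵇ-shift c x y | increasing-shift m c y U | increasing-shift (suc m) c x U = refl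

startingAt-shift : ∀ m c x U → startingAt m (c + x) (map (c +_) U) ≡ startingAt m x U
startingAt-shift m c x [] = refl
startingAt-shift m c x (y ∷ U)
  rewrite <ᵇ-shift c y x | increasing-shift m c x U | startingAt-shift m c x U = refl

count2134-shift : ∀ m c U → count2134 m (map (c +_) U) ≡ count2134 m U
count2134-shift m c [] = refl
count2134-shift m c (x ∷ U) = cong₂ _+_ (startingAt-shift m c x U) (count2134-shift m c U)

between-shift : ∀ c x y U → between (c + x) (c + y) (map (c +_) U) ≡ between x y U
between-shift c x y [] = refl
between-shift c x y (z ∷ U) rewrite <ᵇ-shift c x z | <ᵇ-shift c z y | between-shift c x y U = refl

starting132-shift : ∀ c x U → starting132 (c + x) (map (c +_) U) ≡ starting132 x U
starting132-shift c x [] = refl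
starting132-shift c x (y ∷ U) rewrite <ᵇ-shift c x y | between-shift c x y U | starting132-shift c x U = refl

count132-shift : ∀ c U → count132 (map (c +_) U) ≡ count132 U
count132-shift c [] = refl
count132-shift c (x ∷ U) = cong₂ _+_ (starting132-shift c x U) (count132-shift c U)

between-below : ∀ {x y V} → All (_≤ x) V → between x y V ≡ 0
between-below [] = refl
between-below (z≤ ∷ V≤) rewrite ≤⇒false z≤ = between-below V≤

between-skew : ∀ {b x y V} U → b ≤ x → All (_< b) V → between x y (U ++ V) ≡ between x y U
between-skew [] b≤x V< = between-below (All.map (λ z<b → <⇒≤ (<-≤-trans z<b b≤x)) V<)
between-skew {x = x} {y} (z ∷ U) b≤x V< = cong ((if (x <ᵇ z) ∧ (z <ᵇ y) then 1 else 0) +_) (between-skew U b≤x V<)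

starting132-below : ∀ {x V} → All (_≤ x) V → starting132 x V ≡ 0
starting132-below [] = refl
starting132-below (y≤ ∷ V≤) rewrite ≤⇒false y≤ = starting132-below V≤

starting132-skew : ∀ {b x V} U → b ≤ x → All (_< b) V → starting132 x (U ++ V) ≡ starting132 x U
starting132-skew [] b≤x V< = starting132-below (All.map (λ z<b → <⇒≤ (<-≤-trans z<b b≤x)) V<)
starting132-skew {x = x} (y ∷ U) b≤x V< = cong₂ _+_ (cong (if x <ᵇ y then_else 0) (between-skew U b≤x V<)) (starting132-skew U b≤x V<)

count132-skew : ∀ {b U V} → All (b ≤_) U → All (_< b) V → count132 (U ++ V) ≡ count132 U + count132 V
count132-skew [] V< = refl
count132-skew (_∷_ {x} {U} x≥ U≥) V< = trans (cong₂ _+_ (starting132-skew U x≥ V<) (count132-skew U≥ V<))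
  (sym (+-assoc (starting132 x U) _ _))

between-snoc : ∀ {x y c} U → y ≤ c → between x y (U ++ c ∷ []) ≡ between x y U
between-snoc {x} {y} {c} [] y≤c rewrite ≤⇒false y≤c with x <ᵇ c
... | true  = refl
... | false = refl
between-snoc {x} {y} (z ∷ U) y≤c = cong ((if (x <ᵇ z) ∧ (z <ᵇ y) then 1 else 0) +_) (between-snoc U y≤c)

starting132-snoc : ∀ {x c U} → All (_< c) U → starting132 x (U ++ c ∷ []) ≡ starting132 x U
starting132-snoc {x} {c} [] with x <ᵇ c
... | true  = refl
... | false = refl
starting132-snoc {x} (_∷_ {y} {U} y<c U<) = cong₂ _+_ (cong (if x <ᵇ y then_else 0) (between-snoc U (<⇒≤ y<c))) (starting132-snoc U<)

count132-snoc : ∀ {c U} → All (_< c) U → count132 (U ++ c ∷ []) ≡ count132 U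
count132-snoc [] = refl
count132-snoc (x<c ∷ U<) = cong₂ _+_ (starting132-snoc U<) (count132-snoc U<)

length-snoc : ∀ (U : List ℕ) c → length (U ++ c ∷ []) ≡ suc (length U)
length-snoc U c = trans (length-++ U) (+-comm (length U) 1)

module _ {b N U V} (U≥ : All (b ≤_) U) (b≤N : b ≤ N) (U< : All (_< N) U) (V< : All (_< b) V) where

  private
    UN≥ : All (b ≤_) (U ++ N ∷ [])
    UN≥ = All.++⁺ U≥ (b≤N ∷ [])

    split : U ++ N ∷ V ≡ (U ++ N ∷ []) ++ V
    split = sym (++-assoc U (N ∷ []) V)

  count2134-peak : ∀ m → count2134 (suc m) (U ++ N ∷ V) ≡ count2134 (suc m) U + count2134 m U + count2134 (suc m) V
  count2134-peak m = trans (cong (count2134 (suc m)) split)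
    (trans (count2134-skew m UN≥ V<) (cong (_+ count2134 (suc m) V) (count2134-snoc m U<)))

  inversions-peak : count2134 0 (U ++ N ∷ V) ≡ count2134 0 U + count2134 0 V + suc (length U) * length V
  inversions-peak = trans (cong (count2134 0) split) (trans (inversions-skew UN≥ V<)
    (cong₂ (λ i l → i + count2134 0 V + l * length V) (inversions-snoc U<) (length-snoc U N)))

  count132-peak : count132 (U ++ N ∷ V) ≡ count132 U + count132 V
  count132-peak = trans (cong count132 split) (trans (count132-skew UN≥ V<) (cong (_+ count132 V) (count132-snoc U<)))

-- The permutations described by trees and involutions

word word⁻¹ : Tree → List ℕ
word leaf       = []
word (node l r) = map (sizeT r +_) (word l) ++ (sizeT r + sizeT l) ∷ word r
word⁻¹ leaf       = []
-- Positions and values of `word (node l r)` are exchanged: the right subtree has the last positions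
-- and the lowest values there, hence the first positions and the highest values here.
word⁻¹ (node l r) = map (suc (sizeT l) +_) (word⁻¹ r) ++ (word⁻¹ l ++ sizeT l ∷ [])

-- In a core, the letter `m` is a fixed point, and the maximum, at position `suc m`, is exchanged
-- with the last letter. The letters of `word t` are exchanged with those of `word⁻¹ t`.
wordI : Involution → List ℕ
wordI (core t)   = let m = sizeT t in
  map (2 + m +_) (word t) ++ m ∷ (2 + m + m) ∷ (word⁻¹ t ++ suc m ∷ [])
wordI (fix o)    = wordI o ++ sizeI o ∷ []
wordI (wrap t o) = let m = sizeT t ; c = sizeI o in
  map (suc (m + c) +_) (word t) ++ (suc (m + c) + m) ∷ (map (suc m +_) (wordI o) ++ (word⁻¹ t ++ m ∷ []))

map-≥ : ∀ c U → All (c ≤_) (map (c +_) U)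
map-≥ c []      = []
map-≥ c (x ∷ U) = m≤m+n c x ∷ map-≥ c U

map-< : ∀ c {b U} → All (_< b) U → All (_< c + b) (map (c +_) U)
map-< c []       = []
map-< c (x< ∷ U<) = +-monoʳ-< c x< ∷ map-< c U<

All-weaken : ∀ {b c U} → b ≤ c → All (_< b) U → All (_< c) U
All-weaken b≤c = All.map λ x<b → <-≤-trans x<b b≤c

word-length : ∀ t → length (word t) ≡ sizeT t
word-length leaf = refl
word-length (node l r) rewrite length-++ (map (sizeT r +_) (word l)) {(sizeT r + sizeT l) ∷ word r}
  | length-map (sizeT r +_) (word l) | word-length l | word-length r = +-suc _ _

word⁻¹-length : ∀ t → length (word⁻¹ t) ≡ sizeT t
word⁻¹-length leaf = refl
word⁻¹-length (node l r) rewrite length-++ (map (suc (sizeT l) +_) (word⁻¹ r)) {word⁻¹ l ++ sizeT l ∷ []}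
  | length-map (suc (sizeT l) +_) (word⁻¹ r) | length-snoc (word⁻¹ l) (sizeT l) | word⁻¹-length l | word⁻¹-length r =
  trans (+-suc _ _) (cong suc (+-comm (sizeT r) (sizeT l)))

wordI-length : ∀ o → length (wordI o) ≡ sizeI o
wordI-length (core t) rewrite length-++ (map (2 + sizeT t +_) (word t)) {sizeT t ∷ (2 + sizeT t + sizeT t) ∷ (word⁻¹ t ++ suc (sizeT t) ∷ [])}
  | length-map (2 + sizeT t +_) (word t) | length-snoc (word⁻¹ t) (suc (sizeT t)) | word-length t | word⁻¹-length t = lem (sizeT t)
  where
  lem : ∀ m → m + (2 + suc m) ≡ 3 + (m + m)
  lem = solve-∀
wordI-length (fix o) = trans (length-snoc (wordI o) (sizeI o)) (cong suc (wordI-length o))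
wordI-length (wrap t o) = trans (length-++ (map (suc (m + c) +_) (word t)))
  (trans (cong₂ (λ a b → a + suc b) (trans (length-map _ (word t)) (word-length t))
    (trans (length-++ (map (suc m +_) (wordI o))) (cong₂ _+_ (trans (length-map _ (wordI o)) (wordI-length o))
      (trans (length-snoc (word⁻¹ t) m) (cong suc (word⁻¹-length t)))))) (lem m c))
  where
  m = sizeT t
  c = sizeI o
  lem : ∀ m c → m + suc (c + suc m) ≡ 2 + (m + m) + c
  lem = solve-∀

word-bound : ∀ t → All (_< sizeT t) (word t)
word-bound leaf = []
word-bound (node l r) = All.++⁺
  (All-weaken (≤-trans (≤-reflexive (+-comm (sizeT r) (sizeT l))) (n≤1+n _)) (map-< (sizeT r) (word-bound l)))
  (s≤s (≤-reflexive (+-comm (sizeT r) (sizeT l))) ∷ All-weaken (≤-trans (m≤n+m (sizeT r) (sizeT l)) (n≤1+n _)) (word-bound r))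

word⁻¹-bound : ∀ t → All (_< sizeT t) (word⁻¹ t)
word⁻¹-bound leaf = []
word⁻¹-bound (node l r) = All.++⁺ (map-< (suc (sizeT l)) (word⁻¹-bound r))
  (All.++⁺ (All-weaken (≤-trans (m≤m+n (sizeT l) (sizeT r)) (n≤1+n _)) (word⁻¹-bound l)) (s≤s (m≤m+n (sizeT l) (sizeT r)) ∷ []))

wordI-bound : ∀ o → All (_< sizeI o) (wordI o)
wordI-bound (core t) = All.++⁺ (All-weaken (n≤1+n _) (map-< (2 + m) (word-bound t)))
  (≤-trans (s≤s (m≤m+n m m)) (≤-trans (n≤1+n _) (n≤1+n _)) ∷ ≤-refl ∷
   All.++⁺ (All-weaken (≤-trans (m≤m+n m m) (m≤n+m _ 3)) (word⁻¹-bound t)) (s≤s (s≤s (≤-trans (m≤m+n m m) (n≤1+n _))) ∷ []))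
  where m = sizeT t
wordI-bound (fix o) = All.++⁺ (All-weaken (n≤1+n _) (wordI-bound o)) (≤-refl ∷ [])
wordI-bound (wrap t o) = All.++⁺ (All-weaken (≤-trans (≤-reflexive (lem m c)) (n≤1+n _)) (map-< (suc (m + c)) (word-bound t)))
  (s≤s (≤-reflexive (lem m c)) ∷ All.++⁺ (All-weaken (≤-trans (s≤s (+-monoˡ-≤ c (m≤m+n m m))) (n≤1+n _)) (map-< (suc m) (wordI-bound o)))
    (All.++⁺ (All-weaken (≤-trans (<⇒≤ m<) (n≤1+n _)) (word⁻¹-bound t)) (≤-trans m< (n≤1+n _) ∷ [])))
  where
  m = sizeT t
  c = sizeI o
  lem : ∀ m c → suc (m + c) + m ≡ suc (m + m + c)
  lem = solve-∀
  m< : m < suc (m + m + c)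
  m< = s≤s (≤-trans (m≤m+n m m) (m≤m+n (m + m) c))

count132-word : ∀ t → count132 (word t) ≡ 0
count132-word leaf = refl
count132-word (node l r) = trans
  (count132-peak (map-≥ (sizeT r) (word l)) (m≤m+n _ _) (map-< (sizeT r) (word-bound l)) (word-bound r))
  (cong₂ _+_ (trans (count132-shift (sizeT r) (word l)) (count132-word l)) (count132-word r))

count132-word⁻¹ : ∀ t → count132 (word⁻¹ t) ≡ 0
count132-word⁻¹ leaf = refl
count132-word⁻¹ (node l r) = trans
  (count132-skew (map-≥ (suc (sizeT l)) (word⁻¹ r)) (All.++⁺ (All-weaken (n≤1+n _) (word⁻¹-bound l)) (≤-refl ∷ [])))
  (cong₂ _+_ (trans (count132-shift (suc (sizeT l)) (word⁻¹ r)) (count132-word⁻¹ r))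
    (trans (count132-snoc (word⁻¹-bound l)) (count132-word⁻¹ l)))

count2134-word : ∀ m t → count2134 m (word t) ≡ occT m t
count2134-word zero leaf = refl
count2134-word (suc m) leaf = refl
count2134-word zero (node l r) = trans
  (inversions-peak (map-≥ (sizeT r) (word l)) (m≤m+n _ _) (map-< (sizeT r) (word-bound l)) (word-bound r))
  (cong₂ _+_ (cong₂ _+_ (trans (count2134-shift 0 (sizeT r) (word l)) (count2134-word 0 l)) (count2134-word 0 r))
    (trans (cong₂ (λ a b → suc a * b) (trans (length-map _ (word l)) (word-length l)) (word-length r)) (+-comm (sizeT r) _)))
count2134-word (suc m) (node l r) = trans
  (count2134-peak (map-≥ (sizeT r) (word l)) (m≤m+n _ _) (map-< (sizeT r) (word-bound l)) (word-bound r) m)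
  (cong₂ _+_ (cong₂ _+_ (trans (count2134-shift (suc m) (sizeT r) (word l)) (count2134-word (suc m) l))
                        (trans (count2134-shift m (sizeT r) (word l)) (count2134-word m l))) (count2134-word (suc m) r))

count2134-word⁻¹ : ∀ m t → count2134 m (word⁻¹ t) ≡ occT m t
count2134-word⁻¹ zero leaf = refl
count2134-word⁻¹ (suc m) leaf = refl
count2134-word⁻¹ zero (node l r) = trans
  (inversions-skew (map-≥ (suc (sizeT l)) (word⁻¹ r)) (All.++⁺ (All-weaken (n≤1+n _) (word⁻¹-bound l)) (≤-refl ∷ [])))
  (trans (cong₂ _+_ (cong₂ _+_ (trans (count2134-shift 0 (suc (sizeT l)) (word⁻¹ r)) (count2134-word⁻¹ 0 r))
            (trans (inversions-snoc (word⁻¹-bound l)) (count2134-word⁻¹ 0 l)))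
          (cong₂ _*_ (trans (length-map _ (word⁻¹ r)) (word⁻¹-length r)) (trans (length-snoc (word⁻¹ l) (sizeT l)) (cong suc (word⁻¹-length l)))))
    (lem (occT 0 r) (occT 0 l) (sizeT r) (sizeT l)))
  where
  lem : ∀ a b r l → a + b + r * suc l ≡ b + a + (l * r + r)
  lem = solve-∀
count2134-word⁻¹ (suc m) (node l r) = trans
  (count2134-skew m (map-≥ (suc (sizeT l)) (word⁻¹ r)) (All.++⁺ (All-weaken (n≤1+n _) (word⁻¹-bound l)) (≤-refl ∷ [])))
  (trans (cong₂ _+_ (trans (count2134-shift (suc m) (suc (sizeT l)) (word⁻¹ r)) (count2134-word⁻¹ (suc m) r))
           (trans (count2134-snoc m (word⁻¹-bound l)) (cong₂ _+_ (count2134-word⁻¹ (suc m) l) (count2134-word⁻¹ m l))))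
    (+-comm (occT (suc m) r) _))

-- The shape of core: U lies above m, then N is the maximum, and all of Q lies below U.
module _ {b x N Q} (x<b : x < b) (b≤N : b ≤ N) (Q< : All (_< b) Q) where

  increasing-core : ∀ k {y U} → b ≤ y → y < N → All (b ≤_) U → All (_< N) U →
    increasing (suc k) y (U ++ x ∷ N ∷ Q) ≡ increasing (suc k) y U + increasing k y U
  increasing-core k {y} b≤y y<N [] [] rewrite ≤⇒false (<⇒≤ (<-≤-trans x<b b≤y)) | <⇒true y<N
    | increasing-below k {y} (All.map (λ z<b → <⇒≤ (<-≤-trans z<b b≤y)) Q<) =
    trans (+-identityʳ _) (trans (increasing-skew k {U = []} b≤N [] Q<) (increasing-[] k N y))
  increasing-core zero {y} b≤y y<N (_∷_ {z} {U} z≥ U≥) (z< ∷ U<) =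
    trans (cong (_+_ (if y <ᵇ z then 1 else 0)) (increasing-core zero b≤y y<N U≥ U<)) (sym (+-assoc (if y <ᵇ z then 1 else 0) _ _))
  increasing-core (suc k) {y} b≤y y<N (_∷_ {z} {U} z≥ U≥) (z< ∷ U<)
    rewrite increasing-core k z≥ z< U≥ U< | increasing-core (suc k) b≤y y<N U≥ U< with y <ᵇ z
  ... | true  = lem (increasing (suc k) z U) (increasing k z U) (increasing (suc (suc k)) y U) (increasing (suc k) y U)
    where
    lem : ∀ a b c d → a + b + (c + d) ≡ a + c + (b + d)
    lem = solve-∀
  ... | false = refl

  increasing-[]≡ifZero : ∀ k y → increasing k y [] ≡ ifZero k 1
  increasing-[]≡ifZero zero    y = refl
  increasing-[]≡ifZero (suc k) y = refl

  -- The summand `ifZero k 1` is the occurrence `y x N` of 213, whose 1 lies outside the upper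
  -- block.
  startingAt-core : ∀ k {y U} → b ≤ y → y < N → All (b ≤_) U → All (_< N) U →
    startingAt (suc k) y (U ++ x ∷ N ∷ Q) ≡ startingAt (suc k) y U + startingAt k y U + ifZero k 1
  startingAt-core k {y} b≤y y<N [] [] rewrite <⇒true (<-≤-trans x<b b≤y) | ≤⇒false (<⇒≤ y<N) | <⇒true y<N
    | increasing-below k {y} (All.map (λ z<b → <⇒≤ (<-≤-trans z<b b≤y)) Q<)
    | startingAt-below k {y} (All.map (λ z<b → <⇒≤ (<-≤-trans z<b b≤y)) Q<) =
    trans (+-identityʳ _) (trans (+-identityʳ _) (trans (increasing-skew k {U = []} b≤N [] Q<) (increasing-[]≡ifZero k N)))
  startingAt-core k {y} b≤y y<N (_∷_ {z} {U} z≥ U≥) (z< ∷ U<)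
    rewrite increasing-core k b≤y y<N U≥ U< | startingAt-core k b≤y y<N U≥ U< with z <ᵇ y
  ... | true  = lem (increasing (suc k) y U) (increasing k y U) (startingAt (suc k) y U) (startingAt k y U) (ifZero k 1)
    where
    lem : ∀ a b c d e → a + b + (c + d + e) ≡ a + c + (b + d) + e
    lem = solve-∀
  ... | false = refl

  count2134-core : ∀ k {U} → All (b ≤_) U → All (_< N) U → count2134 (suc k) (U ++ x ∷ N ∷ Q) ≡
    count2134 (suc k) U + count2134 k U + ifZero k (length U) + count2134 (suc k) (x ∷ N ∷ Q)
  count2134-core zero    [] [] = refl
  count2134-core (suc k) [] [] = refl
  count2134-core k (_∷_ {y} {U} y≥ U≥) (y< ∷ U<) = trans
    (cong₂ _+_ (startingAt-core k y≥ y< U≥ U<) (count2134-core k U≥ U<))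
    (trans (lem (startingAt (suc k) y U) (startingAt k y U) (ifZero k 1) (count2134 (suc k) U) (count2134 k U) (ifZero k (length U)) _)
      (cong (λ n → startingAt (suc k) y U + count2134 (suc k) U + (startingAt k y U + count2134 k U) + n + _) (ifZero-suc k (length U))))
    where
    lem : ∀ a b c d e f g → a + b + c + (d + e + f + g) ≡ a + d + (b + e) + (c + f) + g
    lem = solve-∀
    ifZero-suc : ∀ k n → ifZero k 1 + ifZero k n ≡ ifZero k (suc n)
    ifZero-suc zero    n = refl
    ifZero-suc (suc k) n = refl

  inversions-core : ∀ {U} → All (b ≤_) U → All (_< N) U → count2134 0 (U ++ x ∷ N ∷ Q) ≡
    count2134 0 U + count2134 0 (x ∷ N ∷ Q) + length U * suc (length Q)
  inversions-core [] [] = sym (+-identityʳ _)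
  inversions-core (_∷_ {y} {U} y≥ U≥) (y< ∷ U<) = trans (cong₂ _+_ (go U) (inversions-core U≥ U<))
    (lem (startingAt 0 y U) (length Q) (count2134 0 U) _ (length U))
    where
    lem : ∀ s q u z l → s + suc q + (u + z + l * suc q) ≡ s + u + z + suc l * suc q
    lem = solve-∀
    go : ∀ U → startingAt 0 y (U ++ x ∷ N ∷ Q) ≡ startingAt 0 y U + suc (length Q)
    go [] rewrite <⇒true (<-≤-trans x<b y≥) | ≤⇒false (<⇒≤ y<)
      | startingAt-zero-above (All.map (λ z<b → <-≤-trans z<b y≥) Q<) = refl
    go (z ∷ U) = trans (cong ((if z <ᵇ y then 1 else 0) +_) (go U)) (sym (+-assoc (if z <ᵇ y then 1 else 0) _ _))

  -- A 132 that begins in `U` stays there: `x` and `Q` lie below its 1, and `N` is followed by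
  -- nothing large enough to be the 2.
  count132-core : ∀ {U} → All (b ≤_) U → All (_< N) U → count132 (U ++ x ∷ N ∷ Q) ≡ count132 U + count132 (x ∷ N ∷ Q)
  count132-core [] [] = refl
  count132-core (_∷_ {y} {U} y≥ U≥) (y< ∷ U<) = trans (cong₂ _+_ (go U<) (count132-core U≥ U<)) (sym (+-assoc (starting132 y U) _ _))
    where
    Q≤ : All (_≤ y) Q
    Q≤ = All.map (λ z<b → <⇒≤ (<-≤-trans z<b y≥)) Q<
    go₂ : ∀ {z} U → z < N → between y z (U ++ x ∷ N ∷ Q) ≡ between y z U
    go₂ [] z<N rewrite ≤⇒false (<⇒≤ (<-≤-trans x<b y≥)) | <⇒true y< | ≤⇒false (<⇒≤ z<N) = between-below Q≤
    go₂ {z} (w ∷ U) z<N = cong ((if (y <ᵇ w) ∧ (w <ᵇ z) then 1 else 0) +_) (go₂ U z<N)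
    go : ∀ {U} → All (_< N) U → starting132 y (U ++ x ∷ N ∷ Q) ≡ starting132 y U
    go [] rewrite ≤⇒false (<⇒≤ (<-≤-trans x<b y≥)) | <⇒true y< | between-below {y} {N} Q≤ = starting132-below Q≤
    go (_∷_ {z} {U} z< U<) = cong₂ _+_ (cong (if y <ᵇ z then_else 0) (go₂ U z<)) (go U<)

-- The tail of core after its upper block, with D below m.
module _ {m N D} (m+1<N : suc m < N) (D< : All (_< m) D) where

  private
    Q<N : All (_< N) (D ++ suc m ∷ [])
    Q<N = All.++⁺ (All-weaken (≤-trans (n≤1+n m) (<⇒≤ m+1<N)) D<) (m+1<N ∷ [])

    D<′ : All (_< suc m) D
    D<′ = All-weaken (n≤1+n m) D<

  -- The summand `ifZero k (length D)` counts the occurrences of 213 formed by `m`, a letter of `D`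
  -- and the final `suc m`.
  count2134-tail : ∀ k → count2134 (suc k) (m ∷ N ∷ (D ++ suc m ∷ [])) ≡ ifZero k (length D) + (count2134 (suc k) D + count2134 k D)
  count2134-tail k rewrite ≤⇒false (≤-trans (n≤1+n m) (<⇒≤ m+1<N)) | startingAt-below k {N} (All.map <⇒≤ Q<N) | count2134-snoc k D<′ =
    cong (_+ (count2134 (suc k) D + count2134 k D)) (trans (startingAt-snoc k ≤-refl D<′) (go k))
    where
    go : ∀ k → startingAt (suc k) m D + startingAt k m D ≡ ifZero k (length D)
    go zero    = cong₂ _+_ (startingAt-below 0 (All.map <⇒≤ D<)) (startingAt-zero-above D<)
    go (suc k) = cong₂ _+_ (startingAt-below (suc k) (All.map <⇒≤ D<)) (startingAt-below k (All.map <⇒≤ D<))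

  inversions-tail : count2134 0 (m ∷ N ∷ (D ++ suc m ∷ [])) ≡ length D + (suc (length D) + count2134 0 D)
  inversions-tail rewrite ≤⇒false (≤-trans (n≤1+n m) (<⇒≤ m+1<N)) | startingAt-zero-above Q<N | length-snoc D (suc m) | inversions-snoc D<′ =
    cong (_+ (suc (length D) + count2134 0 D)) (go D<)
    where
    go : ∀ {D} → All (_< m) D → startingAt 0 m (D ++ suc m ∷ []) ≡ length D
    go [] rewrite ≤⇒false (n≤1+n m) = refl
    go (y< ∷ D<) rewrite <⇒true y< = cong suc (go D<)

  -- The additional occurrence is `m`, `N`, `suc m`.
  count132-tail : count132 (m ∷ N ∷ (D ++ suc m ∷ [])) ≡ suc (count132 D)
  count132-tail rewrite <⇒true (<-trans (n<1+n m) m+1<N) | starting132-below {N} (All.map <⇒≤ Q<N) | count132-snoc D<′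
    | trans (starting132-snoc {m} D<′) (starting132-below (All.map <⇒≤ D<)) = cong (λ n → n + 0 + count132 D) (go D<)
    where
    go : ∀ {D} → All (_< m) D → between m N (D ++ suc m ∷ []) ≡ 1
    go [] rewrite <⇒true (n<1+n m) | <⇒true m+1<N = refl
    go (y< ∷ D<) rewrite ≤⇒false (<⇒≤ y<) = go D<

module Core (t : Tree) where
  private
    m = sizeT t
    U = map (2 + m +_) (word t)
    Q = word⁻¹ t ++ suc m ∷ []

    m<b : m < 2 + m
    m<b = n≤1+n (suc m)

    Q< : All (_< 2 + m) Q
    Q< = All.++⁺ (All-weaken (<⇒≤ m<b) (word⁻¹-bound t)) (≤-refl ∷ [])

    U≥ : All (2 + m ≤_) U
    U≥ = map-≥ (2 + m) (word t)

    U< : All (_< 2 + m + m) U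
    U< = map-< (2 + m) (word-bound t)

    b≤N : 2 + m ≤ 2 + m + m
    b≤N = m≤m+n (2 + m) m

    length-U : length U ≡ m
    length-U = trans (length-map _ (word t)) (word-length t)

  count132-coreI : count132 (wordI (core t)) ≡ 1
  count132-coreI = trans (count132-core m<b b≤N Q< U≥ U<)
    (cong₂ _+_ (trans (count132-shift (2 + m) (word t)) (count132-word t))
      (trans (count132-tail b≤N (word⁻¹-bound t)) (cong suc (count132-word⁻¹ t))))

  count2134-coreI : ∀ k → count2134 k (wordI (core t)) ≡ occI k (core t)
  count2134-coreI zero = trans (inversions-core m<b b≤N Q< U≥ U<)
    (cong₂ _+_ (cong₂ _+_ (trans (count2134-shift 0 (2 + m) (word t)) (count2134-word 0 t))
        (trans (inversions-tail b≤N (word⁻¹-bound t))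
          (cong₂ (λ l c → l + (suc l + c)) (word⁻¹-length t) (count2134-word⁻¹ 0 t))))
      (cong₂ (λ a b → a * suc b) length-U (trans (length-snoc (word⁻¹ t) (suc m)) (cong suc (word⁻¹-length t)))))
  count2134-coreI (suc k) = trans (count2134-core m<b b≤N Q< k U≥ U<)
    (cong₂ _+_ (cong₂ _+_ (cong₂ _+_ (trans (count2134-shift (suc k) (2 + m) (word t)) (count2134-word (suc k) t))
                                     (trans (count2134-shift k (2 + m) (word t)) (count2134-word k t)))
                          (cong (ifZero k) length-U))
      (trans (count2134-tail b≤N (word⁻¹-bound t) k)
        (trans (cong₂ _+_ (cong (ifZero k) (word⁻¹-length t)) (cong₂ _+_ (count2134-word⁻¹ (suc k) t) (count2134-word⁻¹ k t)))
          (+-comm (ifZero k m) _))))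

-- Stated for an arbitrary word `C`, because the decomposition counts the 132 in the inner word
-- before that word is known to be some `wordI o`.
module Wrap (t : Tree) (C : List ℕ) (C< : All (_< length C) C) where
  private
    m = sizeT t
    c = length C
    U = map (suc (m + c) +_) (word t)
    N = suc (m + c) + m
    MC = map (suc m +_) C
    D = word⁻¹ t ++ m ∷ []

    U≥ : All (suc (m + c) ≤_) U
    U≥ = map-≥ (suc (m + c)) (word t)

    b≤N : suc (m + c) ≤ N
    b≤N = m≤m+n (suc (m + c)) m

    U< : All (_< N) U
    U< = map-< (suc (m + c)) (word-bound t)

    MC≥ : All (suc m ≤_) MC
    MC≥ = map-≥ (suc m) C

    D< : All (_< suc m) D
    D< = All.++⁺ (All-weaken (n≤1+n m) (word⁻¹-bound t)) (≤-refl ∷ [])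

    V< : All (_< suc (m + c)) (MC ++ D)
    V< = All.++⁺ (map-< (suc m) C<) (All-weaken (s≤s (m≤m+n m c)) D<)

  count132-wrap : count132 (U ++ N ∷ (MC ++ D)) ≡ count132 C
  count132-wrap = trans (count132-peak U≥ b≤N U< V<)
    (trans (cong₂ _+_ (trans (count132-shift (suc (m + c)) (word t)) (count132-word t)) (count132-skew MC≥ D<))
      (trans (cong₂ _+_ (count132-shift (suc m) C) (trans (count132-snoc (word⁻¹-bound t)) (count132-word⁻¹ t))) (+-identityʳ _)))

  inversions-wrap : count2134 0 (U ++ N ∷ (MC ++ D)) ≡
    occT 0 t + (count2134 0 C + occT 0 t + c * suc m) + suc m * (c + suc m)
  inversions-wrap = trans (inversions-peak U≥ b≤N U< V<)
    (cong₂ _+_ (cong₂ _+_ (trans (count2134-shift 0 (suc (m + c)) (word t)) (count2134-word 0 t))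
        (trans (inversions-skew MC≥ D<)
          (cong₂ _+_ (cong₂ _+_ (count2134-shift 0 (suc m) C) (trans (inversions-snoc (word⁻¹-bound t)) (count2134-word⁻¹ 0 t)))
            (cong₂ _*_ (length-map _ C) length-D))))
      (cong₂ (λ a b → suc a * b) (trans (length-map _ (word t)) (word-length t))
        (trans (length-++ MC) (cong₂ _+_ (length-map _ C) length-D))))
    where
    length-D : length D ≡ suc m
    length-D = trans (length-snoc (word⁻¹ t) m) (cong suc (word⁻¹-length t))

  count2134-wrap : ∀ k → count2134 (suc k) (U ++ N ∷ (MC ++ D)) ≡
    occT (suc k) t + occT k t + (count2134 (suc k) C + (occT (suc k) t + occT k t))
  count2134-wrap k = trans (count2134-peak U≥ b≤N U< V< k)
    (cong₂ _+_ (cong₂ _+_ (trans (count2134-shift (suc k) (suc (m + c)) (word t)) (count2134-word (suc k) t))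
                          (trans (count2134-shift k (suc (m + c)) (word t)) (count2134-word k t)))
      (trans (count2134-skew k MC≥ D<) (cong₂ _+_ (count2134-shift (suc k) (suc m) C)
        (trans (count2134-snoc k (word⁻¹-bound t)) (cong₂ _+_ (count2134-word⁻¹ (suc k) t) (count2134-word⁻¹ k t))))))

wrapWord : Tree → List ℕ → List ℕ
wrapWord t C = let m = sizeT t ; c = length C in
  map (suc (m + c) +_) (word t) ++ (suc (m + c) + m) ∷ (map (suc m +_) C ++ (word⁻¹ t ++ m ∷ []))

wordI-wrap : ∀ t o → wordI (wrap t o) ≡ wrapWord t (wordI o)
wordI-wrap t o rewrite wordI-length o = refl

wordI-bound′ : ∀ o → All (_< length (wordI o)) (wordI o)
wordI-bound′ o rewrite wordI-length o = wordI-bound o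

count132-wordI : ∀ o → count132 (wordI o) ≡ 1
count132-wordI (core t)   = Core.count132-coreI t
count132-wordI (fix o)    = trans (count132-snoc (wordI-bound o)) (count132-wordI o)
count132-wordI (wrap t o) = trans (cong count132 (wordI-wrap t o))
  (trans (Wrap.count132-wrap t (wordI o) (wordI-bound′ o)) (count132-wordI o))

count2134-wordI : ∀ k o → count2134 k (wordI o) ≡ occI k o
count2134-wordI k (core t) = Core.count2134-coreI t k
count2134-wordI zero (fix o) = trans (inversions-snoc (wordI-bound o)) (count2134-wordI 0 o)
count2134-wordI (suc k) (fix o) = trans (count2134-snoc k (wordI-bound o))
  (cong₂ _+_ (count2134-wordI (suc k) o) (count2134-wordI k o))
count2134-wordI zero (wrap t o) = trans (cong (count2134 0) (wordI-wrap t o))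
  (trans (Wrap.inversions-wrap t (wordI o) (wordI-bound′ o))
    (cong₂ (λ i c → occT 0 t + (i + occT 0 t + c * suc (sizeT t)) + suc (sizeT t) * (c + suc (sizeT t)))
      (count2134-wordI 0 o) (wordI-length o)))
count2134-wordI (suc k) (wrap t o) = trans (cong (count2134 (suc k)) (wordI-wrap t o))
  (trans (Wrap.count2134-wrap t (wordI o) (wordI-bound′ o) k)
    (cong (λ n → occT (suc k) t + occT k t + (n + (occT (suc k) t + occT k t))) (count2134-wordI (suc k) o)))

-- Words as permutations

-- Indexing as a relation; in contrast to `at` it has no default value out of range.
data At : List ℕ → ℕ → ℕ → Set where
  here  : ∀ {x w} → At (x ∷ w) 0 x
  there : ∀ {x w i y} → At w i y → At (x ∷ w) (suc i) y

At-cast : ∀ {w i j x y} → i ≡ j → x ≡ y → At w i x → At w j y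
At-cast refl refl p = p

At-< : ∀ {w i x} → At w i x → i < length w
At-< here      = s≤s z≤n
At-< (there p) = s≤s (At-< p)

At-functional : ∀ {w i x y} → At w i x → At w i y → x ≡ y
At-functional here      here      = refl
At-functional (there p) (there q) = At-functional p q

at-At : ∀ w {i} → i < length w → At w i (at w i)
at-At (x ∷ w) {zero}  i<       = here
at-At (x ∷ w) {suc i} (s≤s i<) = there (at-At w i<)

At-at : ∀ {w i x} → At w i x → at w i ≡ x
At-at here      = refl
At-at (there p) = At-at p

At-++ˡ : ∀ {u v i x} → At u i x → At (u ++ v) i x
At-++ˡ here      = here
At-++ˡ (there p) = there (At-++ˡ p)

At-++ʳ : ∀ u {v i x} → At v i x → At (u ++ v) (length u + i) x
At-++ʳ []      p = p
At-++ʳ (_ ∷ u) p = there (At-++ʳ u p)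

At-++⁻ : ∀ u {v i x} → At (u ++ v) i x → At u i x ⊎ ∃ λ j → i ≡ length u + j × At v j x
At-++⁻ []      p    = inj₂ (_ , refl , p)
At-++⁻ (_ ∷ u) here = inj₁ here
At-++⁻ (_ ∷ u) (there p) with At-++⁻ u p
... | inj₁ q              = inj₁ (there q)
... | inj₂ (j , refl , q) = inj₂ (j , refl , q)

At-map⁺ : ∀ (f : ℕ → ℕ) {w i x} → At w i x → At (map f w) i (f x)
At-map⁺ f here      = here
At-map⁺ f (there p) = there (At-map⁺ f p)

At-map⁻ : ∀ (f : ℕ → ℕ) w {i x} → At (map f w) i x → ∃ λ y → x ≡ f y × At w i y
At-map⁻ f (y ∷ w) here = y , refl , here
At-map⁻ f (y ∷ w) (there p) with z , eq , q ← At-map⁻ f w p = z , eq , there q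

At-All : ∀ {P : ℕ → Set} {w i x} → All P w → At w i x → P x
At-All (px ∷ _) here      = px
At-All (_ ∷ pw) (there q) = At-All pw q

All-At : ∀ {P : ℕ → Set} w → (∀ {i x} → At w i x → P x) → All P w
All-At []      f = []
All-At (x ∷ w) f = f here ∷ All-At w (λ p → f (there p))

At-ext : ∀ u v → length u ≡ length v → (∀ {i x} → At u i x → At v i x) → u ≡ v
At-ext []      []      eq f = refl
At-ext (x ∷ u) (y ∷ v) eq f with here ← f here =
  cong (x ∷_) (At-ext u v (suc-injective eq) (λ p → tail (f (there p))))
  where
  tail : ∀ {y w i x} → At (y ∷ w) (suc i) x → At w i x
  tail (there p) = p

At-split : ∀ {w i x} → At w i x → ∃ λ u → ∃ λ v → w ≡ u ++ x ∷ v × length u ≡ i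
At-split here = [] , _ , refl , refl
At-split (there {y} p) with u , v , refl , refl ← At-split p = y ∷ u , v , refl , refl

Injective : List ℕ → Set
Injective w = ∀ {i j x} → At w i x → At w j x → i ≡ j

-- Such a word is a permutation: every letter is itself a position, hence below the length, and it
-- determines where it occurs.
SelfInverse : List ℕ → Set
SelfInverse w = ∀ {i x} → At w i x → At w x i

SelfInverse⇒Injective : ∀ {w} → SelfInverse w → Injective w
SelfInverse⇒Injective inv p q = At-functional (inv p) (inv q)

SelfInverse⇒bound : ∀ {w} → SelfInverse w → All (_< length w) w
SelfInverse⇒bound {w} inv = All-At w (λ p → At-< (inv p))

word-inverse : ∀ t {i x} → At (word t) i x → At (word⁻¹ t) x i
word-inverse (node l r) p with At-++⁻ (map (sizeT r +_) (word l)) p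
... | inj₁ q with y , refl , q′ ← At-map⁻ _ (word l) q =
      At-cast (cong (_+ y) (trans (length-map _ (word⁻¹ r)) (word⁻¹-length r))) refl
        (At-++ʳ (map (suc (sizeT l) +_) (word⁻¹ r)) (At-++ˡ (word-inverse l q′)))
... | inj₂ (_ , refl , here) =
      At-cast (cong₂ _+_ (trans (length-map _ (word⁻¹ r)) (word⁻¹-length r)) (trans (+-identityʳ _) (word⁻¹-length l)))
        (sym (trans (+-identityʳ _) (trans (length-map _ (word l)) (word-length l))))
        (At-++ʳ (map (suc (sizeT l) +_) (word⁻¹ r)) (At-++ʳ (word⁻¹ l) here))
... | inj₂ (suc j , refl , there q) =
      At-cast refl (trans (sym (+-suc (sizeT l) j)) (cong (_+ suc j) (sym (trans (length-map _ (word l)) (word-length l)))))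
        (At-++ˡ (At-map⁺ (suc (sizeT l) +_) (word-inverse r q)))

word⁻¹-inverse : ∀ t {i x} → At (word⁻¹ t) i x → At (word t) x i
word⁻¹-inverse (node l r) p with At-++⁻ (map (suc (sizeT l) +_) (word⁻¹ r)) p
... | inj₁ q with y , refl , q′ ← At-map⁻ _ (word⁻¹ r) q =
      At-cast (trans (cong (_+ suc y) (trans (length-map _ (word l)) (word-length l))) (+-suc (sizeT l) y)) refl
        (At-++ʳ (map (sizeT r +_) (word l)) (there (word⁻¹-inverse r q′)))
... | inj₂ (j , refl , q) with At-++⁻ (word⁻¹ l) q
...   | inj₁ q′ = At-cast refl (cong (_+ j) (sym (trans (length-map _ (word⁻¹ r)) (word⁻¹-length r))))
        (At-++ˡ (At-map⁺ (sizeT r +_) (word⁻¹-inverse l q′)))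
...   | inj₂ (_ , refl , here) = At-cast (trans (+-identityʳ _) (trans (length-map _ (word l)) (word-length l)))
        (sym (cong₂ _+_ (trans (length-map _ (word⁻¹ r)) (word⁻¹-length r)) (trans (+-identityʳ _) (word⁻¹-length l))))
        (At-++ʳ (map (sizeT r +_) (word l)) here)

snoc-selfInverse : ∀ {w} → SelfInverse w → SelfInverse (w ++ length w ∷ [])
snoc-selfInverse {w} inv p with At-++⁻ w p
... | inj₁ q = At-++ˡ (inv q)
... | inj₂ (_ , refl , here) = At-cast (+-identityʳ _) (sym (+-identityʳ _)) (At-++ʳ w here)

core-selfInverse : ∀ t → SelfInverse (wordI (core t))
core-selfInverse t {i} {x} p with At-++⁻ (map (2 + sizeT t +_) (word t)) p
... | inj₁ q with y , refl , q′ ← At-map⁻ _ (word t) q =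
      At-cast (trans (cong (_+ (2 + y)) (trans (length-map _ (word t)) (word-length t))) (lem (sizeT t) y)) refl
        (At-++ʳ (map (2 + sizeT t +_) (word t)) (there (there (At-++ˡ (word-inverse t q′)))))
  where
  lem : ∀ m y → m + (2 + y) ≡ 2 + m + y
  lem = solve-∀
... | inj₂ (_ , refl , here) = At-cast eq (sym eq) (At-++ʳ (map (2 + sizeT t +_) (word t)) here)
  where
  eq : length (map (2 + sizeT t +_) (word t)) + 0 ≡ sizeT t
  eq = trans (+-identityʳ _) (trans (length-map _ (word t)) (word-length t))
... | inj₂ (_ , refl , there here) =
      At-cast (trans (cong₂ (λ a b → a + (2 + (b + 0))) (trans (length-map _ (word t)) (word-length t)) (word⁻¹-length t)) (lem (sizeT t)))
        (sym (trans (cong (_+ 1) (trans (length-map _ (word t)) (word-length t))) (+-comm (sizeT t) 1)))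
        (At-++ʳ (map (2 + sizeT t +_) (word t)) (there (there (At-++ʳ (word⁻¹ t) here))))
  where
  lem : ∀ m → m + (2 + (m + 0)) ≡ 2 + m + m
  lem = solve-∀
... | inj₂ (suc (suc j) , refl , there (there q)) with At-++⁻ (word⁻¹ t) q
...   | inj₁ q′ = At-cast refl (sym (trans (cong (_+ (2 + j)) (trans (length-map _ (word t)) (word-length t))) (lem (sizeT t) j)))
        (At-++ˡ (At-map⁺ (2 + sizeT t +_) (word⁻¹-inverse t q′)))
  where
  lem : ∀ m y → m + (2 + y) ≡ 2 + m + y
  lem = solve-∀
...   | inj₂ (_ , refl , here) =
        At-cast (trans (cong (_+ 1) (trans (length-map _ (word t)) (word-length t))) (+-comm (sizeT t) 1))
          (sym (trans (cong₂ (λ a b → a + (2 + (b + 0))) (trans (length-map _ (word t)) (word-length t)) (word⁻¹-length t)) (lem (sizeT t))))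
          (At-++ʳ (map (2 + sizeT t +_) (word t)) (there here))
  where
  lem : ∀ m → m + (2 + (m + 0)) ≡ 2 + m + m
  lem = solve-∀

wrap-selfInverse : ∀ t {C} → SelfInverse C → SelfInverse (wrapWord t C)
wrap-selfInverse t {C} inv p with At-++⁻ (map (suc (sizeT t + length C) +_) (word t)) p
... | inj₁ q with y , refl , q′ ← At-map⁻ _ (word t) q =
      At-cast (trans (cong₂ (λ a b → a + suc (b + y)) (trans (length-map _ (word t)) (word-length t)) (length-map _ C)) (lem (sizeT t) (length C) y)) refl
        (At-++ʳ (map (suc (sizeT t + length C) +_) (word t)) (there (At-++ʳ (map (suc (sizeT t) +_) C) (At-++ˡ (word-inverse t q′)))))
  where
  lem : ∀ m c y → m + suc (c + y) ≡ suc (m + c) + y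
  lem = solve-∀
... | inj₂ (_ , refl , here) =
      At-cast (trans (cong₂ (λ a b → a + suc (b + (length (word⁻¹ t) + 0))) (trans (length-map _ (word t)) (word-length t)) (length-map _ C))
                (trans (cong (λ d → sizeT t + suc (length C + (d + 0))) (word⁻¹-length t)) (lem (sizeT t) (length C))))
        (sym (trans (+-identityʳ _) (trans (length-map _ (word t)) (word-length t))))
        (At-++ʳ (map (suc (sizeT t + length C) +_) (word t)) (there (At-++ʳ (map (suc (sizeT t) +_) C) (At-++ʳ (word⁻¹ t) here))))
  where
  lem : ∀ m c → m + suc (c + (m + 0)) ≡ suc (m + c) + m
  lem = solve-∀
... | inj₂ (suc j , refl , there q) with At-++⁻ (map (suc (sizeT t) +_) C) q
...   | inj₁ q′ with y , refl , q″ ← At-map⁻ _ C q′ =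
        At-cast (trans (cong (_+ suc y) (trans (length-map _ (word t)) (word-length t))) (+-suc (sizeT t) y))
          (sym (trans (cong (_+ suc j) (trans (length-map _ (word t)) (word-length t))) (+-suc (sizeT t) j)))
          (At-++ʳ (map (suc (sizeT t + length C) +_) (word t)) (there (At-++ˡ (At-map⁺ (suc (sizeT t) +_) (inv q″)))))
...   | inj₂ (k , refl , q′) with At-++⁻ (word⁻¹ t) q′
...     | inj₁ q″ = At-cast refl
            (sym (trans (cong₂ (λ a b → a + suc (b + k)) (trans (length-map _ (word t)) (word-length t)) (length-map _ C)) (lem (sizeT t) (length C) k)))
            (At-++ˡ (At-map⁺ (suc (sizeT t + length C) +_) (word⁻¹-inverse t q″)))
  where
  lem : ∀ m c y → m + suc (c + y) ≡ suc (m + c) + y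
  lem = solve-∀
...     | inj₂ (_ , refl , here) =
          At-cast (trans (+-identityʳ _) (trans (length-map _ (word t)) (word-length t)))
            (sym (trans (cong₂ (λ a b → a + suc (b + (length (word⁻¹ t) + 0))) (trans (length-map _ (word t)) (word-length t)) (length-map _ C))
                (trans (cong (λ d → sizeT t + suc (length C + (d + 0))) (word⁻¹-length t)) (lem (sizeT t) (length C)))))
            (At-++ʳ (map (suc (sizeT t + length C) +_) (word t)) here)
  where
  lem : ∀ m c → m + suc (c + (m + 0)) ≡ suc (m + c) + m
  lem = solve-∀

wordI-selfInverse : ∀ o → SelfInverse (wordI o)
wordI-selfInverse (core t)   = core-selfInverse t
wordI-selfInverse (fix o)    = subst (λ n → SelfInverse (wordI o ++ n ∷ [])) (wordI-length o) (snoc-selfInverse (wordI-selfInverse o))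
wordI-selfInverse (wrap t o) = subst SelfInverse (sym (wordI-wrap t o)) (wrap-selfInverse t (wordI-selfInverse o))

pigeonhole : ∀ b n {w} → Injective w → All (b ≤_) w → All (_< b + n) w → length w ≤ n
pigeonhole b n {w} inj w≥ w< = injective⇒≤ {f = f} f-injective
  where
  value : Fin (length w) → ℕ
  value i = at w (toℕ i)
  at-value : ∀ i → At w (toℕ i) (value i)
  at-value i = at-At w (toℕ<n i)
  value≥ : ∀ i → b ≤ value i
  value≥ i = At-All w≥ (at-value i)
  value< : ∀ i → value i ∸ b < n
  value< i = subst (value i ∸ b <_) (m+n∸m≡n b n) (∸-monoˡ-< (At-All w< (at-value i)) (value≥ i))
  f : Fin (length w) → Fin n
  f i = fromℕ< (value< i)
  f-injective : ∀ {i j} → f i ≡ f j → i ≡ j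
  f-injective {i} {j} eq = toℕ-injective (inj (at-value i) (subst (At w (toℕ j)) (sym value≡) (at-value j)))
    where
    value≡ : value i ≡ value j
    value≡ = ∸-cancelʳ-≡ (value≥ i) (value≥ j)
      (trans (sym (toℕ-fromℕ< (value< i))) (trans (cong toℕ eq) (toℕ-fromℕ< (value< j))))

-- Occurrences of 132 as triples of positions

record Occurs132 (w : List ℕ) (a b c : ℕ) : Set where
  constructor occurs
  field
    {x y z} : ℕ
    at-a    : At w a x
    at-b    : At w b y
    at-c    : At w c z
    a<b     : a < b
    b<c     : b < c
    x<z     : x < z
    z<y     : z < y

between-positive : ∀ {x y w c z} → At w c z → x < z → z < y → 1 ≤ between x y w
between-positive here p q rewrite <⇒true p | <⇒true q = s≤s z≤n
between-positive (there r) p q = ≤-trans (between-positive r p q) (m≤n+m _ _)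

starting132-positive : ∀ {x w b y c z} → At w b y → At w c z → b < c → x < z → z < y → 1 ≤ starting132 x w
starting132-positive here (there r) _ p q rewrite <⇒true (<-trans p q) =
  ≤-trans (between-positive r p q) (m≤m+n _ _)
starting132-positive (there s) (there r) (s≤s b<c) p q = ≤-trans (starting132-positive s r b<c p q) (m≤n+m _ _)

count132-positive : ∀ {w a b c} → Occurs132 w a b c → 1 ≤ count132 w
count132-positive (occurs here (there s) (there r) _ (s≤s b<c) p q) = ≤-trans (starting132-positive s r b<c p q) (m≤m+n _ _)
count132-positive (occurs (there t) (there s) (there r) (s≤s a<b) (s≤s b<c) p q) =
  ≤-trans (count132-positive (occurs t s r a<b b<c p q)) (m≤n+m _ _)

if-positive : ∀ b {n} → 1 ≤ (if b then n else 0) → 1 ≤ n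
if-positive true p = p

sum-positive : ∀ {m n} → 1 ≤ m + n → 1 ≤ m ⊎ 1 ≤ n
sum-positive {zero}  p = inj₂ p
sum-positive {suc m} p = inj₁ (s≤s z≤n)

between-witness : ∀ {x y} w → 1 ≤ between x y w → ∃ λ c → ∃ λ z → At w c z × x < z × z < y
between-witness {x} {y} (z ∷ w) p with x <ᵇ z in eq | z <ᵇ y in eq′
... | true | true = 0 , z , here , true⇒< eq , true⇒< eq′
... | true | false with c , z , q , r ← between-witness w p = suc c , z , there q , r
... | false | _ with c , z , q , r ← between-witness w p = suc c , z , there q , r

starting132-witness : ∀ {x} w → 1 ≤ starting132 x w →
  ∃ λ b → ∃ λ c → ∃ λ y → ∃ λ z → At w b y × At w c z × b < c × x < z × z < y
starting132-witness {x} (y ∷ w) p with sum-positive {if x <ᵇ y then between x y w else 0} p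
... | inj₂ q with b , c , y , z , s , r , b<c , rest ← starting132-witness w q =
  suc b , suc c , y , z , there s , there r , s≤s b<c , rest
... | inj₁ q with c , z , r , rest ← between-witness w (if-positive (x <ᵇ y) q) =
  0 , suc c , y , z , here , there r , s≤s z≤n , rest

count132-witness : ∀ w → 1 ≤ count132 w → ∃ λ a → ∃ λ b → ∃ λ c → Occurs132 w a b c
count132-witness (x ∷ w) p with sum-positive {starting132 x w} p
... | inj₁ q with b , c , y , z , s , r , b<c , x<z , z<y ← starting132-witness w q =
  0 , suc b , suc c , occurs here (there s) (there r) (s≤s z≤n) (s≤s b<c) x<z z<y
... | inj₂ q with a , b , c , occurs t s r a<b b<c x<z z<y ← count132-witness w q =
  suc a , suc b , suc c , occurs (there t) (there s) (there r) (s≤s a<b) (s≤s b<c) x<z z<y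

not-both : ∀ {m n} → m + n ≤ 1 → 1 ≤ m → 1 ≤ n → ⊥
not-both p q r with s≤s () ← ≤-trans (+-mono-≤ q r) p

between-unique : ∀ {x y w c c′ z z′} → between x y w ≤ 1 → At w c z → x < z → z < y →
  At w c′ z′ → x < z′ → z′ < y → c ≡ c′
between-unique le here p q here p′ q′ = refl
between-unique le here p q (there r) p′ q′ rewrite <⇒true p | <⇒true q =
  ⊥-elim (not-both le (s≤s z≤n) (between-positive r p′ q′))
between-unique le (there r) p q here p′ q′ rewrite <⇒true p′ | <⇒true q′ =
  ⊥-elim (not-both le (s≤s z≤n) (between-positive r p q))
between-unique le (there r) p q (there r′) p′ q′ =
  cong suc (between-unique (≤-trans (m≤n+m _ _) le) r p q r′ p′ q′)

starting132-unique : ∀ {x w b b′ c c′ y y′ z z′} → starting132 x w ≤ 1 →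
  At w b y → At w c z → b < c → x < z → z < y →
  At w b′ y′ → At w c′ z′ → b′ < c′ → x < z′ → z′ < y′ → b ≡ b′ × c ≡ c′
starting132-unique le here (there r) _ p q here (there r′) _ p′ q′ rewrite <⇒true (<-trans p q) =
  refl , cong suc (between-unique (≤-trans (m≤m+n _ _) le) r p q r′ p′ q′)
starting132-unique le here (there r) _ p q (there s′) (there r′) (s≤s b<c′) p′ q′ rewrite <⇒true (<-trans p q) =
  ⊥-elim (not-both le (between-positive r p q) (starting132-positive s′ r′ b<c′ p′ q′))
starting132-unique le (there s) (there r) (s≤s b<c) p q here (there r′) _ p′ q′ rewrite <⇒true (<-trans p′ q′) =
  ⊥-elim (not-both le (between-positive r′ p′ q′) (starting132-positive s r b<c p q))
starting132-unique le (there s) (there r) (s≤s b<c) p q (there s′) (there r′) (s≤s b<c′) p′ q′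
  with eq , eq′ ← starting132-unique (≤-trans (m≤n+m _ _) le) s r b<c p q s′ r′ b<c′ p′ q′ = cong suc eq , cong suc eq′

-- Converts the bound on the count into equations between positions, from which the shape of a core
-- is read off.
count132-unique : ∀ {w a b c a′ b′ c′} → count132 w ≤ 1 → Occurs132 w a b c → Occurs132 w a′ b′ c′ →
  a ≡ a′ × b ≡ b′ × c ≡ c′
count132-unique le (occurs here (there s) (there r) _ (s≤s b<c) p q) (occurs here (there s′) (there r′) _ (s≤s b<c′) p′ q′)
  with eq , eq′ ← starting132-unique (≤-trans (m≤m+n _ _) le) s r b<c p q s′ r′ b<c′ p′ q′ = refl , cong suc eq , cong suc eq′
count132-unique le (occurs here (there s) (there r) _ (s≤s b<c) p q) (occurs (there t) (there s′) (there r′) (s≤s a<b′) (s≤s b<c′) p′ q′) =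
  ⊥-elim (not-both le (starting132-positive s r b<c p q) (count132-positive (occurs t s′ r′ a<b′ b<c′ p′ q′)))
count132-unique le (occurs (there t) (there s) (there r) (s≤s a<b) (s≤s b<c) p q) (occurs here (there s′) (there r′) _ (s≤s b<c′) p′ q′) =
  ⊥-elim (not-both le (starting132-positive s′ r′ b<c′ p′ q′) (count132-positive (occurs t s r a<b b<c p q)))
count132-unique le (occurs (there t) (there s) (there r) (s≤s a<b) (s≤s b<c) p q) (occurs (there t′) (there s′) (there r′) (s≤s a<b′) (s≤s b<c′) p′ q′)
  with eq , eq′ , eq″ ← count132-unique (≤-trans (m≤n+m _ _) le) (occurs t s r a<b b<c p q) (occurs t′ s′ r′ a<b′ b<c′ p′ q′)
  = cong suc eq , cong suc eq′ , cong suc eq″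

-- Decomposing an involution at its maximum

unshift : ∀ c {U} → All (c ≤_) U → ∃ λ U′ → U ≡ map (c +_) U′
unshift c [] = [] , refl
unshift c (c≤x ∷ U≥) with U′ , eq ← unshift c U≥ = _ ∷ U′ , cong₂ _∷_ (sym (m+[n∸m]≡n c≤x)) eq

map-<⁻ : ∀ c {b} U → All (_< c + b) (map (c +_) U) → All (_< b) U
map-<⁻ c []      []        = []
map-<⁻ c (x ∷ U) (p ∷ U<) = +-cancelˡ-< c _ _ p ∷ map-<⁻ c U U<

Injective-map⁻ : ∀ c {U} → Injective (map (c +_) U) → Injective U
Injective-map⁻ c inj p q = inj (At-map⁺ (c +_) p) (At-map⁺ (c +_) q)

Injective-++ˡ : ∀ {u v} → Injective (u ++ v) → Injective u
Injective-++ˡ inj p q = inj (At-++ˡ p) (At-++ˡ q)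

Injective-++ʳ : ∀ u {v} → Injective (u ++ v) → Injective v
Injective-++ʳ u inj p q = +-cancelˡ-≡ (length u) _ _ (inj (At-++ʳ u p) (At-++ʳ u q))

∈⇒At : ∀ {x w} → x ∈ w → ∃ λ i → At w i x
∈⇒At (here refl) = 0 , here
∈⇒At (there p) with i , q ← ∈⇒At p = suc i , there q

At⇒∈ : ∀ {x w i} → At w i x → x ∈ w
At⇒∈ here      = here refl
At⇒∈ (there p) = there (At⇒∈ p)

remove-bound : ∀ {n w} → All (_< suc n) w → (∀ {i} → ¬ At w i n) → All (_< n) w
remove-bound {n} {w} w< n∉ = All-At w λ p → ≤∧≢⇒< (≤-pred (At-All w< p)) λ { refl → n∉ p }

max-occurs : ∀ {n w} → length w ≡ suc n → Injective w → All (_< suc n) w → ∃ λ i → At w i n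
max-occurs {n} {w} eq inj w< with Any.any? (n ≟_) w
... | yes p = ∈⇒At p
... | no n∉ = ⊥-elim (<-irrefl refl (subst (_≤ n) eq
  (pigeonhole 0 n inj (All.universal (λ _ → z≤n) w) (remove-bound w< (n∉ ∘ At⇒∈)))))

module Peak {u n v} (inj : Injective (u ++ n ∷ v)) (len : length (u ++ n ∷ v) ≡ suc n) (w< : All (_< suc n) (u ++ n ∷ v)) where

  inU : ∀ {i x} → At u i x → At (u ++ n ∷ v) i x
  inU = At-++ˡ

  atPeak : At (u ++ n ∷ v) (length u) n
  atPeak = At-cast (+-identityʳ _) refl (At-++ʳ u here)

  inV : ∀ {i x} → At v i x → At (u ++ n ∷ v) (length u + suc i) x
  inV p = At-++ʳ u (there p)

  n≡ : n ≡ length u + length v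
  n≡ = suc-injective (trans (sym len) (trans (length-++ u) (+-suc (length u) (length v))))

  U<n : All (_< n) u
  U<n = remove-bound (All.++⁻ˡ u w<) λ p → <⇒≢ (At-< p) (inj (inU p) atPeak)

  V<n : All (_< n) v
  V<n = remove-bound (All.tail (All.++⁻ʳ u w<)) λ p → m≢1+m+n (length u)
    (trans (inj atPeak (inV p)) (+-suc (length u) _))

  module _ (above : ∀ {i x j z} → At u i x → At v j z → z < x) where

    -- The distinct letters of `u` lie strictly between `z` and `n`, so there are at most
    -- `n - z - 1` of them; with `n ≡ length u + length v` this bounds `z`.
    V<|v| : All (_< length v) v
    V<|v| = All-At v λ {j} {z} q → +-cancelˡ-≤ (length u) (suc z) (length v) (subst (length u + suc z ≤_) n≡
      (m≤o∸n⇒m+n≤o (length u) (At-All V<n q)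
        (pigeonhole (suc z) (n ∸ suc z) (Injective-++ˡ inj) (All-At u λ p → above p q)
          (subst (λ k → All (_< k) u) (sym (m+[n∸m]≡n (At-All V<n q))) U<n))))

    -- A letter of `u` exceeds all the distinct letters of `v`, so it is at least their number.
    lower : ∃ λ u′ → u ≡ map (length v +_) u′ × All (_< length u′) u′
    lower with u′ , eq ← unshift (length v) {u} (All-At u λ {i} {x} p → pigeonhole 0 x
                 (λ q r → suc-injective (Injective-++ʳ u inj (there q) (there r)))
                 (All.universal (λ _ → z≤n) v) (All-At v λ q → above p q))
      = u′ , eq , map-<⁻ (length v) u′ (subst₂ (λ k U → All (_< k) U)
          (trans n≡ (trans (+-comm (length u) (length v)) (cong (length v +_) (trans (cong length eq) (length-map (length v +_) u′)))))
          eq U<n)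

-- A letter before the maximum that is smaller than one after it would form a 132 with the maximum
-- as 3. So the two sides are separated by value, and each is a shorter permutation avoiding 132.
tree-complete : ∀ f w → length w ≤ f → Injective w → All (_< length w) w → count132 w ≡ 0 → ∃ λ t → word t ≡ w
tree-complete f [] _ _ _ _ = leaf , refl
tree-complete (suc f) (h ∷ w) len≤ inj w< none with i , p ← max-occurs refl inj w< with u , v , eq , _ ← At-split p =
  go u v eq (subst Injective eq inj) (cong length (sym eq)) (subst (All (_< suc (length w))) eq w<) (trans (cong count132 (sym eq)) none)
  where
  n = length w
  go : ∀ u v → h ∷ w ≡ u ++ n ∷ v → Injective (u ++ n ∷ v) → length (u ++ n ∷ v) ≡ suc n →
    All (_< suc n) (u ++ n ∷ v) → count132 (u ++ n ∷ v) ≡ 0 → ∃ λ t → word t ≡ h ∷ w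
  go u v eq inj len w< none = subtrees (proj₁ low) (proj₁ (proj₂ low)) (proj₂ (proj₂ low))
    where
    open Peak inj len w< using (n≡; inU; atPeak; inV; V<n; U<n)
    above : ∀ {i x j z} → At u i x → At v j z → z < x
    above {i} {x} {j} {z} p q with <-cmp z x
    ... | tri< z<x _ _    = z<x
    ... | tri≈ _ refl _   = ⊥-elim (<⇒≢ (≤-trans (At-< p) (m≤m+n (length u) (suc j))) (inj (inU p) (inV q)))
    ... | tri> _ _ x<z    = ⊥-elim (<⇒≢ (count132-positive
            (occurs (inU p) atPeak (inV q) (At-< p) (m<m+n (length u) (s≤s z≤n)) x<z (At-All V<n q))) (sym none))
    V<|v| = Peak.V<|v| inj len w< above
    low = Peak.lower inj len w< above
    none′ : ∀ {u′} → u ≡ map (length v +_) u′ → count132 u′ + count132 v ≡ 0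
    none′ {u′} eq = trans (sym (trans (count132-peak (subst (All (length v ≤_)) (sym eq) (map-≥ (length v) u′))
        (subst (length v ≤_) (sym n≡) (m≤n+m (length v) _)) U<n V<|v|)
      (cong (_+ count132 v) (trans (cong count132 eq) (count132-shift (length v) u′))))) none
    subtrees : ∀ u′ → u ≡ map (length v +_) u′ → All (_< length u′) u′ → ∃ λ t → word t ≡ h ∷ w
    subtrees u′ refl U<
      with l , refl ← tree-complete f u′ (≤-trans (≤-trans (≤-reflexive (sym (length-map _ u′))) (m≤m+n _ (length v)))
                        (≤-trans (≤-reflexive (sym n≡)) (≤-pred len≤)))
                      (Injective-map⁻ (length v) (Injective-++ˡ inj)) U< (m+n≡0⇒m≡0 _ (none′ refl))
         | r , refl ← tree-complete f v (≤-trans (m≤n+m (length v) _) (≤-trans (≤-reflexive (sym n≡)) (≤-pred len≤)))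
                      (λ p q → suc-injective (Injective-++ʳ (map (length v +_) u′) inj (there p) (there q)))
                      V<|v| (m+n≡0⇒n≡0 (count132 u′) (none′ refl))
      = node l r , trans (cong₂ (λ k N → map (k +_) (word l) ++ N ∷ word r) (sym (word-length r))
          (trans (cong₂ _+_ (sym (word-length r)) (sym (trans (length-map _ (word l)) (word-length l))))
            (trans (+-comm (length (word r)) _) (sym n≡)))) (sym eq)

positive-or-zero : ∀ n → n ≡ 0 ⊎ 1 ≤ n
positive-or-zero zero    = inj₁ refl
positive-or-zero (suc n) = inj₂ (s≤s z≤n)

-- The maximum is not fixed here, so the last position, whose number is `n`, holds the partner of
-- `n`, that is, the position `length u` of the maximum.
module TwoCycle (u v′ : List ℕ) (n : ℕ)
  (selfInverse : SelfInverse (u ++ n ∷ (v′ ++ length u ∷ [])))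
  (len : length (u ++ n ∷ (v′ ++ length u ∷ [])) ≡ suc n)
  (once : count132 (u ++ n ∷ (v′ ++ length u ∷ [])) ≡ 1) where

  m : ℕ
  m = length u

  v W : List ℕ
  v = v′ ++ m ∷ []
  W = u ++ n ∷ v

  injective : Injective W
  injective = SelfInverse⇒Injective selfInverse

  W< : All (_< suc n) W
  W< = subst (λ k → All (_< k) W) len (SelfInverse⇒bound selfInverse)

  open Peak injective len W< public

  n≡′ : n ≡ m + suc (length v′)
  n≡′ = trans n≡ (cong (m +_) (length-snoc v′ m))

  inV′ : ∀ {i x} → At v′ i x → At W (m + suc i) x
  inV′ p = inV (At-++ˡ p)

  atLast : At W n m
  atLast = selfInverse atPeak

  m<n : m < n
  m<n = subst (m <_) (sym n≡′) (m<m+n m (s≤s z≤n))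

  V′-not-last : ∀ {k x} → At v′ k x → m + suc k ≢ n
  V′-not-last p eq = <⇒≢ (At-< p) (suc-injective (+-cancelˡ-≡ m _ _ (trans eq n≡′)))

  -- Applied to a pair that `selfInverse` has turned round, this tells into which block of `W` a
  -- letter points.
  data Region : ℕ → ℕ → Set where
    upper : ∀ {i x} → At u i x → Region i x
    peak  : Region m n
    below : ∀ {k x} → At v′ k x → Region (m + suc k) x
    last  : Region n m

  region : ∀ {i x} → At W i x → Region i x
  region p with At-++⁻ u p
  ... | inj₁ q = upper q
  ... | inj₂ (_ , refl , here) = subst (λ i → Region i n) (sym (+-identityʳ m)) peak
  ... | inj₂ (_ , refl , there q) with At-++⁻ v′ q
  ...   | inj₁ r = below r
  ...   | inj₂ (_ , refl , here) = subst (λ i → Region i m) (trans n≡′ (cong (λ k → m + suc k) (sym (+-identityʳ _)))) last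

  -- The case that leads to a wrapping: the maximum is not the 3 of any 132.
  module Separated (above : ∀ {i x j z} → At u i x → At v j z → z < x) where

    b = length v

    b≡ : b ≡ suc (length v′)
    b≡ = length-snoc v′ m

    V<b : All (_< b) v
    V<b = V<|v| above

    m<b : m < b
    m<b = All.head (All.++⁻ʳ v′ V<b)

    module _ (u′ C D : List ℕ) (u≡ : u ≡ map (b +_) u′) (U′< : All (_< length u′) u′) (v′≡ : v′ ≡ C ++ D) (lenD : length D ≡ m) where

      c = length C

      inC : ∀ {i x} → At C i x → At v′ i x
      inC p = subst (λ l → At l _ _) (sym v′≡) (At-++ˡ p)

      inD : ∀ {i x} → At D i x → At v′ (c + i) x
      inD p = subst (λ l → At l _ _) (sym v′≡) (At-++ʳ C p)

      inU′ : ∀ {i x} → At u′ i x → At u i (b + x)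
      inU′ p = subst (λ l → At l _ _) (sym u≡) (At-map⁺ (b +_) p)

      fromU : ∀ {i x} → At u i x → ∃ λ y → x ≡ b + y × At u′ i y
      fromU p = At-map⁻ (b +_) u′ (subst (λ l → At l _ _) u≡ p)

      length-v′ : length v′ ≡ c + m
      length-v′ = trans (cong length v′≡) (trans (length-++ C) (cong (c +_) lenD))

      b≡c+m : b ≡ suc (c + m)
      b≡c+m = trans b≡ (cong suc length-v′)

      -- An occurrence at positions i, j, k with letters x, y, z is mirrored to the positions b + x,
      -- b + z, b + y. Uniqueness would give i = b + x, but i < m < b.
      u′-avoids : count132 u′ ≡ 0
      u′-avoids with positive-or-zero (count132 u′)
      ... | inj₁ eq = eq
      ... | inj₂ positive with i , j , k , occurs p q r i<j j<k x<z z<y ← count132-witness u′ positive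
          with eq , _ ← count132-unique (≤-reflexive once)
            (occurs (inU (inU′ p)) (inU (inU′ q)) (inU (inU′ r)) i<j j<k (+-monoʳ-< b x<z) (+-monoʳ-< b z<y))
            (occurs (selfInverse (inU (inU′ p))) (selfInverse (inU (inU′ r))) (selfInverse (inU (inU′ q)))
              (+-monoʳ-< b x<z) (+-monoʳ-< b z<y) i<j j<k)
          = ⊥-elim (<⇒≢ (<-≤-trans (<-trans (At-< (inU′ p)) m<b) (m≤m+n b _)) eq)

      -- In `W` this letter `x` stands at position `b + i`, so the letter at position `x` is
      -- `b + i`. It is too large for `v` and it is not `n`, hence it belongs to `u`.
      D-lower : ∀ {i x} → At D i x → At u′ x i
      D-lower {i} {x} p = go (region (selfInverse (inV′ (inD p)))) refl
        where
        go : ∀ {x′ y} → Region x′ y → y ≡ m + suc (c + i) → At u′ x′ i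
        go (upper q) eq with y , eq′ , r ← fromU q = At-cast refl (+-cancelˡ-≡ b _ _ (trans (sym eq′)
          (trans eq (trans (lem m c i) (cong (_+ i) (sym b≡c+m)))))) r
          where
          lem : ∀ m c i → m + suc (c + i) ≡ suc (c + m) + i
          lem = solve-∀
        go peak eq = ⊥-elim (V′-not-last (inD p) (sym eq))
        go (below q) eq = ⊥-elim (<⇒≱ (At-All V<b (At-++ˡ q)) (≤-trans (≤-reflexive b≡c+m)
          (≤-trans (m≤m+n (suc (c + m)) i) (≤-reflexive (trans (lem m c i) (sym eq))))))
          where
          lem : ∀ m c i → suc (c + m) + i ≡ m + suc (c + i)
          lem = solve-∀
        go last eq = ⊥-elim (m≢1+m+n m (trans eq (+-suc m (c + i))))

      -- A letter `x < m` would be a position in `u`, where all letters are at least `b`; but the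
      -- letter there is the position of `x` in `W`, and a position in the block `C` is below `b`.
      -- The letter `m` itself stands at the end of `W`.
      C≥ : ∀ {i x} → At C i x → suc m ≤ x
      C≥ {i} {x} p with <-cmp m x
      ... | tri< m<x _ _ = m<x
      ... | tri≈ _ refl _ = ⊥-elim (V′-not-last (inC p) (At-functional (selfInverse (inV′ (inC p))) atPeak))
      ... | tri> _ _ x<m with y , eq , _ ← fromU (at-At u x<m) =
        ⊥-elim (<⇒≱ (At-< p) (+-cancelˡ-≤ (suc m) c i (≤-trans (≤-reflexive (trans (cong suc (+-comm m c)) (sym b≡c+m)))
          (≤-trans (m≤m+n b y) (≤-reflexive (trans (sym eq)
            (trans (At-functional (inU (at-At u x<m)) (selfInverse (inV′ (inC p)))) (+-suc m i))))))))

      C-selfInverse : ∀ C′ → C ≡ map (suc m +_) C′ → SelfInverse C′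
      C-selfInverse C′ C≡ {i} {y} p = go (region (selfInverse (inV′ (inC inC′)))) refl refl
        where
        inC′ : At C i (suc m + y)
        inC′ = subst (λ l → At l _ _) (sym C≡) (At-map⁺ (suc m +_) p)
        go : ∀ {x′ y′} → Region x′ y′ → x′ ≡ suc m + y → y′ ≡ m + suc i → At C′ y i
        go (upper q) eq _ = ⊥-elim (<⇒≱ (At-< q) (≤-trans (n≤1+n m) (≤-trans (m≤m+n (suc m) y) (≤-reflexive (sym eq)))))
        go peak eq _ = ⊥-elim (m≢1+m+n m eq)
        go (below {k} q) eq eq′ with At-++⁻ C (subst (λ l → At l _ _) v′≡ q)
        ... | inj₁ r with z , eq″ , s ← At-map⁻ (suc m +_) C′ (subst (λ l → At l _ _) C≡ r) =
              At-cast (+-cancelˡ-≡ m _ _ (suc-injective (trans (sym (+-suc m k)) eq)))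
                (+-cancelˡ-≡ (suc m) _ _ (trans (sym eq″) (trans eq′ (+-suc m i)))) s
        ... | inj₂ (_ , _ , r) = ⊥-elim (<⇒≱ (At-< (inU′ (D-lower r))) (≤-trans (m≤m+n m (suc i)) (≤-reflexive (sym eq′))))
        go last _ eq′ = ⊥-elim (m≢1+m+n m (trans eq′ (+-suc m i)))

      unwrap : ∃ λ t → ∃ λ C′ → W ≡ wrapWord t C′ × SelfInverse C′ × count132 C′ ≡ 1
      unwrap with C′ , C≡ ← unshift (suc m) {C} (All-At C C≥)
        | t , t≡ ← tree-complete (length u′) u′ ≤-refl
            (Injective-map⁻ b (subst Injective u≡ (Injective-++ˡ injective))) U′< u′-avoids =
        t , C′ , W≡ , C-selfInverse C′ C≡ ,
        trans (sym (Wrap.count132-wrap t C′ (SelfInverse⇒bound (C-selfInverse C′ C≡)))) (trans (cong count132 (sym W≡)) once)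
        where
        m≡ : m ≡ sizeT t
        m≡ = trans (cong length u≡) (trans (length-map (b +_) u′) (trans (cong length (sym t≡)) (word-length t)))
        c≡ : c ≡ length C′
        c≡ = trans (cong length C≡) (length-map (suc m +_) C′)
        D≡ : D ≡ word⁻¹ t
        D≡ = At-ext D (word⁻¹ t) (trans lenD (trans m≡ (sym (word⁻¹-length t))))
          λ p → word-inverse t (subst (λ l → At l _ _) (sym t≡) (D-lower p))
        bottom : v ≡ map (suc (sizeT t) +_) C′ ++ (word⁻¹ t ++ sizeT t ∷ [])
        bottom = trans (cong (_++ m ∷ []) v′≡) (trans (++-assoc C D (m ∷ []))
          (cong₂ _++_ (trans C≡ (cong (λ k → map (suc k +_) C′) m≡)) (cong₂ (λ l k → l ++ k ∷ []) D≡ m≡)))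
        b≡′ : b ≡ suc (sizeT t + length C′)
        b≡′ = trans b≡c+m (cong suc (trans (+-comm c m) (cong₂ _+_ m≡ c≡)))
        W≡ : W ≡ wrapWord t C′
        W≡ = trans (cong₂ (λ U N → U ++ N ∷ v) (trans u≡ (cong₂ (λ k l → map (k +_) l) b≡′ (sym t≡)))
            (trans n≡ (trans (+-comm m b) (cong₂ _+_ b≡′ m≡))))
          (cong (λ V → map (suc (sizeT t + length C′) +_) (word t) ++ (suc (sizeT t + length C′) + sizeT t) ∷ V) bottom)

    unwrapped : ∃ λ t → ∃ λ C′ → W ≡ wrapWord t C′ × SelfInverse C′ × count132 C′ ≡ 1
    unwrapped with u′ , u≡ , U′< ← Peak.lower injective len W< above =
      unwrap u′ (take k v′) (drop k v′) u≡ U′< (sym (take++drop≡id k v′))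
        (trans (length-drop k v′) (m∸[m∸n]≡n (≤-pred (subst (m <_) b≡ m<b))))
      where k = length v′ ∸ m

  -- The case that leads to a core: `x`, the maximum and `z` form the single 132.
  module Crossing {a x k z} (p : At u a x) (q : At v k z) (x<z : x < z) where

    crossing : Occurs132 W a m (m + suc k)
    crossing = occurs (inU p) atPeak (inV q) (At-< p) (m<m+n m (s≤s z≤n)) x<z (At-All V<n q)

    the-crossing : ∀ {a′ b′ c′} → Occurs132 W a′ b′ c′ → a ≡ a′ × m ≡ b′ × m + suc k ≡ c′
    the-crossing = count132-unique (≤-reflexive once) crossing

    -- The mirror image of the crossing stands at the positions `x`, `z`, `n`. Uniqueness makes it
    -- the crossing itself, so its 1 is a fixed point and its 2 is the last letter.
    reflected : a ≡ x × m ≡ z × m + suc k ≡ n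
    reflected = the-crossing (occurs (selfInverse (inU p)) (selfInverse (inV q)) atLast
      x<z (At-All V<n q) (At-< p) (m<m+n m (s≤s z≤n)))

    a-fixed : At u a a
    a-fixed = At-cast refl (sym (proj₁ reflected)) p

    ends-at-n : m + suc k ≡ n
    ends-at-n = proj₂ (proj₂ reflected)

    -- Otherwise the two letters would form with the maximum a second 132, one that ends before the
    -- last position.
    below-U : ∀ {i s j r} → At u i s → At v′ j r → r < s
    below-U {i} {s} {j} {r} α β with <-cmp r s
    ... | tri< r<s _ _  = r<s
    ... | tri≈ _ refl _ = ⊥-elim (<⇒≢ (<-≤-trans (At-< α) (m≤m+n m (suc j))) (injective (inU α) (inV′ β)))
    ... | tri> _ _ s<r  = ⊥-elim (V′-not-last β (trans (sym (proj₂ (proj₂ (the-crossing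
            (occurs (inU α) atPeak (inV′ β) (At-< α) (m<m+n m (s≤s z≤n)) s<r (At-All V<n (At-++ˡ β))))))) ends-at-n))

    -- A letter below `m` would form a 132 with the maximum and the final `m`, and the only such
    -- occurrence begins at `a`.
    above-m : ∀ {i s} → At u i s → a ≢ i → suc m ≤ s
    above-m {i} {s} α i≢a with <-cmp m s
    ... | tri< m<s _ _  = m<s
    ... | tri≈ _ refl _ = ⊥-elim (<⇒≢ (<-trans (At-< α) m<n) (injective (inU α) atLast))
    ... | tri> _ _ s<m  = ⊥-elim (i≢a (proj₁ (the-crossing (occurs (inU α) atPeak atLast (At-< α) m<n s<m m<n))))

    -- Were `suc a` still a position in `u`, its letter would exceed `m` and so be a position after
    -- the maximum that holds `suc a`. But the letters of `v′` are below the fixed letter `a`, and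
    -- the last letter is `m`.
    m≡1+a : m ≡ suc a
    m≡1+a with m ≟ suc a
    ... | yes eq = eq
    ... | no m≢ = ⊥-elim (go (region (selfInverse (inU α))) refl refl)
      where
      1+a<m : suc a < m
      1+a<m = ≤∧≢⇒< (At-< p) (m≢ ∘ sym)
      α : At u (suc a) (at u (suc a))
      α = at-At u 1+a<m
      m<s : m < at u (suc a)
      m<s = above-m α (<⇒≢ ≤-refl)
      go : ∀ {s y} → Region s y → s ≡ at u (suc a) → y ≢ suc a
      go (upper β) eq _ = <⇒≱ (At-< β) (≤-trans (<⇒≤ m<s) (≤-reflexive (sym eq)))
      go peak eq _ = <⇒≢ m<s eq
      go (below β) eq refl = <⇒≱ (below-U a-fixed β) (n≤1+n a)
      go last _ eq = m≢ eq

    module _ (u₀ : List ℕ) (a′ : ℕ) (u≡ : u ≡ u₀ ++ a′ ∷ []) where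

      len-u₀ : length u₀ ≡ a
      len-u₀ = suc-injective (trans (sym (length-snoc u₀ a′)) (trans (sym (cong length u≡)) m≡1+a))

      inU₀ : ∀ {i s} → At u₀ i s → At u i s
      inU₀ α = subst (λ l → At l _ _) (sym u≡) (At-++ˡ α)

      a′≡a : a′ ≡ a
      a′≡a = At-functional (subst₂ (λ l i → At l i a′) (sym u≡) (trans (+-identityʳ _) len-u₀) (At-++ʳ u₀ here)) a-fixed

      U₀≥ : All (suc m ≤_) u₀
      U₀≥ = All-At u₀ λ α → above-m (inU₀ α) λ { refl → <-irrefl (sym len-u₀) (At-< α) }

      U₀< : All (_< suc m + length v′) u₀
      U₀< = All-At u₀ λ α → subst (_ <_) (trans n≡′ (+-suc m _)) (At-All U<n (inU₀ α))

      V′< : All (_< a) v′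
      V′< = All-At v′ (below-U a-fixed)

      injective-u₀ : Injective u₀
      injective-u₀ α β = injective (inU (inU₀ α)) (inU (inU₀ β))

      injective-v′ : Injective v′
      injective-v′ α β = suc-injective (+-cancelˡ-≡ m _ _ (injective (inV′ α) (inV′ β)))

      -- Two opposite pigeonhole bounds: the letters of `v′` are below `a`, and the `a` letters of
      -- `u₀` fit into an interval of length `length v′`.
      len-v′ : length v′ ≡ a
      len-v′ = ≤-antisym (pigeonhole 0 a injective-v′ (All.universal (λ _ → z≤n) v′) V′<)
        (subst (_≤ length v′) len-u₀ (pigeonhole (suc m) (length v′) injective-u₀ U₀≥ U₀<))

      decore : ∃ λ t → W ≡ wordI (core t)
      decore with u′ , u₀≡ ← unshift (suc m) {u₀} U₀≥ = result u′ u₀≡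
        where
        result : ∀ u′ → u₀ ≡ map (suc m +_) u′ → ∃ λ t → W ≡ wordI (core t)
        result u′ u₀≡ = proj₁ tree , W≡
          where
          inU′ : ∀ {i s} → At u′ i s → At u₀ i (suc m + s)
          inU′ α = subst (λ l → At l _ _) (sym u₀≡) (At-map⁺ (suc m +_) α)
          len-u′ : length u′ ≡ a
          len-u′ = trans (sym (trans (cong length u₀≡) (length-map (suc m +_) u′))) len-u₀
          -- The single 132 has its 3 at position `m`, which lies after `u₀`.
          u′-avoids : count132 u′ ≡ 0
          u′-avoids with positive-or-zero (count132 u′)
          ... | inj₁ eq = eq
          ... | inj₂ positive with i , j , l , occurs α β γ i<j j<l s<r r<y ← count132-witness u′ positive
              = ⊥-elim (<⇒≢ (At-< (inU₀ (inU′ β))) (sym (proj₁ (proj₂ (the-crossing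
                  (occurs (inU (inU₀ (inU′ α))) (inU (inU₀ (inU′ β))) (inU (inU₀ (inU′ γ))) i<j j<l
                    (+-monoʳ-< (suc m) s<r) (+-monoʳ-< (suc m) r<y)))))))
          U′< : All (_< length u′) u′
          U′< = map-<⁻ (suc m) u′ (subst₂ (λ l k → All (_< suc m + k) l) u₀≡ (trans len-v′ (sym len-u′)) U₀<)
          tree : ∃ λ t → word t ≡ u′
          tree = tree-complete (length u′) u′ ≤-refl (Injective-map⁻ (suc m) (subst Injective u₀≡ injective-u₀)) U′< u′-avoids
          t = proj₁ tree
          size-t : sizeT t ≡ a
          size-t = trans (sym (word-length t)) (trans (cong length (proj₂ tree)) len-u′)
          V′-inverse : ∀ {i s} → At v′ i s → At (word⁻¹ t) i s
          V′-inverse {i} {s} α = word-inverse t (subst (λ l → At l s i) (sym (proj₂ tree)) (go (region (selfInverse (inV′ α))) refl refl))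
            where
            s<a : s < a
            s<a = At-All V′< α
            s<m : s < m
            s<m = <-trans s<a (At-< p)
            go : ∀ {s′ y} → Region s′ y → s′ ≡ s → y ≡ m + suc i → At u′ s i
            go (upper β) refl eq with At-++⁻ u₀ (subst (λ l → At l _ _) u≡ β)
            ... | inj₁ γ with y , eq′ , δ ← At-map⁻ (suc m +_) u′ (subst (λ l → At l _ _) u₀≡ γ) =
                  At-cast refl (+-cancelˡ-≡ (suc m) _ _ (trans (sym eq′) (trans eq (+-suc m i)))) δ
            ... | inj₂ (_ , refl , _) = ⊥-elim (<⇒≱ s<a (≤-trans (≤-reflexive (sym len-u₀)) (m≤m+n _ _)))
            go peak refl _ = ⊥-elim (<-irrefl refl s<m)
            go (below {j} _) refl _ = ⊥-elim (<⇒≱ s<m (m≤m+n m (suc j)))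
            go last refl _ = ⊥-elim (<⇒≱ s<m (<⇒≤ m<n))
          v′≡ : v′ ≡ word⁻¹ t
          v′≡ = At-ext v′ (word⁻¹ t) (trans len-v′ (sym (trans (word⁻¹-length t) size-t))) V′-inverse
          m≡ : m ≡ suc (sizeT t)
          m≡ = trans m≡1+a (cong suc (sym size-t))
          n≡″ : n ≡ 2 + sizeT t + sizeT t
          n≡″ = trans n≡′ (trans (cong₂ (λ k l → k + suc l) m≡ (trans len-v′ (sym size-t))) (+-suc (suc (sizeT t)) (sizeT t)))
          W≡ : W ≡ wordI (core t)
          W≡ = begin
            u ++ n ∷ v
              ≡⟨ cong (_++ n ∷ v) u≡ ⟩
            (u₀ ++ a′ ∷ []) ++ n ∷ v
              ≡⟨ ++-assoc u₀ (a′ ∷ []) (n ∷ v) ⟩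
            u₀ ++ a′ ∷ n ∷ v
              ≡⟨ cong₂ (λ l k → l ++ k ∷ n ∷ v) (trans u₀≡ (cong₂ (λ k l → map (suc k +_) l) m≡ (sym (proj₂ tree)))) (trans a′≡a (sym size-t)) ⟩
            map (2 + sizeT t +_) (word t) ++ sizeT t ∷ n ∷ v
              ≡⟨ cong₂ (λ k l → map (2 + sizeT t +_) (word t) ++ sizeT t ∷ k ∷ l) n≡″ (cong₂ (λ l k → l ++ k ∷ []) v′≡ m≡) ⟩
            wordI (core t) ∎
            where open ≡-Reasoning

    decored : ∃ λ t → W ≡ wordI (core t)
    decored = go u refl
      where
      go : ∀ l → u ≡ l → ∃ λ t → W ≡ wordI (core t)
      go l eq with initLast l
      go .[] eq | [] = ⊥-elim (<⇒≱ (At-< p) (≤-trans (≤-reflexive (cong length eq)) z≤n))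
      go .(u₀ ++ a′ ∷ []) eq | u₀ ∷ʳ′ a′ = decore u₀ a′ eq

  peeled : (∃ λ t → ∃ λ C → W ≡ wrapWord t C × SelfInverse C × count132 C ≡ 1) ⊎ ∃ λ t → W ≡ wordI (core t)
  peeled with All.all? (λ x → All.all? (_<? x) v) u
  ... | yes above = inj₁ (Separated.unwrapped λ p q → At-All (At-All above p) q)
  ... | no ¬above with x , x∈ , ¬all ← find (All.¬All⇒Any¬ (λ x → All.all? (_<? x) v) u ¬above)
      with z , z∈ , z≮x ← find (All.¬All⇒Any¬ (_<? x) v ¬all)
      with i , p ← ∈⇒At x∈ | j , q ← ∈⇒At z∈
      = inj₂ (Crossing.decored p q (≤∧≢⇒< (≮⇒≥ z≮x)
          λ { refl → <⇒≢ (<-≤-trans (At-< p) (m≤m+n m (suc j))) (injective (inU p) (inV q)) }))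

snoc-selfInverse⁻ : ∀ {u n} → n ≡ length u → SelfInverse (u ++ n ∷ []) → SelfInverse u
snoc-selfInverse⁻ {u} refl inv p with At-++⁻ u (inv (At-++ˡ p))
... | inj₁ q = q
... | inj₂ (_ , refl , here) = ⊥-elim (<⇒≢ (At-< p)
        (At-functional (inv (At-++ˡ p)) (At-cast refl refl (At-++ʳ u here))))

involution-complete : ∀ f w → length w ≤ f → SelfInverse w → count132 w ≡ 1 → ∃ λ o → wordI o ≡ w
involution-complete (suc f) (h ∷ w) len≤ inv once
  -- The letter at the last position is the position of the maximum, so `inv` locates the maximum
  -- and the word is cut there.
  with u , v , eq , lenu ← At-split (inv (at-At (h ∷ w) {length w} ≤-refl)) =
  go u v eq (subst SelfInverse eq inv) (cong length (sym eq)) (trans (cong count132 (sym eq)) once)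
    (subst₂ (λ l j → At l (length w) j) eq (sym lenu) (at-At (h ∷ w) {length w} ≤-refl))
  where
  n = length w
  go : ∀ u v → h ∷ w ≡ u ++ n ∷ v → SelfInverse (u ++ n ∷ v) → length (u ++ n ∷ v) ≡ suc n →
    count132 (u ++ n ∷ v) ≡ 1 → At (u ++ n ∷ v) n (length u) → ∃ λ o → wordI o ≡ h ∷ w
  go u v eq inv len once p with initLast v
  go u .[] eq inv len once p | []
    with n≡ ← suc-injective (trans (sym len) (length-snoc u n))
    with o , refl ← involution-complete f u (≤-trans (≤-reflexive (sym n≡)) (≤-pred len≤)) (snoc-selfInverse⁻ n≡ inv)
           (trans (sym (count132-snoc (subst (λ k → All (_< k) u) (sym n≡) (SelfInverse⇒bound (snoc-selfInverse⁻ n≡ inv))))) once)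
    = fix o , trans (cong (λ k → wordI o ++ k ∷ []) (trans (sym (wordI-length o)) (sym n≡))) (sym eq)
  go u .(v′ ++ j ∷ []) eq inv len once p | v′ ∷ʳ′ j = two-cycle last-value eq inv len once
    where
    last-value : j ≡ length u
    last-value = At-functional (At-cast (suc-injective (trans (lem (length u) (length v′))
        (trans (sym (trans (length-++ u) (cong (λ k → length u + suc k) (length-snoc v′ j)))) len))) refl
      (At-++ʳ u (there (At-++ʳ v′ here)))) p
      where
      lem : ∀ a b → suc (a + suc (b + 0)) ≡ a + suc (suc b)
      lem = solve-∀
    smaller : ∀ t C → h ∷ w ≡ wrapWord t C → suc (length C) ≤ suc (length w)
    smaller t C eq = ≤-trans (s≤s (≤-trans (≤-reflexive (sym (length-map (suc (sizeT t) +_) C)))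
        (≤-trans (m≤m+n _ _) (≤-reflexive (sym (length-++ (map (suc (sizeT t) +_) C)))))))
      (≤-trans (m≤n+m _ (length (map (suc (sizeT t + length C) +_) (word t))))
        (≤-reflexive (trans (sym (length-++ (map (suc (sizeT t + length C) +_) (word t)))) (cong length (sym eq)))))
    two-cycle : j ≡ length u → h ∷ w ≡ u ++ n ∷ (v′ ++ j ∷ []) → SelfInverse (u ++ n ∷ (v′ ++ j ∷ [])) →
      length (u ++ n ∷ (v′ ++ j ∷ [])) ≡ suc n → count132 (u ++ n ∷ (v′ ++ j ∷ [])) ≡ 1 → ∃ λ o → wordI o ≡ h ∷ w
    two-cycle refl eq inv len once with TwoCycle.peeled u v′ n inv len once
    ... | inj₂ (t , eq′) = core t , trans (sym eq′) (sym eq)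
    ... | inj₁ (t , C , eq′ , invC , onceC)
        with o , refl ← involution-complete f C (≤-pred (≤-trans (smaller t C (trans eq eq′)) len≤)) invC onceC
        = wrap t o , trans (wordI-wrap t o) (trans (sym eq′) (sym eq))

-- Counting words

∈-words⁻ : ∀ n m {w} → w ∈ words n m → length w ≡ m × All (_< n) w
∈-words⁻ n zero (here refl) = refl , []
∈-words⁻ n (suc m) p
  with w , w∈ , q ← find (∈-concatMap⁻ (λ w → map (_∷ w) (upTo n)) {xs = words n m} p)
  with x , x∈ , refl ← ∈-map⁻ (_∷ w) q
  with eq , w< ← ∈-words⁻ n m w∈ = cong suc eq , ∈-upTo⁻ x∈ ∷ w<

∈-words⁺ : ∀ n {w} → All (_< n) w → w ∈ words n (length w)
∈-words⁺ n [] = here refl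
∈-words⁺ n (x< ∷ w<) = ∈-concatMap⁺ (λ w → map (_∷ w) (upTo n)) (lose (∈-words⁺ n w<) (∈-map⁺ _ (∈-upTo⁺ x<)))

words-unique : ∀ n m → Unique (words n m)
words-unique n zero = [] ∷ []
words-unique n (suc m) = concatMap-unique (λ w → map (_∷ w) (upTo n)) (words-unique n m)
  (λ w → Unique.map⁺ (λ { refl → refl }) (Unique.upTo⁺ n)) same-tail
  where
  same-tail : ∀ {w w′ v} → v ∈ map (_∷ w) (upTo n) → v ∈ map (_∷ w′) (upTo n) → w ≡ w′
  same-tail {w} {w′} p q with _ , _ , refl ← ∈-map⁻ (_∷ w) p with _ , _ , refl ← ∈-map⁻ (_∷ w′) q = refl

notElem-intro : ∀ x ys → (∀ {i} → ¬ At ys i x) → T (notElem x ys)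
notElem-intro x [] f = _
notElem-intro x (y ∷ ys) f with x ≡ᵇ y in eq
... | true  = f (subst (At (y ∷ ys) 0) (sym (≡ᵇ⇒≡ x y (subst T (sym eq) _))) here)
... | false = notElem-intro x ys (f ∘ there)

distinct-intro : ∀ w → Injective w → T (distinct w)
distinct-intro [] inj = _
distinct-intro (x ∷ w) inj = T-∧⁺ {notElem x w} (notElem-intro x w λ p → 0≢1+n (inj here (there p)))
  (distinct-intro w λ p q → suc-injective (inj (there p) (there q)))

isInvolution⁺ : ∀ w → SelfInverse w → T (isInvolution w)
isInvolution⁺ w inv = and⁺ _ λ x∈ → check (∈-map⁻ _ x∈)
  where
  check : ∀ {b} → (∃ λ i → i ∈ upTo (length w) × b ≡ (at w (at w i) ≡ᵇ i)) → T b
  check (i , i∈ , refl) = ≡⇒≡ᵇ _ _ (At-at (inv (at-At w (∈-upTo⁻ i∈))))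

isInvolution⁻ : ∀ w → All (_< length w) w → T (isInvolution w) → SelfInverse w
isInvolution⁻ w w< t {i} {x} p = subst (At w x) at-x (at-At w (At-All w< p))
  where
  at-x : at w x ≡ i
  at-x = trans (cong (at w) (sym (At-at p)))
    (≡ᵇ⇒≡ _ _ (and⁻ t (∈-map⁺ (λ i → at w (at w i) ≡ᵇ i) (∈-upTo⁺ (At-< p)))))

-- Distinct shapes have distinct words

peak-cancel : ∀ {N u u′ v v′} → All (_< N) u → All (_< N) u′ → u ++ N ∷ v ≡ u′ ++ N ∷ v′ → u ≡ u′ × v ≡ v′
peak-cancel [] [] refl = refl , refl
peak-cancel [] (N<N ∷ _) refl = ⊥-elim (<-irrefl refl N<N)
peak-cancel (N<N ∷ _) [] refl = ⊥-elim (<-irrefl refl N<N)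
peak-cancel {u = x ∷ u} {x′ ∷ u′} (_ ∷ u<) (_ ∷ u′<) eq with refl , eq′ ← ∷-injective eq
  with refl , refl ← peak-cancel u< u′< eq′ = refl , refl

shift-injective : ∀ c {u v} → map (c +_) u ≡ map (c +_) v → u ≡ v
shift-injective c = map-injective (+-cancelˡ-≡ c _ _)

word-injective : ∀ s t → word s ≡ word t → s ≡ t
word-injective leaf leaf eq = refl
word-injective leaf (node l r) eq with () ← trans (cong length eq) (word-length (node l r))
word-injective (node l r) leaf eq with () ← trans (sym (word-length (node l r))) (cong length eq)
word-injective (node l r) (node l′ r′) eq = go N≡ eq
  where
  N≡ : sizeT r + sizeT l ≡ sizeT r′ + sizeT l′
  N≡ = trans (+-comm (sizeT r) _) (trans (suc-injective (trans (sym (word-length (node l r)))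
    (trans (cong length eq) (word-length (node l′ r′))))) (+-comm (sizeT l′) _))
  go : ∀ {N} → sizeT r + sizeT l ≡ N → map (sizeT r +_) (word l) ++ (sizeT r + sizeT l) ∷ word r ≡
       map (sizeT r′ +_) (word l′) ++ (sizeT r′ + sizeT l′) ∷ word r′ → node l r ≡ node l′ r′
  go _ eq with equ , eqv ← peak-cancel {sizeT r + sizeT l} (map-< (sizeT r) (word-bound l))
                 (subst (λ N → All (_< N) (map (sizeT r′ +_) (word l′))) (sym N≡) (map-< (sizeT r′) (word-bound l′)))
                 (trans eq (cong (λ N → map (sizeT r′ +_) (word l′) ++ N ∷ word r′) (sym N≡)))
    with refl ← word-injective r r′ eqv = cong (λ l → node l r) (word-injective l l′ (shift-injective (sizeT r) equ))

top upperPart lowerPart : Involution → _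
top (core t)   = 2 + sizeT t + sizeT t
top (fix o)    = sizeI o
top (wrap t o) = suc (sizeT t + sizeI o) + sizeT t
upperPart (core t)   = map (2 + sizeT t +_) (word t) ++ sizeT t ∷ []
upperPart (fix o)    = wordI o
upperPart (wrap t o) = map (suc (sizeT t + sizeI o) +_) (word t)
lowerPart (core t)   = word⁻¹ t ++ suc (sizeT t) ∷ []
lowerPart (fix o)    = []
lowerPart (wrap t o) = map (suc (sizeT t) +_) (wordI o) ++ (word⁻¹ t ++ sizeT t ∷ [])

wordI-parts : ∀ o → wordI o ≡ upperPart o ++ top o ∷ lowerPart o
wordI-parts (core t)   = sym (++-assoc (map (2 + sizeT t +_) (word t)) _ _)
wordI-parts (fix o)    = refl
wordI-parts (wrap t o) = refl

top-size : ∀ o → suc (top o) ≡ sizeI o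
top-size (core t)   = refl
top-size (fix o)    = refl
top-size (wrap t o) = lem (sizeT t) (sizeI o)
  where
  lem : ∀ m c → suc (suc (m + c) + m) ≡ 2 + (m + m) + c
  lem = solve-∀

upperPart-bound : ∀ o → All (_< top o) (upperPart o)
upperPart-bound (core t) = All.++⁺ (map-< (2 + sizeT t) (word-bound t)) (s≤s (≤-trans (m≤m+n _ _) (n≤1+n _)) ∷ [])
upperPart-bound (fix o) = wordI-bound o
upperPart-bound (wrap t o) = map-< (suc (sizeT t + sizeI o)) (word-bound t)

-- Words of equal length have the same maximum, and it occurs only once, so both are cut at the same
-- place.
parts-injective : ∀ o o′ → wordI o ≡ wordI o′ → upperPart o ≡ upperPart o′ × lowerPart o ≡ lowerPart o′
parts-injective o o′ eq = peak-cancel (upperPart-bound o)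
  (subst (λ N → All (_< N) (upperPart o′)) (sym top≡) (upperPart-bound o′))
  (trans (sym (wordI-parts o)) (trans eq (trans (wordI-parts o′) (cong (λ N → upperPart o′ ++ N ∷ lowerPart o′) (sym top≡)))))
  where
  top≡ : top o ≡ top o′
  top≡ = suc-injective (trans (top-size o) (trans (sym (wordI-length o))
    (trans (cong length eq) (trans (wordI-length o′) (sym (top-size o′))))))

snoc≢[] : ∀ (u : List ℕ) {x} → u ++ x ∷ [] ≢ []
snoc≢[] [] ()
snoc≢[] (_ ∷ _) ()

lowerPart-wrap≢[] : ∀ t o → lowerPart (wrap t o) ≢ []
lowerPart-wrap≢[] t o eq = snoc≢[] (map (suc (sizeT t) +_) (wordI o) ++ word⁻¹ t)
  (trans (++-assoc (map (suc (sizeT t) +_) (wordI o)) (word⁻¹ t) _) eq)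

-- Before the maximum, a core ends in a letter smaller than the number of letters there, whereas in
-- a wrapping all these letters exceed their number.
upperPart-core≢wrap : ∀ t t′ o → upperPart (core t) ≢ upperPart (wrap t′ o)
upperPart-core≢wrap t t′ o eq = <⇒≱ (≤-refl {suc (sizeT t)})
  (≤-trans (≤-reflexive size≡) (≤-trans (≤-trans (m≤m+n _ (sizeI o)) (n≤1+n _))
    (All.head (All.++⁻ʳ (map (2 + sizeT t +_) (word t)) (subst (All (suc (sizeT t′ + sizeI o) ≤_)) (sym eq) (map-≥ _ (word t′)))))))
  where
  size≡ : suc (sizeT t) ≡ sizeT t′
  size≡ = trans (sym (trans (length-snoc (map (2 + sizeT t +_) (word t)) (sizeT t)) (cong suc (trans (length-map _ (word t)) (word-length t)))))
    (trans (cong length eq) (trans (length-map _ (word t′)) (word-length t′)))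

wordI-injective : ∀ o o′ → wordI o ≡ wordI o′ → o ≡ o′
wordI-injective o o′ eq = go o o′ eq (parts-injective o o′ eq)
  where
  go : ∀ o o′ → wordI o ≡ wordI o′ → upperPart o ≡ upperPart o′ × lowerPart o ≡ lowerPart o′ → o ≡ o′
  go (core t) (core t′) _ (equ , _) with eqm , eq ← ∷ʳ-injective (map (2 + sizeT t +_) (word t)) _ equ =
    cong core (word-injective t t′ (shift-injective (2 + sizeT t) (trans eqm (cong (λ k → map (2 + k +_) (word t′)) (sym eq)))))
  go (core t) (fix o′) _ (_ , eqv) = ⊥-elim (snoc≢[] (word⁻¹ t) eqv)
  go (core t) (wrap t′ o′) _ (equ , _) = ⊥-elim (upperPart-core≢wrap t t′ o′ equ)
  go (fix o) (core t′) _ (_ , eqv) = ⊥-elim (snoc≢[] (word⁻¹ t′) (sym eqv))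
  go (fix o) (fix o′) _ (equ , _) = cong fix (wordI-injective o o′ equ)
  go (fix o) (wrap t′ o′) _ (_ , eqv) = ⊥-elim (lowerPart-wrap≢[] t′ o′ (sym eqv))
  go (wrap t o) (core t′) _ (equ , _) = ⊥-elim (upperPart-core≢wrap t′ t o (sym equ))
  go (wrap t o) (fix o′) _ (_ , eqv) = ⊥-elim (lowerPart-wrap≢[] t o eqv)
  go (wrap t o) (wrap t′ o′) eq (equ , eqv) = result same-tree
    where
    size≡ : sizeT t ≡ sizeT t′
    size≡ = trans (sym (trans (length-map _ (word t)) (word-length t)))
      (trans (cong length equ) (trans (length-map _ (word t′)) (word-length t′)))
    size≡′ : sizeI o ≡ sizeI o′
    size≡′ = +-cancelˡ-≡ (2 + (sizeT t + sizeT t)) _ _ (trans (sym (wordI-length (wrap t o))) (trans (cong length eq)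
      (trans (wordI-length (wrap t′ o′)) (cong (λ m → 2 + (m + m) + sizeI o′) (sym size≡)))))
    same-tree : t ≡ t′
    same-tree = word-injective t t′ (shift-injective (suc (sizeT t + sizeI o)) (trans equ
      (cong₂ (λ m c → map (suc (m + c) +_) (word t′)) (sym size≡) (sym size≡′))))
    result : t ≡ t′ → wrap t o ≡ wrap t′ o′
    result refl = cong (wrap t) (wordI-injective o o′ (shift-injective (suc (sizeT t))
      (++-cancelʳ (word⁻¹ t ++ sizeT t ∷ []) _ _ eqv)))

-- Lists that realise the even part, the substitution of x² and the multiplication by a power of x

module _ {A : Set} where

  evens spread : (ℕ → List A) → ℕ → List A
  evens L n = if isEvenℕ n then L n else []
  spread L zero          = L 0
  spread L (suc zero)    = []
  spread L (suc (suc n)) = spread (L ∘ suc) n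

  shift : ℕ → (ℕ → List A) → ℕ → List A
  shift zero    L n       = L n
  shift (suc p) L zero    = []
  shift (suc p) L (suc n) = shift p L n

  counting-evens : ∀ L → counting (evens L) ≈ evenPart (counting L)
  counting-evens L = pointwise go
    where
    go : ∀ n → counting (evens L) n ≡ evenPart (counting L) n
    go n with isEvenℕ n
    ... | true  = refl
    ... | false = refl

  counting-spread : ∀ L → counting (spread L) ≈ sq (counting L)
  counting-spread L = pointwise (go L)
    where
    go : ∀ L n → counting (spread L) n ≡ sq (counting L) n
    go L zero          = refl
    go L (suc zero)    = refl
    go L (suc (suc n)) = go (L ∘ suc) n

  counting-shift : ∀ p L → counting (shift p L) ≈ (X^ p ⊛ counting L)
  counting-shift zero L = S.sym (S.trans (⊛-congʳ (counting L) X^-zero) (⊛-identityˡ (counting L)))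
  counting-shift (suc p) L = begin
    counting (shift (suc p) L)          ≈⟨ pointwise (λ { zero → refl ; (suc n) → sym (X^1-⊛-suc (counting (shift p L)) n) }) ⟩
    X^ 1 ⊛ counting (shift p L)         ≈⟨ ⊛-congˡ (X^ 1) (counting-shift p L) ⟩
    X^ 1 ⊛ (X^ p ⊛ counting L)          ≈⟨ ⊛-assoc (X^ 1) (X^ p) (counting L) ⟨
    X^ 1 ⊛ X^ p ⊛ counting L            ≈⟨ ⊛-congʳ (counting L) (X^-suc p) ⟨
    X^ (suc p) ⊛ counting L             ∎
    where open ≈-Reasoning

  ∈-evens⁻ : ∀ L n {x} → x ∈ evens L n → T (isEvenℕ n) × x ∈ L n
  ∈-evens⁻ L n p with isEvenℕ n
  ... | true = _ , p

  ∈-evens⁺ : ∀ L n {x} → T (isEvenℕ n) → x ∈ L n → x ∈ evens L n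
  ∈-evens⁺ L n t p with isEvenℕ n
  ... | true = p

  ∈-spread⁻ : ∀ L n {x} → x ∈ spread L n → ∃ λ c → n ≡ c + c × x ∈ L c
  ∈-spread⁻ L zero p = 0 , refl , p
  ∈-spread⁻ L (suc (suc n)) p with c , refl , q ← ∈-spread⁻ (L ∘ suc) n p = suc c , cong suc (sym (+-suc c c)) , q

  ∈-spread⁺ : ∀ L c {x} → x ∈ L c → x ∈ spread L (c + c)
  ∈-spread⁺ L zero p = p
  ∈-spread⁺ L (suc c) p rewrite +-suc c c = ∈-spread⁺ (L ∘ suc) c p

  ∈-shift⁻ : ∀ p L n {x} → x ∈ shift p L n → ∃ λ d → n ≡ p + d × x ∈ L d
  ∈-shift⁻ zero L n q = n , refl , q
  ∈-shift⁻ (suc p) L (suc n) q with d , refl , r ← ∈-shift⁻ p L n q = d , refl , r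

  ∈-shift⁺ : ∀ p L d {x} → x ∈ L d → x ∈ shift p L (p + d)
  ∈-shift⁺ zero L d q = q
  ∈-shift⁺ (suc p) L d q = ∈-shift⁺ p L d q

  evens-unique : ∀ {L} → (∀ n → Unique (L n)) → ∀ n → Unique (evens L n)
  evens-unique L! n with isEvenℕ n
  ... | true  = L! n
  ... | false = []

  spread-unique : ∀ {L} → (∀ n → Unique (L n)) → ∀ n → Unique (spread L n)
  spread-unique L! zero          = L! 0
  spread-unique L! (suc zero)    = []
  spread-unique L! (suc (suc n)) = spread-unique (L! ∘ suc) n

  shift-unique : ∀ p {L} → (∀ n → Unique (L n)) → ∀ n → Unique (shift p L n)
  shift-unique zero    L! n       = L! n
  shift-unique (suc p) L! zero    = []
  shift-unique (suc p) L! (suc n) = shift-unique p L! n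

unique-length : ∀ {A : Set} {xs ys : List A} → Unique xs → Unique ys →
  (∀ {x} → x ∈ xs → x ∈ ys) → (∀ {x} → x ∈ ys → x ∈ xs) → length xs ≡ length ys
unique-length xs! ys! f g = ↭-length (∼bag⇒↭ (unique∧set⇒bag xs! ys! (mk⇔ f g)))

-- Comparison with the definition of the count

counted : List ℕ → ℕ → List ℕ → Bool
counted τ r π = isInvolution π ∧ isEvenℕ (inversions π) ∧ (occurrences p132 π ≡ᵇ 1) ∧ (occurrences τ π ≡ᵇ r)

-- An involution with `c` 2-cycles has size `2 + m + (c + c)`, and it is even exactly if `c` is. The
-- three operations correspond to `X^ (2 + m)`, `sq` and `evenPart`.
shapes : ℕ → ℕ → List Involution
shapes m = shift (2 + m) (spread (evens (involutions (suc m))))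

shapes⁻ : ∀ m {n o} → o ∈ shapes m n → Good (suc m) o × T (isEvenℕ (cycles o)) × sizeI o ≡ n
shapes⁻ m {n} p
  with d , refl , q ← ∈-shift⁻ (2 + m) _ n p
  with c , refl , r ← ∈-spread⁻ (evens (involutions (suc m))) d q
  with even , s ← ∈-evens⁻ (involutions (suc m)) c r
  with refl , good ← sound (involutions-enumerate (suc m)) {n = c} s = good , even , Good⇒size good

shapes⁺ : ∀ m {o} → Good (suc m) o → T (isEvenℕ (cycles o)) → o ∈ shapes m (sizeI o)
shapes⁺ m {o} good even = subst (λ n → o ∈ shapes m n) (sym (Good⇒size good))
  (∈-shift⁺ (2 + m) _ (cycles o + cycles o) (∈-spread⁺ (evens (involutions (suc m))) (cycles o)
    (∈-evens⁺ (involutions (suc m)) (cycles o) even (complete (involutions-enumerate (suc m)) good))))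

-- The filtered permutations and the words of the shapes are two duplicate-free lists with the same
-- members, so they have equal length.
Je-shapes : ∀ m n → Je (p2134 (3 + m)) 1 n ≡ length (shapes m n)
Je-shapes m n = trans
  (unique-length {xs = filterᵇ good? (perms n)} {ys = map wordI (shapes m n)}
    (Unique.filter⁺ (T? ∘ good?) (Unique.filter⁺ (T? ∘ distinct) (words-unique n n)))
    (Unique.map⁺ (wordI-injective _ _) (shift-unique (2 + m) (spread-unique (evens-unique (unique (involutions-enumerate (suc m))))) n))
    to from)
  (length-map wordI (shapes m n))
  where
  τ = p2134 (3 + m)
  good? = counted τ 1
  to : ∀ {w} → w ∈ filterᵇ good? (perms n) → w ∈ map wordI (shapes m n)
  to {w} p
    with w∈ , t ← ∈-filter⁻ (T? ∘ good?) {xs = perms n} p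
    with len , w< ← ∈-words⁻ n n (proj₁ (∈-filter⁻ (T? ∘ distinct) {xs = words n n} w∈))
    with inv , t′ ← T-∧⁻ {isInvolution w} t
    with even , t″ ← T-∧⁻ {isEvenℕ (inversions w)} t′
    with once132 , onceτ ← T-∧⁻ {occurrences p132 w ≡ᵇ 1} t″
    with o , refl ← involution-complete (length w) w ≤-refl
           (isInvolution⁻ w (subst (λ k → All (_< k) w) (sym len) w<) inv)
           (trans (sym (occurrences-132 w)) (≡ᵇ⇒≡ _ 1 once132))
    = ∈-map⁺ wordI (subst (λ k → o ∈ shapes m k) (trans (sym (wordI-length o)) len)
        (shapes⁺ m (once⇒Good m o (trans (sym (count2134-wordI (suc m) o)) (trans (sym (occurrences-2134 (suc m) w)) (≡ᵇ⇒≡ _ 1 onceτ))))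
          (subst T (trans (cong isEvenℕ (trans (inversions-count w) (count2134-wordI 0 o))) (inversions-parity o)) even)))
  from : ∀ {w} → w ∈ map wordI (shapes m n) → w ∈ filterᵇ good? (perms n)
  from p
    with o , o∈ , refl ← ∈-map⁻ wordI p
    with good , even , refl ← shapes⁻ m {n} o∈
    = ∈-filter⁺ (T? ∘ good?)
        (∈-filter⁺ (T? ∘ distinct)
          (subst (λ k → wordI o ∈ words (sizeI o) k) (wordI-length o) (∈-words⁺ (sizeI o) (wordI-bound o)))
          (distinct-intro (wordI o) (SelfInverse⇒Injective (wordI-selfInverse o))))
        (T-∧⁺ {isInvolution (wordI o)} (isInvolution⁺ (wordI o) (wordI-selfInverse o))
          (T-∧⁺ {isEvenℕ (inversions (wordI o))}
            (subst T (sym (trans (cong isEvenℕ (trans (inversions-count (wordI o)) (count2134-wordI 0 o))) (inversions-parity o))) even)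
            (T-∧⁺ {occurrences p132 (wordI o) ≡ᵇ 1}
              (≡⇒≡ᵇ _ 1 (trans (occurrences-132 (wordI o)) (count132-wordI o)))
              (≡⇒≡ᵇ _ 1 (trans (occurrences-2134 (suc m) (wordI o)) (trans (count2134-wordI (suc m) o) (Good⇒once good)))))))

-- One occurrence of 21 is one inversion, so the permutation is odd. The shapes do not cover this
-- case: `Good 0` holds of 132 alone, while 1324 also has just one 21 and one 132.
Je-21 : ∀ n → Je (p2134 2) 1 n ≡ 0
Je-21 n = cong length (filter-none (T? ∘ counted (p2134 2) 1) (All.universal odd (perms n)))
  where
  odd : ∀ w → ¬ T (counted (p2134 2) 1 w)
  odd w t
    with even , t″ ← T-∧⁻ {isEvenℕ (inversions w)} (proj₂ (T-∧⁻ {isInvolution w} t))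
    with _ , once ← T-∧⁻ {occurrences p132 w ≡ᵇ 1} t″
    = subst (T ∘ isEvenℕ) (trans (inversions-count w) (trans (sym (occurrences-2134 0 w)) (≡ᵇ⇒≡ _ 1 once))) even

open import Data.Integer using (+_)

theorem3p26 : (k : ℕ) → 2 ≤ k → (n : ℕ) →
    + Je (p2134 k) 1 n
    ≡ ((one ⊖ X^ 2)
    ⊛ sumFromTo 2 (k ∸ 1) (λ j →
    X^ (k + 2 ∸ j) ⊛ sq (Re j) ⊛ prodFromTo (j + 1) k (λ i → sq (negArg (R i)))
    ⊛ invU (j + 1))) n
theorem3p26 (suc zero) (s≤s ()) n
theorem3p26 (suc (suc zero)) _ n = trans (cong pos (Je-21 n)) (sym (trans
  (coeff (⊛-congˡ (one ⊖ X^ 2) (pointwise {sumFromTo 2 1 (term 2)} {const (pos 0)} λ { zero → refl ; (suc _) → refl })) n)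
  (trans (coeff (S.zeroʳ (one ⊖ X^ 2)) n) (const-0 n))))
  where
  const-0 : ∀ n → const (pos 0) n ≡ pos 0
  const-0 zero    = refl
  const-0 (suc n) = refl
-- Here `k` is `3 + m`, and g_k is `cycleSeries (suc m)`, since the index of `cycleSeries` is
-- `k - 2`.
theorem3p26 (suc (suc (suc m))) _ n = trans (cong pos (Je-shapes m n)) (coeff (S.trans counting-shapes (S.sym (sumFromTo-term (suc m)))) n)
  where
  counting-shapes : counting (shapes m) ≈ (X^ (2 + m) ⊛ sq (evenPart (cycleSeries (suc m))))
  counting-shapes = begin
    counting (shapes m)
      ≈⟨ counting-shift (2 + m) (spread (evens (involutions (suc m)))) ⟩
    X^ (2 + m) ⊛ counting (spread (evens (involutions (suc m))))
      ≈⟨ ⊛-congˡ (X^ (2 + m)) (S.trans (counting-spread (evens (involutions (suc m)))) (sq-cong (counting-evens (involutions (suc m))))) ⟩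
    X^ (2 + m) ⊛ sq (evenPart (counting (involutions (suc m))))
      ≈⟨ ⊛-congˡ (X^ (2 + m)) (sq-cong (evenPart-cong (counting-involutions (suc m)))) ⟩
    X^ (2 + m) ⊛ sq (evenPart (cycleSeries (suc m))) ∎
    where open ≈-Reasoning
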